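{- Assume $\omega_a\ne0$ and $\omega_{ -b}\ne0$. Then, in $K[u][[z]]$, $$\sum_{k\ge0}\sum_{\ell=0}^{k}F_{k,\ell}\,u^\ell z^k=\frac{\widetilde N(u,z)}{\widetilde D(uz)\,D(z)},$$ where $D(z)=\det(1-z\mathbf T)$, $\widetilde D(z)=\det(1-z\widetilde{\mathbf T})$, and $\widetilde N(u,z)$ is the $(\widetilde I_0,I_0)$ entry of the matrix $\operatorname{adj}(1-uz\widetilde{\mathbf T})\,\mathbf U\,\operatorname{adj}(1-z\mathbf T)$ (adj denoting the adjugate, i.e. the transposed cofactor matrix), a polynomial in $u,z$. Moreover $D(z)$ has degree $\binom{a+b}{a}$, $\widetilde D(z)$ has degree $\binom{a+b}{a-1}$, and, as a polynomial in $z$, $\widetilde N(u,z)$ has degree $\binom{a+b+1}{a}-a-b-1$ with leading coefficient equal to $c\,u^{\binom{a+b}{a-1}-a}$ for some nonzero $c\in K$.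
   Context: Let $S$ be a finite set of integers with $a:=\max S\ge 1$ and $b:=-\min S\ge 1$. Each $s\in S$ carries a weight $\omega_s$ in a field $K$ of characteristic $0$; set $\omega_s:=0$ for $s\in\mathbb Z\setminus S$, and for $s\in\mathbb Z$ put $\beta_s:=\delta_{s,0}-\omega_s$ and $\widetilde\beta_s:=-\beta_{s+1}$. For $k\ge0$, $A_k$ is the $(k+1)\times(k+1)$ matrix with rows and columns indexed by $0,\dots,k$ whose $(i,j)$ entry is $\omega_{j-i}$. For $0\le\ell\le k$, $F_{k,\ell}$ is the $(\ell,0)$ cofactor of $1-A_k$, i.e. $(-1)^\ell$ times the determinant of the matrix obtained from $1-A_k$ by deleting row $\ell$ and column $0$. Notation: $[m,n]:=\{i\in\mathbb Z: m\le i\le n\}$, $X+c:=\{x+c:x\in X\}$; an $n$-subset is a subset of cardinality $n$. $I_0:=[0,a-1]$, $\widetilde I_0:=[0,a-2]$ (empty if $a=1$). For a finite set $I\subseteq\mathbb Z$ and $s\in\mathbb Z$, $\epsilon_s(I):=(-1)^{\#\{i\in I:\ i<s\}}$. $\mathbf T$ is the square matrix with rows and columns indexed by the $a$-subsets of $[-b,a-1]$ and entries $\mathbf T[I,J]:=\epsilon_s(I)\beta_s$ if there is an integer $s$ with $I\cup\{a\}=(J+1)\cup\{s\}$ (such $s$ is then unique), and $0$ otherwise. $\widetilde{\mathbf T}$ is the square matrix indexed by the $(a-1)$-subsets of $[-b-1,a-2]$ with $\widetilde{\mathbf T}[I,J]:=\epsilon_s(I)\widetilde\beta_s$ if there is an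 integer $s$ with $I\cup\{a-1\}=(J+1)\cup\{s\}$, and $0$ otherwise. $\mathbf U$ is the matrix with rows indexed by the $(a-1)$-subsets of $[-b-1,a-2]$ and columns by the $a$-subsets of $[-b,a-1]$, with $\mathbf U[I,J]=1$ if $I\cup\{a-1\}=J$ and $0$ otherwise. -}

module Defs where

open import Algebra.Apartness.Bundles using (HeytingField; HeytingCommutativeRing)
open import Algebra.Bundles using (CommutativeRing; RawRing)
import Algebra.Definitions.RawSemiring as RawSemiringDefinitions
open import Data.Fin.Base using (Fin; zero; suc; toℕ; punchIn)
import Data.Fin.Properties as Fin
open import Data.Integer.Base as ℤ using (ℤ; +_; -[1+_])
import Data.Integer.Properties as ℤ
open import Data.Integer.Tactic.RingSolver using (solve-∀)
open import Data.List.Base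
  using (List; []; _∷_; _++_; map; foldr; filter; length; lookup; tabulate)
open import Data.List.Membership.DecPropositional ℤ._≟_ using (_∈?_)
open import Data.List.Membership.Propositional using (_∈_; lose)
import Data.List.Membership.Propositional.Properties as ∈
open import Data.List.Relation.Binary.Sublist.Propositional as Sublist
  using ([]; _∷_; _∷ʳ_) renaming (_⊆_ to _⊑_)
import Data.List.Relation.Binary.Sublist.Propositional.Properties as Sublist
open import Data.List.Relation.Binary.Subset.DecPropositional ℤ._≟_ using (_⊆_; _⊆?_)
open import Data.List.Relation.Unary.All using (All)
open import Data.List.Relation.Unary.Any using (any?; here; index; satisfied)
open import Data.Nat.Base as ℕ using (ℕ; zero; suc; pred; _∸_)
open import Data.Product.Base using (_×_; _,_; proj₂; ∃)
open import Function.Base using (_∘_)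
open import Level using (Level; _⊔_)
open import Relation.Binary.PropositionalEquality
  using (_≡_; refl; sym; trans; cong; subst)
open import Relation.Nullary.Decidable using (Dec; yes; no; map′; _×-dec_)

private
  variable
    c ℓ c′ ℓ′ ℓ₁ ℓ₂ : Level

------------------------------------------------------------------------
-- Matrices, determinants and adjugates

module Matrices (R : RawRing c ℓ) where
  open RawRing R
  open RawSemiringDefinitions rawSemiring using (sum; _^_)

  Matrix : ℕ → ℕ → Set c
  Matrix m n = Fin m → Fin n → Carrier

  identity : ∀ {n} → Matrix n n
  identity i j with i Fin.≟ j
  ... | yes _ = 1#
  ... | no  _ = 0#

  infixl 6 _⊖_
  _⊖_ : ∀ {m n} → Matrix m n → Matrix m n → Matrix m n
  (M ⊖ N) i j = M i j + - N i j

  infixr 8 _·_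
  _·_ : ∀ {m n} → Carrier → Matrix m n → Matrix m n
  (x · M) i j = x * M i j

  infixl 7 _⊗_
  _⊗_ : ∀ {l m n} → Matrix l m → Matrix m n → Matrix l n
  (M ⊗ N) i j = sum λ k → M i k * N k j

  minor : ∀ {m n} → Matrix (suc m) (suc n) → Fin (suc m) → Fin (suc n) → Matrix m n
  minor M i j p q = M (punchIn i p) (punchIn j q)

  -- Laplace expansion along row 0.
  det : ∀ {n} → Matrix n n → Carrier
  det {zero}  M = 1#
  det {suc n} M = sum λ j → M zero j * ((- 1#) ^ toℕ j * det (minor M zero j))

  cofactor : ∀ {n} → Matrix n n → Fin n → Fin n → Carrier
  cofactor {suc n} M i j = (- 1#) ^ (toℕ i ℕ.+ toℕ j) * det (minor M i j)

  adj : ∀ {n} → Matrix n n → Matrix n n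
  adj M i j = cofactor M j i

------------------------------------------------------------------------
-- Polynomials and formal power series

-- Coefficient lists, constant term first; trailing zeros are allowed and are
-- ignored by the equality.
module Polynomials (R : RawRing c ℓ) where
  open RawRing R

  Poly : Set c
  Poly = List Carrier

  coeff : Poly → ℕ → Carrier
  coeff []      n       = 0#
  coeff (x ∷ p) zero    = x
  coeff (x ∷ p) (suc n) = coeff p n

  _≈ₚ_ : Poly → Poly → Set ℓ
  p ≈ₚ q = ∀ n → coeff p n ≈ coeff q n

  _+ₚ_ : Poly → Poly → Poly
  []      +ₚ q       = q
  (x ∷ p) +ₚ []      = x ∷ p
  (x ∷ p) +ₚ (y ∷ q) = (x + y) ∷ (p +ₚ q)

  _*ₚ_ : Poly → Poly → Poly
  []      *ₚ q = []
  (x ∷ p) *ₚ q = map (x *_) q +ₚ (0# ∷ (p *ₚ q))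

  constant : Carrier → Poly
  constant x = x ∷ []

  X : Poly
  X = 0# ∷ 1# ∷ []

  rawRing : RawRing c ℓ
  rawRing = record
    { Carrier = Poly
    ; _≈_     = _≈ₚ_
    ; _+_     = _+ₚ_
    ; _*_     = _*ₚ_
    ; -_      = map -_
    ; 0#      = []
    ; 1#      = constant 1#
    }

  DegreeAtMost : Poly → ℕ → Set ℓ
  DegreeAtMost p n = ∀ m → n ℕ.< m → coeff p m ≈ 0#

-- The value p(x), for p with coefficients mapped along ι.
evaluate : (R : RawRing c ℓ) (A : RawRing c′ ℓ′) →
           (RawRing.Carrier R → RawRing.Carrier A) →
           List (RawRing.Carrier R) → RawRing.Carrier A → RawRing.Carrier A
evaluate R A ι p x = foldr (λ r v → ι r + x * v) 0# p
  where open RawRing A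

module PowerSeries (R : RawRing c ℓ) where
  open RawRing R
  open RawSemiringDefinitions rawSemiring using (sum)

  rawRing : RawRing c ℓ
  rawRing = record
    { Carrier = ℕ → Carrier
    ; _≈_     = λ f g → ∀ n → f n ≈ g n
    ; _+_     = λ f g n → f n + g n
    ; _*_     = λ f g n → sum λ (i : Fin (suc n)) → f (toℕ i) * g (n ∸ toℕ i)
    ; -_      = λ f n → - f n
    ; 0#      = λ _ → 0#
    ; 1#      = λ { zero → 1# ; (suc _) → 0# }
    }

-- f = p / q, including the claim that q is invertible.
IsFraction : (R : RawRing c ℓ) (f p q : RawRing.Carrier R) → Set (c ⊔ ℓ)
IsFraction R f p q = ∃ λ q⁻¹ → q * q⁻¹ ≈ 1# × f ≈ p * q⁻¹
  where open RawRing R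

------------------------------------------------------------------------
-- Finite sets of integers, represented by lists

infix 4 _≐_ _≐?_

_≐_ : List ℤ → List ℤ → Set
X ≐ Y = X ⊆ Y × Y ⊆ X

_≐?_ : ∀ X Y → Dec (X ≐ Y)
X ≐? Y = (X ⊆? Y) ×-dec (Y ⊆? X)

_IsMaximumOf_ : ℤ → List ℤ → Set
m IsMaximumOf S = m ∈ S × All (ℤ._≤ m) S

_IsMinimumOf_ : ℤ → List ℤ → Set
m IsMinimumOf S = m ∈ S × All (m ℤ.≤_) S

natPart : ℤ → ℕ
natPart (+ n)    = n
natPart -[1+ _ ] = 0

consecutive : ℤ → ℕ → List ℤ
consecutive m zero    = []
consecutive m (suc l) = m ∷ consecutive (ℤ.suc m) l

[_⋯_] : ℤ → ℤ → List ℤ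
[ m ⋯ n ] = consecutive m (natPart (n ℤ.- m ℤ.+ ℤ.1ℤ))

-- The n-subsets of X, each listed once and in the order of X (if X has no
-- repeated elements).
subsets : ∀ {A : Set} → ℕ → List A → List (List A)
subsets zero    X       = [] ∷ []
subsets (suc n) []      = []
subsets (suc n) (x ∷ X) = map (x ∷_) (subsets n X) ++ subsets (suc n) X

-- With X + 1 the translate of X:  is there s with  I ∪ {t} = (J + 1) ∪ {s} ?
-- Such an s lies in I ∪ {t}, so the search is finite.
shift? : ∀ t I J → Dec (∃ λ s → t ∷ I ≐ s ∷ map ℤ.suc J)
shift? t I J = map′ satisfied
  (λ (s , eq) → lose (proj₂ eq (here refl)) eq)
  (any? (λ s → t ∷ I ≐? s ∷ map ℤ.suc J) (t ∷ I))

private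
  ⊑⇒∈subsets : ∀ {A : Set} {X Y : List A} → X ⊑ Y → X ∈ subsets (length X) Y
  ⊑⇒∈subsets {X = []}              _          = here refl
  ⊑⇒∈subsets {X = x ∷ X} {y ∷ Y}   (_ ∷ʳ X⊑Y) =
    ∈.∈-++⁺ʳ (map (y ∷_) (subsets (length X) Y)) (⊑⇒∈subsets X⊑Y)
  ⊑⇒∈subsets                       (refl ∷ X⊑Y) =
    ∈.∈-++⁺ˡ (∈.∈-map⁺ (_ ∷_) (⊑⇒∈subsets X⊑Y))

  length-consecutive : ∀ m l → length (consecutive m l) ≡ l
  length-consecutive m zero    = refl
  length-consecutive m (suc l) = cong suc (length-consecutive (ℤ.suc m) l)

  natPart-pred : ∀ i → natPart (i ℤ.- ℤ.1ℤ) ≡ pred (natPart i)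
  natPart-pred (+ zero)  = refl
  natPart-pred (+ suc n) = refl
  natPart-pred -[1+ n ]  = refl

  consecutive-tail : ∀ m l → consecutive (ℤ.suc m) (pred l) ⊑ consecutive m l
  consecutive-tail m zero    = []
  consecutive-tail m (suc l) = m ∷ʳ Sublist.⊆-refl

  interval-tail : ∀ m n → [ ℤ.suc m ⋯ n ] ⊑ [ m ⋯ n ]
  interval-tail m n = subst (λ l → consecutive (ℤ.suc m) l ⊑ [ m ⋯ n ])
    (sym (trans (cong natPart (identity m n)) (natPart-pred (n ℤ.- m ℤ.+ ℤ.1ℤ))))
    (consecutive-tail m _)
    where
    identity : ∀ m n → n ℤ.- (ℤ.1ℤ ℤ.+ m) ℤ.+ ℤ.1ℤ ≡ n ℤ.- m ℤ.+ ℤ.1ℤ ℤ.- ℤ.1ℤ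
    identity = solve-∀

  interval-suffix : ∀ k m n → [ + k ℤ.+ m ⋯ n ] ⊑ [ m ⋯ n ]
  interval-suffix zero    m n =
    subst (λ i → [ i ⋯ n ] ⊑ [ m ⋯ n ]) (sym (ℤ.+-identityˡ m)) Sublist.⊆-refl
  interval-suffix (suc k) m n = Sublist.⊆-trans
    (subst (λ i → [ i ⋯ n ] ⊑ [ + k ℤ.+ m ⋯ n ])
      (sym (ℤ.+-assoc ℤ.1ℤ (+ k) m)) (interval-tail (+ k ℤ.+ m) n))
    (interval-suffix k m n)

  interval∈subsets : ∀ k l m n → + k ℤ.+ m ≡ ℤ.0ℤ → natPart (n ℤ.+ ℤ.1ℤ) ≡ l →
                     [ ℤ.0ℤ ⋯ n ] ∈ subsets l [ m ⋯ n ]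
  interval∈subsets k l m n k+m≡0 size≡l = subst (λ j → [ ℤ.0ℤ ⋯ n ] ∈ subsets j [ m ⋯ n ])
    (trans (length-consecutive ℤ.0ℤ _)
      (trans (cong (λ i → natPart (i ℤ.+ ℤ.1ℤ)) (ℤ.+-identityʳ n)) size≡l))
    (⊑⇒∈subsets (subst (λ i → [ i ⋯ n ] ⊑ [ m ⋯ n ]) k+m≡0 (interval-suffix k m n)))

------------------------------------------------------------------------

fieldRing : HeytingField c ℓ₁ ℓ₂ → RawRing c ℓ₁
fieldRing K = CommutativeRing.rawRing
  (HeytingCommutativeRing.commutativeRing (HeytingField.heytingCommutativeRing K))

CharacteristicZero : HeytingField c ℓ₁ ℓ₂ → Set ℓ₁
CharacteristicZero K = ∀ n → n ×ᴷ 1# ≈ 0# → n ≡ 0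
  where
  open HeytingField K using (_≈_; 0#; 1#)
  open RawSemiringDefinitions (RawRing.rawSemiring (fieldRing K)) renaming (_×_ to _×ᴷ_)

-- The values of weight outside S are never used.
module Setup (K : HeytingField c ℓ₁ ℓ₂)
             (S : List ℤ) (weight : ℤ → HeytingField.Carrier K) (a b : ℕ) where

  open HeytingField K using (Carrier; _≈_; _#_; 0#; 1#)
    renaming (_+_ to _+ᴷ_; _*_ to _*ᴷ_; -_ to -ᴷ_)
  open RawSemiringDefinitions (RawRing.rawSemiring (fieldRing K))
    using () renaming (_^_ to _^ᴷ_)

  K[u] : RawRing c ℓ₁
  K[u] = Polynomials.rawRing (fieldRing K)

  K[u][z] : RawRing c ℓ₁
  K[u][z] = Polynomials.rawRing K[u]

  K[u]⟦z⟧ : RawRing c ℓ₁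
  K[u]⟦z⟧ = PowerSeries.rawRing K[u]

  K[z] : RawRing c ℓ₁
  K[z] = Polynomials.rawRing (fieldRing K)

  module KM   = Matrices (fieldRing K)
  module KzM  = Matrices K[z]
  module KuzM = Matrices K[u][z]
  module KP   = Polynomials (fieldRing K)
  module KuP  = Polynomials K[u]

  u z : RawRing.Carrier K[u][z]
  u = KuP.constant KP.X
  z = KuP.X

  ι : Carrier → RawRing.Carrier K[u][z]
  ι x = KuP.constant (KP.constant x)

  ω : ℤ → Carrier
  ω s with s ∈? S
  ... | yes _ = weight s
  ... | no  _ = 0#

  β : ℤ → Carrier
  β s with s ℤ.≟ ℤ.0ℤ
  ... | yes _ = 1# +ᴷ (-ᴷ ω s)
  ... | no  _ = 0# +ᴷ (-ᴷ ω s)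

  β̃ : ℤ → Carrier
  β̃ s = -ᴷ β (ℤ.suc s)

  A : ∀ k → KM.Matrix (suc k) (suc k)
  A k i j = ω (+ toℕ j ℤ.- + toℕ i)

  F : ∀ k → Fin (suc k) → Carrier
  F k l = KM.cofactor (KM.identity KM.⊖ A k) l zero

  -- The coefficient of z^k is the polynomial Σ_ℓ F_{k,ℓ} u^ℓ.
  generatingFunction : RawRing.Carrier K[u]⟦z⟧
  generatingFunction k = tabulate (F k)

  ε : ℤ → List ℤ → Carrier
  ε s I = (-ᴷ 1#) ^ᴷ length (filter (ℤ._<? s) I)

  transferEntry : ℤ → (ℤ → Carrier) → List ℤ → List ℤ → Carrier
  transferEntry t γ I J with shift? t I J
  ... | yes (s , _) = ε s I *ᴷ γ s
  ... | no  _       = 0#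

  unionEntry : ℤ → List ℤ → List ℤ → Carrier
  unionEntry t I J with t ∷ I ≐? J
  ... | yes _ = 1#
  ... | no  _ = 0#

  indices : List (List ℤ)
  indices = subsets a [ ℤ.- (+ b) ⋯ + a ℤ.- + 1 ]

  indices̃ : List (List ℤ)
  indices̃ = subsets (a ∸ 1) [ ℤ.- (+ b) ℤ.- + 1 ⋯ + a ℤ.- + 2 ]

  T : KM.Matrix (length indices) (length indices)
  T i j = transferEntry (+ a) β (lookup indices i) (lookup indices j)

  T̃ : KM.Matrix (length indices̃) (length indices̃)
  T̃ i j = transferEntry (+ a ℤ.- + 1) β̃ (lookup indices̃ i) (lookup indices̃ j)

  U : KM.Matrix (length indices̃) (length indices)
  U i j = unionEntry (+ a ℤ.- + 1) (lookup indices̃ i) (lookup indices j)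

  I₀ : List ℤ
  I₀ = [ ℤ.0ℤ ⋯ + a ℤ.- + 1 ]

  Ĩ₀ : List ℤ
  Ĩ₀ = [ ℤ.0ℤ ⋯ + a ℤ.- + 2 ]

  I₀∈indices : I₀ ∈ indices
  I₀∈indices = interval∈subsets b a (ℤ.- (+ b)) (+ a ℤ.- + 1)
    (ℤ.+-inverseʳ (+ b)) (cong natPart (arith (+ a)))
    where
    arith : ∀ i → i ℤ.- + 1 ℤ.+ + 1 ≡ i
    arith = solve-∀

  Ĩ₀∈indices̃ : Ĩ₀ ∈ indices̃
  Ĩ₀∈indices̃ = interval∈subsets (suc b) (a ∸ 1)
    (ℤ.- (+ b) ℤ.- + 1) (+ a ℤ.- + 2) (start (+ b))
    (trans (cong natPart (arith (+ a))) (trans (natPart-pred (+ a)) (pred≡∸1 a)))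
    where
    start : ∀ i → + 1 ℤ.+ i ℤ.+ (ℤ.- i ℤ.- + 1) ≡ ℤ.0ℤ
    start = solve-∀
    arith : ∀ i → i ℤ.- + 2 ℤ.+ + 1 ≡ i ℤ.- + 1
    arith = solve-∀
    pred≡∸1 : ∀ n → pred n ≡ n ∸ 1
    pred≡∸1 zero    = refl
    pred≡∸1 (suc n) = refl

  D : RawRing.Carrier K[z]
  D = KzM.det (KzM.identity KzM.⊖ KP.X KzM.· (λ i j → KP.constant (T i j)))

  D̃ : RawRing.Carrier K[z]
  D̃ = KzM.det (KzM.identity KzM.⊖ KP.X KzM.· (λ i j → KP.constant (T̃ i j)))

  Ñ : RawRing.Carrier K[u][z]
  Ñ = (KuzM.adj (KuzM.identity KuzM.⊖ (u * z) KuzM.· (λ i j → ι (T̃ i j)))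
        KuzM.⊗ (λ i j → ι (U i j))
        KuzM.⊗ KuzM.adj (KuzM.identity KuzM.⊖ z KuzM.· (λ i j → ι (T i j))))
      (index Ĩ₀∈indices̃) (index I₀∈indices)
    where open RawRing K[u][z] using (_*_)

  denominator : RawRing.Carrier K[u][z]
  denominator = (D̃ ⟨ u * z ⟩) * (D ⟨ z ⟩)
    where
    open RawRing K[u][z] using (_*_)
    _⟨_⟩ : RawRing.Carrier K[z] → RawRing.Carrier K[u][z] → RawRing.Carrier K[u][z]
    p ⟨ x ⟩ = evaluate (fieldRing K) K[u][z] ι p x

  toSeries : RawRing.Carrier K[u][z] → RawRing.Carrier K[u]⟦z⟧
  toSeries = KuP.coeff

  HasDegree : RawRing.Carrier K[z] → ℕ → Set (ℓ₁ ⊔ ℓ₂)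
  HasDegree p n = KP.coeff p n # 0# × KP.DegreeAtMost p n

  _u^_ : Carrier → ℕ → RawRing.Carrier K[u]
  x u^ e = KP.constant x * (KP.X ^ e)
    where
    open RawRing K[u] using (_*_; rawSemiring)
    open RawSemiringDefinitions rawSemiring using (_^_)

{-# OPTIONS --safe #-}
module Submission where

-- The transfer matrix acts on functions of lists as a contraction:
-- (T f)(I) = δ_β (f ∘ map pred) (I ∷ʳ a), where δ_v is interior multiplication by v,
-- which removes one element x from a list with weight ± v x.  A determinant is the
-- iterated contraction by its rows, and therefore (T̃ˡ U Tᵏ⁻ˡ)[Ĩ₀, I₀] is the Laplace
-- expansion of the minor defining F_{k,ℓ}.  So the generating function is
-- ((1 - uzT̃)⁻¹ U (1 - zT)⁻¹)[Ĩ₀, I₀], which Cramer's rule turns into the fraction.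
--
-- Since δ_β² = 0, the transfer in the opposite direction, f ↦ δ_β f (-b ∷ map suc J),
-- inverts T up to the scalar ± β_a β_{-b}; hence D and D̃ have full degree.
-- For the degree of Ñ, expand at z = ∞: the first a - 1 backward steps from Ĩ₀ and
-- the last b backward steps to I₀ are forced and give nothing that U can connect,
-- and after one more step on each side exactly one subset, [-b, a-b-2], is left.

open import Defs
open import Algebra.Apartness.Bundles using (HeytingField; HeytingCommutativeRing)
open import Algebra.Bundles using (CommutativeRing; RawRing)
import Algebra.Morphism.Construct.Composition as Composition
import Algebra.Morphism.RingMonomorphism as RingMonomorphism
open import Algebra.Morphism.Structures using (IsRingHomomorphism)
import Algebra.Properties.AbelianGroup as AbelianGroupProperties
import Algebra.Properties.CommutativeSemiring.Exp as CommutativeSemiringExp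
import Algebra.Properties.Ring as RingProperties
import Algebra.Properties.Semiring.Exp as SemiringExp
import Algebra.Properties.Semiring.Mult as SemiringMult
import Algebra.Properties.Semiring.Mult.TCOptimised as SemiringMultTCO
import Algebra.Properties.Semiring.Sum as SemiringSum
import Algebra.Solver.Ring as RingSolver
open import Algebra.Solver.Ring.AlmostCommutativeRing
  using (fromCommutativeRing; _-Raw-AlmostCommutative⟶_)
open import Algebra.Structures using (IsCommutativeRing)
open import Data.Fin.Base as Fin
  using (Fin; zero; suc; toℕ; punchIn; punchOut; inject₁; fromℕ)
import Data.Fin.Properties as Fin
open import Data.Integer.Base as ℤ using (ℤ; +_)
import Data.Integer.Properties as ℤ
open import Data.Integer.Tactic.RingSolver using (solve-∀)
open import Data.List.Base
  using (List; []; _∷_; _++_; _∷ʳ_; map; length; tabulate; allFin; filter; lookup)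
import Data.List.Properties as List
open import Data.List.Membership.DecPropositional ℤ._≟_ using (_∈?_)
open import Data.List.Membership.Propositional using (_∈_; _∉_)
import Data.List.Membership.Propositional.Properties as ∈
import Data.List.Relation.Binary.Pointwise as Pointwise
open import Data.List.Relation.Binary.Permutation.Propositional using (_↭_; ↭-sym; ↭-trans)
open import Data.List.Relation.Binary.Permutation.Propositional.Properties
  using (∷↭∷ʳ; shift; ∈-resp-↭)
import Data.List.Relation.Binary.Sublist.Heterogeneous.Properties as HeterogeneousSublist
open import Data.List.Relation.Binary.Sublist.Propositional
  using ([]; _∷_; minimum) renaming (_⊆_ to _⊑_; _∷ʳ_ to skip; lookup to ⊑⇒⊆)
import Data.List.Relation.Binary.Sublist.Propositional.Properties as PropositionalSublist
open import Data.List.Relation.Unary.All as All using (All; []; _∷_)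
import Data.List.Relation.Unary.All.Properties as All
open import Data.List.Relation.Unary.AllPairs as AllPairs using (AllPairs; []; _∷_)
import Data.List.Relation.Unary.AllPairs.Properties as AllPairs
open import Data.List.Relation.Unary.Any using (here; there; index)
open import Data.List.Relation.Unary.Any.Properties using (lookup-index)
open import Data.List.Relation.Unary.Unique.Propositional using (Unique)
import Data.List.Relation.Unary.Unique.Propositional.Properties as Unique
open import Data.Maybe.Base using (Maybe; just; nothing)
open import Data.Nat.Base as ℕ using (ℕ; zero; suc; _∸_; _<_; s≤s; z≤n)
open import Data.Nat.Combinatorics using (_C_; nCk+nC[k+1]≡[n+1]C[k+1])
import Data.Nat.Properties as ℕ
open import Data.Product.Base using (_×_; _,_; proj₁; proj₂; ∃; ∃₂)
open import Data.Sum.Base using (_⊎_; inj₁; inj₂)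
open import Function.Base using (_∘_; id; _⟨_⟩_)
open import Level using (Level; _⊔_)
open import Relation.Binary.Core using (Rel)
open import Relation.Binary.Definitions using (Transitive; Irreflexive; tri<; tri≈; tri>)
open import Relation.Binary.PropositionalEquality as ≡ using (_≡_; _≢_)
import Relation.Binary.Reasoning.Setoid as SetoidReasoning
open import Relation.Nullary.Decidable using (Dec; yes; no)
open import Relation.Nullary.Negation using (¬_; contradiction)

-- Two mismatches shape the proof. `T` acts on the subsets of a finite window, while contraction is
-- defined on all lists. A removal followed by a shift can leave the window only at its lower end,
-- so the functions involved are required to vanish on lists whose head lies below the window; and
-- the letters a, a+1, ... that successive steps append are placed at the end of the list in
-- advance, which is harmless because β vanishes above a. The cofactor sign is the other point: the
-- minus sign in β̃, taken once for each of the l steps of T̃, produces exactly the factor (-1)^l,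
-- while the index shift in β̃ accounts for the rows above the deleted one.
--
-- The constants in the degree of Ñ count backward steps. Let m and n be the sizes of T̃ and T. The
-- a steps on the row side multiply Ñ by (uz)^a and the b + 1 steps on the column side by z^(b+1),
-- up to a unit of K. The product has degree m + n in z, and its top coefficient is a unit times
-- u^m, the power of u coming from the substitution of uz in D̃. Hence the degree m + n - (a + b +
-- 1) and the exponent m - a, and Pascal's rule evaluates m + n.

private
  variable
    c ℓ c′ ℓ′ ℓ₁ ℓ₂ : Level


-- The coefficients of the solver are formal differences of natural numbers.
module IntegerCoefficientSolver (R : CommutativeRing c ℓ) where
  open CommutativeRing R
  open RingProperties ring using (-0#≈0#; x[y-z]≈xy-xz; [y-z]x≈yx-zx)
  open AbelianGroupProperties +-abelianGroup
    using (⁻¹-∙-comm; ⁻¹-anti-homo‿-; x∙y⁻¹≈ε⇒x≈y)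
  open SemiringMult semiring using (×-homo-+; ×1-homo-*) renaming (_×_ to _∙_)
  open SemiringMultTCO semiring using (×ᵤ≈×) renaming (_×_ to _∙′_)
  open SetoidReasoning setoid

  private
    differences : RawRing _ _
    differences = record
      { Carrier = ℕ × ℕ
      ; _≈_     = _≡_
      ; _+_     = λ (a , b) (c , d) → a ℕ.+ c , b ℕ.+ d
      ; _*_     = λ (a , b) (c , d) → a ℕ.* c ℕ.+ b ℕ.* d , a ℕ.* d ℕ.+ b ℕ.* c
      ; -_      = λ (a , b) → b , a
      ; 0#      = 0 , 0
      ; 1#      = 1 , 0
      }

    ⟦_⟧ : ℕ × ℕ → Carrier
    ⟦ a , b ⟧ = a ∙ 1# - b ∙ 1#

    rearrange : ∀ w x y z → (w + x) - (y + z) ≈ (w - y) + (x - z)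
    rearrange w x y z = begin
      (w + x) - (y + z)       ≈⟨ +-congˡ (⁻¹-∙-comm y z) ⟨
      (w + x) + (- y + - z)   ≈⟨ +-assoc w x _ ⟩
      w + (x + (- y + - z))   ≈⟨ +-congˡ (+-assoc x (- y) (- z)) ⟨
      w + ((x + - y) + - z)   ≈⟨ +-congˡ (+-congʳ (+-comm x (- y))) ⟩
      w + ((- y + x) + - z)   ≈⟨ +-congˡ (+-assoc (- y) x (- z)) ⟩
      w + (- y + (x - z))     ≈⟨ +-assoc w (- y) _ ⟨
      (w - y) + (x - z)       ∎

    *-homo : ∀ a b c d → ⟦ a ℕ.* c ℕ.+ b ℕ.* d , a ℕ.* d ℕ.+ b ℕ.* c ⟧ ≈
                         ⟦ a , b ⟧ * ⟦ c , d ⟧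
    *-homo a b c d = begin
      (a ℕ.* c ℕ.+ b ℕ.* d) ∙ 1# - (a ℕ.* d ℕ.+ b ℕ.* c) ∙ 1#
        ≈⟨ +-cong (product a c b d) (-‿cong (product a d b c)) ⟩
      (α * γ + β * δ) - (α * δ + β * γ)   ≈⟨ rearrange _ _ _ _ ⟩
      (α * γ - α * δ) + (β * δ - β * γ)   ≈⟨ +-congˡ (⁻¹-anti-homo‿- (β * γ) (β * δ)) ⟨
      (α * γ - α * δ) - (β * γ - β * δ)   ≈⟨ +-cong (x[y-z]≈xy-xz α γ δ) (-‿cong (x[y-z]≈xy-xz β γ δ)) ⟨
      α * (γ - δ) - β * (γ - δ)           ≈⟨ [y-z]x≈yx-zx (γ - δ) α β ⟨
      (α - β) * (γ - δ)                   ∎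
      where
      α = a ∙ 1#
      β = b ∙ 1#
      γ = c ∙ 1#
      δ = d ∙ 1#
      product : ∀ m n p q → (m ℕ.* n ℕ.+ p ℕ.* q) ∙ 1# ≈
                            (m ∙ 1#) * (n ∙ 1#) + (p ∙ 1#) * (q ∙ 1#)
      product m n p q = trans (×-homo-+ 1# (m ℕ.* n) (p ℕ.* q))
        (+-cong (×1-homo-* m n) (×1-homo-* p q))

    -- Equal to ⟦_⟧, but literally 0# and 1# at the constants 0 and 1.
    ⟪_⟫ : ℕ × ℕ → Carrier
    ⟪ a , zero  ⟫ = a ∙′ 1#
    ⟪ a , suc b ⟫ = ⟦ a , suc b ⟧

    ⟪⟫≈⟦⟧ : ∀ x → ⟪ x ⟫ ≈ ⟦ x ⟧
    ⟪⟫≈⟦⟧ (a , zero)  = trans (sym (×ᵤ≈× a 1#))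
      (sym (trans (+-congˡ -0#≈0#) (+-identityʳ _)))
    ⟪⟫≈⟦⟧ (a , suc b) = refl

    homomorphism : differences -Raw-AlmostCommutative⟶ fromCommutativeRing R
    homomorphism = record
      { ⟦_⟧    = ⟪_⟫
      ; +-homo = λ x@(a , b) y@(c , d) → trans (⟪⟫≈⟦⟧ (a ℕ.+ c , b ℕ.+ d)) (trans
          (trans (+-cong (×-homo-+ 1# a c) (-‿cong (×-homo-+ 1# b d))) (rearrange _ _ _ _))
          (sym (+-cong (⟪⟫≈⟦⟧ x) (⟪⟫≈⟦⟧ y))))
      ; *-homo = λ x@(a , b) y@(c , d) →
          trans (⟪⟫≈⟦⟧ (a ℕ.* c ℕ.+ b ℕ.* d , a ℕ.* d ℕ.+ b ℕ.* c)) (trans (*-homo a b c d)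
            (sym (*-cong (⟪⟫≈⟦⟧ x) (⟪⟫≈⟦⟧ y))))
      ; -‿homo = λ x@(a , b) → trans (⟪⟫≈⟦⟧ (b , a)) (trans
          (sym (⁻¹-anti-homo‿- (a ∙ 1#) (b ∙ 1#))) (sym (-‿cong (⟪⟫≈⟦⟧ x))))
      ; 0-homo = refl
      ; 1-homo = refl
      }

    -- Different pairs can represent the same integer, so coefficients are compared by cross
    -- addition. Plain equality of pairs would make the solver miss cancellations.
    decide : ∀ x y → Maybe (⟪ x ⟫ ≈ ⟪ y ⟫)
    decide x@(a , b) y@(c , d) with a ℕ.+ d ℕ.≟ c ℕ.+ b
    ... | no  _  = nothing
    ... | yes eq = just (trans (⟪⟫≈⟦⟧ x) (trans (x∙y⁻¹≈ε⇒x≈y _ _ (begin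
      ⟦ a , b ⟧ - ⟦ c , d ⟧           ≈⟨ +-congˡ (⁻¹-anti-homo‿- _ _) ⟩
      ⟦ a , b ⟧ + ⟦ d , c ⟧           ≈⟨ rearrange _ _ _ _ ⟨
      (a ∙ 1# + d ∙ 1#) - (b ∙ 1# + c ∙ 1#)
        ≈⟨ +-cong (×-homo-+ 1# a d) (-‿cong (×-homo-+ 1# b c)) ⟨
      (a ℕ.+ d) ∙ 1# - (b ℕ.+ c) ∙ 1#
        ≡⟨ ≡.cong (λ n → n ∙ 1# - (b ℕ.+ c) ∙ 1#) (≡.trans eq (ℕ.+-comm c b)) ⟩
      (b ℕ.+ c) ∙ 1# - (b ℕ.+ c) ∙ 1# ≈⟨ -‿inverseʳ _ ⟩
      0#                              ∎)) (sym (⟪⟫≈⟦⟧ y))))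

  open RingSolver differences (fromCommutativeRing R) homomorphism decide public
    using (solve; _:=_; _:+_; _:*_; _:-_; :-_; con; Polynomial)

  :0 :1 : ∀ {n} → Polynomial n
  :0 = con (0 , 0)
  :1 = con (1 , 0)

-- Formal power series and polynomials

mkIsRingHomomorphism : (R : RawRing c ℓ) (A : RawRing c′ ℓ′) →
  let module R = RawRing R
      module A = RawRing A
  in ∀ {f : R.Carrier → A.Carrier} → (∀ {x y} → x R.≈ y → f x A.≈ f y) →
  (∀ x y → f (x R.+ y) A.≈ f x A.+ f y) → f R.0# A.≈ A.0# →
  (∀ x y → f (x R.* y) A.≈ f x A.* f y) → f R.1# A.≈ A.1# → (∀ x → f (R.- x) A.≈ A.- f x) →
  IsRingHomomorphism R A f
mkIsRingHomomorphism R A cong homo-+ homo-0 homo-* homo-1 homo-neg = record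
  { isSemiringHomomorphism = record
    { isNearSemiringHomomorphism = record
      { +-isMonoidHomomorphism = record
        { isMagmaHomomorphism = record { isRelHomomorphism = record { cong = cong } ; homo = homo-+ }
        ; ε-homo = homo-0
        }
      ; *-homo = homo-*
      }
    ; 1#-homo = homo-1
    }
  ; -‿homo = homo-neg
  }

module Series (R : CommutativeRing c ℓ) where
  open CommutativeRing R hiding (isCommutativeRing)
  open SemiringSum semiring using (sum; sum-cong-≋)
  open SetoidReasoning setoid
  open RawRing (PowerSeries.rawRing rawRing)
    using () renaming (Carrier to Ser; _+_ to _⊕_; _*_ to _⊛_; _≈_ to _≋_; 1# to 𝟏; -_ to ⊝_; 0# to 𝟎)
  open IntegerCoefficientSolver R

  private
    ⊛-cong : ∀ {f f′ g g′ : Ser} → f ≋ f′ → g ≋ g′ → (f ⊛ g) ≋ (f′ ⊛ g′)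
    ⊛-cong f≋ g≋ n = sum-cong-≋ {suc n} (λ i → *-cong (f≋ (toℕ i)) (g≋ (n ∸ toℕ i)))

    ⊛-distribˡ : ∀ f g h → (f ⊛ (g ⊕ h)) ≋ ((f ⊛ g) ⊕ (f ⊛ h))
    ⊛-distribˡ f g h zero    = solve 3
      (λ x y z → x :* (y :+ z) :+ :0 := (x :* y :+ :0) :+ (x :* z :+ :0)) refl _ _ _
    ⊛-distribˡ f g h (suc n) = trans (+-congˡ (⊛-distribˡ (f ∘ suc) g h n)) (solve 5
      (λ x y z p q → x :* (y :+ z) :+ (p :+ q) := (x :* y :+ p) :+ (x :* z :+ q))
      refl _ _ _ _ _)

    ⊛-zeroˡ : ∀ f → (𝟎 ⊛ f) ≋ 𝟎
    ⊛-zeroˡ f zero    = solve 1 (λ x → :0 :* x :+ :0 := :0) refl _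
    ⊛-zeroˡ f (suc n) = trans (+-congˡ (⊛-zeroˡ f n)) (solve 1 (λ x → :0 :* x :+ :0 := :0) refl _)

    ⊛-identityˡ : ∀ f → (𝟏 ⊛ f) ≋ f
    ⊛-identityˡ f zero    = solve 1 (λ x → :1 :* x :+ :0 := x) refl _
    ⊛-identityˡ f (suc n) = trans (+-congˡ (⊛-zeroˡ f n)) (solve 1 (λ x → :1 :* x :+ :0 := x) refl _)

    -- The recursion on the second factor; the one on the first is definitional.
    ⊛-sucʳ : ∀ f g n → (f ⊛ g) (suc n) ≈ f (suc n) * g 0 + (f ⊛ (g ∘ suc)) n
    ⊛-sucʳ f g zero    = solve 4
      (λ x y z w → x :* y :+ (z :* w :+ :0) := z :* w :+ (x :* y :+ :0)) refl _ _ _ _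
    ⊛-sucʳ f g (suc n) = trans (+-congˡ (⊛-sucʳ (f ∘ suc) g n))
      (solve 5 (λ x y z w p → x :* y :+ (z :* w :+ p) := z :* w :+ (x :* y :+ p)) refl _ _ _ _ _)

    ⊛-comm : ∀ f g → (f ⊛ g) ≋ (g ⊛ f)
    ⊛-comm f g zero    = +-congʳ (*-comm _ _)
    ⊛-comm f g (suc n) = trans (⊛-sucʳ f g n)
      (trans (+-cong (*-comm _ _) (⊛-comm f (g ∘ suc) n)) refl)

    ⊛-scale : ∀ x f g n → ((λ m → x * f m) ⊛ g) n ≈ x * (f ⊛ g) n
    ⊛-scale x f g zero    = solve 3 (λ x y z → (x :* y) :* z :+ :0 := x :* (y :* z :+ :0)) refl _ _ _
    ⊛-scale x f g (suc n) = trans (+-congˡ (⊛-scale x (f ∘ suc) g n))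
      (solve 4 (λ x y z p → (x :* y) :* z :+ x :* p := x :* (y :* z :+ p)) refl _ _ _ _)

    ⊛-distribʳ : ∀ f g h → ((g ⊕ h) ⊛ f) ≋ ((g ⊛ f) ⊕ (h ⊛ f))
    ⊛-distribʳ f g h n = trans (⊛-comm (g ⊕ h) f n)
      (trans (⊛-distribˡ f g h n) (+-cong (⊛-comm f g n) (⊛-comm f h n)))

    ⊛-assoc : ∀ f g h → ((f ⊛ g) ⊛ h) ≋ (f ⊛ (g ⊛ h))
    ⊛-assoc f g h zero    = solve 3
      (λ x y z → (x :* y :+ :0) :* z :+ :0 := x :* (y :* z :+ :0) :+ :0) refl _ _ _
    ⊛-assoc f g h (suc n) = begin
      (f 0 * g 0 + 0#) * h (suc n) + (((λ m → f 0 * g (suc m)) ⊕ ((f ∘ suc) ⊛ g)) ⊛ h) n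
        ≈⟨ +-congˡ (⊛-distribʳ h (λ m → f 0 * g (suc m)) ((f ∘ suc) ⊛ g) n) ⟩
      (f 0 * g 0 + 0#) * h (suc n) +
        (((λ m → f 0 * g (suc m)) ⊛ h) n + (((f ∘ suc) ⊛ g) ⊛ h) n)
        ≈⟨ +-congˡ (+-cong (⊛-scale (f 0) (g ∘ suc) h n) (⊛-assoc (f ∘ suc) g h n)) ⟩
      (f 0 * g 0 + 0#) * h (suc n) + (f 0 * ((g ∘ suc) ⊛ h) n + ((f ∘ suc) ⊛ (g ⊛ h)) n)
        ≈⟨ solve 5 (λ x y z p q → (x :* y :+ :0) :* z :+ (x :* p :+ q) := x :* (y :* z :+ p) :+ q)
             refl _ _ _ _ _ ⟩
      f 0 * (g 0 * h (suc n) + ((g ∘ suc) ⊛ h) n) + ((f ∘ suc) ⊛ (g ⊛ h)) n ∎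

  isCommutativeRing : IsCommutativeRing _≋_ _⊕_ _⊛_ ⊝_ 𝟎 𝟏
  isCommutativeRing = record
    { isRing = record
      { +-isAbelianGroup = record
        { isGroup = record
          { isMonoid = record
            { isSemigroup = record
              { isMagma = record
                { isEquivalence = record
                  { refl = λ n → refl ; sym = λ p n → sym (p n) ; trans = λ p q n → trans (p n) (q n) }
                ; ∙-cong = λ p q n → +-cong (p n) (q n)
                }
              ; assoc = λ f g h n → +-assoc (f n) (g n) (h n)
              }
            ; identity = (λ f n → +-identityˡ (f n)) , (λ f n → +-identityʳ (f n))
            }
          ; inverse = (λ f n → -‿inverseˡ (f n)) , (λ f n → -‿inverseʳ (f n))
          ; ⁻¹-cong = λ p n → -‿cong (p n)
          }
        ; comm = λ f g n → +-comm (f n) (g n)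
        }
      ; *-cong = ⊛-cong
      ; *-assoc = ⊛-assoc
      ; *-identity = ⊛-identityˡ , λ f n → trans (⊛-comm f 𝟏 n) (⊛-identityˡ f n)
      ; distrib = ⊛-distribˡ , ⊛-distribʳ
      }
    ; *-comm = ⊛-comm
    }

  commutativeRing : CommutativeRing c ℓ
  commutativeRing = record { isCommutativeRing = isCommutativeRing }

  -- Long division: f = f₀ q + z h with h = f′ - f₀ q′, primes denoting shifts.
  _÷_ : Ser → Ser → Ser
  (f ÷ q) zero    = f 0
  (f ÷ q) (suc n) = ((λ m → f (suc m) - f 0 * q (suc m)) ÷ q) n

  ÷-* : ∀ f q → q 0 ≈ 1# → ((f ÷ q) ⊛ q) ≋ f
  ÷-* f q q₀≈1 zero    = trans (+-congʳ (*-congˡ q₀≈1)) (solve 1 (λ x → x :* :1 :+ :0 := x) refl _)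
  ÷-* f q q₀≈1 (suc n) = trans (+-congˡ (÷-* (λ m → f (suc m) - f 0 * q (suc m)) q q₀≈1 n))
    (solve 2 (λ x y → x :+ (y :- x) := y) refl _ _)

  sum-at : ∀ {n} (f : Fin n → Ser) k →
           SemiringSum.sum (CommutativeRing.semiring commutativeRing) f k ≈ sum (λ i → f i k)
  sum-at {zero}  f k = refl
  sum-at {suc n} f k = +-congˡ (sum-at (f ∘ suc) k)

  -- Long division of 1 by a series with constant term 1 gives the inverse; multiplying `f q = p` by
  -- it turns the equation into a quotient.
  isFraction : ∀ {f p q} → q 0 ≈ 1# → (f ⊛ q) ≋ p → IsFraction (PowerSeries.rawRing rawRing) f p q
  isFraction {f} {p} {q} q₀≈1 fq≋p = q⁻¹ , q⊛q⁻¹ ,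
    S.sym (S.trans (S.*-congʳ (S.sym fq≋p)) (S.trans (S.*-assoc f q q⁻¹)
      (S.trans (S.*-congˡ {f} q⊛q⁻¹) (S.*-identityʳ f))))
    where
    module S = CommutativeRing commutativeRing
    q⁻¹ = 𝟏 ÷ q
    q⊛q⁻¹ : (q ⊛ q⁻¹) ≋ 𝟏
    q⊛q⁻¹ = S.trans (S.*-comm q q⁻¹) (÷-* 𝟏 q q₀≈1)

module Polys (R : CommutativeRing c ℓ) where
  open CommutativeRing R hiding (isCommutativeRing; _-_)
  open Polynomials rawRing using (coeff; _≈ₚ_; _+ₚ_; _*ₚ_; constant)
  private
    module S = CommutativeRing (Series.commutativeRing R)
  open RingProperties ring using (-0#≈0#)

  coeff-+ : ∀ p q n → coeff (p +ₚ q) n ≈ coeff p n + coeff q n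
  coeff-+ []      q       n       = sym (+-identityˡ _)
  coeff-+ (x ∷ p) []      n       = sym (+-identityʳ _)
  coeff-+ (x ∷ p) (y ∷ q) zero    = refl
  coeff-+ (x ∷ p) (y ∷ q) (suc n) = coeff-+ p q n

  coeff-map : ∀ (f : Carrier → Carrier) → f 0# ≈ 0# → ∀ p n → coeff (map f p) n ≈ f (coeff p n)
  coeff-map f f0 []      n       = sym f0
  coeff-map f f0 (x ∷ p) zero    = refl
  coeff-map f f0 (x ∷ p) (suc n) = coeff-map f f0 p n

  coeff-* : ∀ p q n → coeff (p *ₚ q) n ≈ (coeff p S.* coeff q) n
  coeff-* []      q n       = sym (S.zeroˡ (coeff q) n)
  coeff-* (x ∷ p) q zero    = trans (coeff-+ (map (x *_) q) _ 0)
    (+-congʳ (coeff-map (x *_) (zeroʳ x) q 0))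
  coeff-* (x ∷ p) q (suc n) = trans (coeff-+ (map (x *_) q) _ (suc n))
    (+-cong (coeff-map (x *_) (zeroʳ x) q (suc n)) (coeff-* p q n))

  coeff-1 : coeff (constant 1#) S.≈ S.1#
  coeff-1 zero    = refl
  coeff-1 (suc n) = refl

  coeff-isHom : IsRingHomomorphism (Polynomials.rawRing rawRing) S.rawRing coeff
  coeff-isHom = mkIsRingHomomorphism (Polynomials.rawRing rawRing) S.rawRing
    (λ p → p) coeff-+ (λ n → refl) coeff-* coeff-1 (coeff-map -_ -0#≈0#)

  -- Equality of coefficient lists is equality of their coefficient series by definition, so the
  -- coefficient map is injective and the ring laws are inherited from power series.
  isCommutativeRing : IsCommutativeRing _≈ₚ_ _+ₚ_ _*ₚ_ (map -_) [] (constant 1#)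
  isCommutativeRing = RingMonomorphism.isCommutativeRing
    {R₁ = Polynomials.rawRing rawRing} {R₂ = S.rawRing} {⟦_⟧ = coeff}
    (record { isRingHomomorphism = coeff-isHom ; injective = λ p → p }) S.isCommutativeRing

  commutativeRing : CommutativeRing c ℓ
  commutativeRing = record { isCommutativeRing = isCommutativeRing }

-- Increasing lists

module IncreasingLists {A : Set} {_<_ : Rel A Level.zero}
  (<-trans : Transitive _<_) (<-irrefl : Irreflexive _≡_ _<_) where

  Increasing : List A → Set
  Increasing = AllPairs _<_

  -- Increasing lists are the normal forms of finite sets: the head of `X` is either the head of `Y`
  -- or lies beyond it, and in the second case so does all of `X`. With equal lengths, `⊑⇒≡` then
  -- yields equality of lists.
  increasing-⊑ : ∀ {X Y} → Increasing X → Increasing Y → (∀ {x} → x ∈ X → x ∈ Y) → X ⊑ Y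
  increasing-⊑ {[]}    {Y}     _ _ _ = minimum Y
  increasing-⊑ {x ∷ X} {[]}    _ _ X⊆Y with () ← X⊆Y (here ≡.refl)
  increasing-⊑ {x ∷ X} {y ∷ Y} (x<X ∷ incX) (y<Y ∷ incY) X⊆Y with X⊆Y (here ≡.refl)
  ... | here ≡.refl = ≡.refl ∷ increasing-⊑ incX incY tail⊆
    where
    tail⊆ : ∀ {z} → z ∈ X → z ∈ Y
    tail⊆ z∈X with X⊆Y (there z∈X)
    ... | here ≡.refl = contradiction (All.lookup x<X z∈X) (<-irrefl ≡.refl)
    ... | there z∈Y   = z∈Y
  ... | there x∈Y   = skip y (increasing-⊑ (x<X ∷ incX) incY X⊆tail)
    where
    y<x = All.lookup y<Y x∈Y
    X⊆tail : ∀ {z} → z ∈ x ∷ X → z ∈ Y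
    X⊆tail z∈ with X⊆Y z∈
    X⊆tail z∈            | there z∈Y   = z∈Y
    X⊆tail (here ≡.refl) | here ≡.refl = contradiction y<x (<-irrefl ≡.refl)
    X⊆tail (there z∈X)   | here ≡.refl =
      contradiction (<-trans y<x (All.lookup x<X z∈X)) (<-irrefl ≡.refl)

⊑⇒≡ : ∀ {A : Set} {X Y : List A} → X ⊑ Y → length X ≡ length Y → X ≡ Y
⊑⇒≡ X⊑Y |X|≡|Y| = Pointwise.Pointwise-≡⇒≡ (HeterogeneousSublist.toPointwise |X|≡|Y| X⊑Y)

-- Contraction of alternating forms, and determinants

module Determinants (R : CommutativeRing c ℓ) where
  open CommutativeRing R hiding (zero)
  open RingProperties ring using (-0#≈0#)
  open SemiringExp semiring using (_^_; ^-homo-*)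
  open SemiringSum semiring using (sum; sum-cong-≋; sum-replicate-zero; ∑-comm; *-distribˡ-sum)
  open IntegerCoefficientSolver R
  open Matrices rawRing
  open SetoidReasoning setoid

  sum-zero : ∀ {n} {f : Fin n → Carrier} → (∀ i → f i ≈ 0#) → sum f ≈ 0#
  sum-zero {n} f≈0 = trans (sum-cong-≋ f≈0) (sum-replicate-zero n)

  sum-neg : ∀ {n} (f : Fin n → Carrier) → sum (λ i → - f i) ≈ - sum f
  sum-neg {zero}  f = sym -0#≈0#
  sum-neg {suc n} f = trans (+-congˡ (sum-neg (f ∘ suc)))
    (solve 2 (λ x y → :- x :+ :- y := :- (x :+ y)) refl _ _)

  sum-sub : ∀ {n} (f g : Fin n → Carrier) → sum (λ i → f i - g i) ≈ sum f - sum g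
  sum-sub {zero}  f g = solve 0 (:0 := :0 :- :0) refl
  sum-sub {suc n} f g = trans (+-congˡ (sum-sub (f ∘ suc) (g ∘ suc)))
    (solve 4 (λ x y z w → (x :- y) :+ (z :- w) := (x :+ z) :- (y :+ w)) refl _ _ _ _)

  negate : ∀ {n} (f g h : Fin n → Carrier) →
           - sum (λ i → f i * (g i * h i)) ≈ sum λ i → f i * ((- 1# * g i) * h i)
  negate f g h = trans (sym (sum-neg λ i → f i * (g i * h i))) (sum-cong-≋ λ i →
    solve 3 (λ x y z → :- (x :* (y :* z)) := x :* ((:- :1 :* y) :* z)) refl (f i) (g i) (h i))

  reassoc : ∀ {n} (f g h : Fin n → Carrier) →
            sum (λ i → f i * (g i * h i)) ≈ sum λ i → (f i * g i) * h i
  reassoc f g h = sum-cong-≋ λ i → sym (*-assoc (f i) (g i) (h i))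

  sum-cong : ∀ {n} (f g : Fin n → Carrier) → (∀ i → f i ≈ g i) → sum f ≈ sum g
  sum-cong f g f≈g = sum-cong-≋ f≈g

  identity-suc : ∀ {n} (i j : Fin n) → identity (suc i) (suc j) ≈ identity i j
  identity-suc i j with i Fin.≟ j
  ... | yes _ = refl
  ... | no  _ = refl

  identity-refl : ∀ {n} (i : Fin n) → identity i i ≈ 1#
  identity-refl i with i Fin.≟ i
  ... | yes _  = refl
  ... | no i≢i = contradiction ≡.refl i≢i

  identity-≢ : ∀ {n} {i j : Fin n} → i ≢ j → identity i j ≈ 0#
  identity-≢ {i = i} {j} i≢j with i Fin.≟ j
  ... | yes i≡j = contradiction i≡j i≢j
  ... | no _    = refl

  sum-identityˡ : ∀ {n} (i : Fin n) (f : Fin n → Carrier) → sum (λ j → identity i j * f j) ≈ f i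
  sum-identityˡ zero    f = trans
    (+-cong (*-identityˡ (f zero)) (sum-zero {f = λ j → 0# * f (suc j)} λ j → zeroˡ (f (suc j))))
    (+-identityʳ (f zero))
  sum-identityˡ (suc i) f = trans
    (+-cong (zeroˡ (f zero)) (trans (sum-cong-≋ λ j → *-congʳ {f (suc j)} (identity-suc i j))
      (sum-identityˡ i (f ∘ suc))))
    (+-identityˡ (f (suc i)))

  identity-sym : ∀ {n} (i j : Fin n) → identity i j ≈ identity j i
  identity-sym i j with i Fin.≟ j
  ... | yes ≡.refl = sym (identity-refl i)
  ... | no i≢j     = sym (identity-≢ (i≢j ∘ ≡.sym))

  sum-identityʳ : ∀ {n} (i : Fin n) (f : Fin n → Carrier) → sum (λ j → f j * identity j i) ≈ f i
  sum-identityʳ i f = trans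
    (sum-cong-≋ λ j → trans (*-comm _ _) (*-congʳ (identity-sym j i))) (sum-identityˡ i f)

  sign² : ∀ n → (- 1#) ^ n * (- 1#) ^ n ≈ 1#
  sign² zero    = *-identityˡ 1#
  sign² (suc n) = trans
    (solve 1 (λ s → (:- :1 :* s) :* (:- :1 :* s) := s :* s) refl ((- 1#) ^ n)) (sign² n)

  module _ {X : Set} where

    Form : Set c
    Form = List X → Carrier

    infix 4 _≈ᶠ_
    _≈ᶠ_ : Form → Form → Set ℓ
    g ≈ᶠ h = ∀ xs → g xs ≈ h xs

    -- Interior multiplication by v.
    δ : (X → Carrier) → Form → Form
    δ v g []       = 0#
    δ v g (x ∷ xs) = v x * g xs - δ v (g ∘ (x ∷_)) xs

    unit : Form
    unit []      = 1#
    unit (_ ∷ _) = 0#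

    -- The first row contracts outermost, matching the Laplace expansion along row 0; at `unit`
    -- every letter must be used up, which gives the determinant.
    Δ : ∀ {n} → (Fin n → X → Carrier) → Form → Form
    Δ {zero}  M g = g
    Δ {suc n} M g = δ (M zero) (Δ (M ∘ suc) g)

    δ-cong : ∀ {v w g h} → (∀ x → v x ≈ w x) → g ≈ᶠ h → δ v g ≈ᶠ δ w h
    δ-cong v≈w g≈h []       = refl
    δ-cong v≈w g≈h (x ∷ xs) =
      +-cong (*-cong (v≈w x) (g≈h xs)) (-‿cong (δ-cong v≈w (g≈h ∘ (x ∷_)) xs))

    δ-congʳ : ∀ {v g h} → g ≈ᶠ h → δ v g ≈ᶠ δ v h
    δ-congʳ = δ-cong λ _ → refl

    Δ-cong : ∀ {n} {M N : Fin n → X → Carrier} {g h} →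
             (∀ i x → M i x ≈ N i x) → g ≈ᶠ h → Δ M g ≈ᶠ Δ N h
    Δ-cong {zero}  M≈N g≈h = g≈h
    Δ-cong {suc n} M≈N g≈h = δ-cong (M≈N zero) (Δ-cong (M≈N ∘ suc) g≈h)

    δ-zero : ∀ v {g} → (∀ xs → g xs ≈ 0#) → ∀ xs → δ v g xs ≈ 0#
    δ-zero v g≈0 []       = refl
    δ-zero v g≈0 (x ∷ xs) = trans
      (+-cong (*-congˡ (g≈0 xs)) (-‿cong (δ-zero v (g≈0 ∘ (x ∷_)) xs)))
      (solve 1 (λ x → x :* :0 :- :0 := :0) refl _)

    δ-+ : ∀ v g h xs → δ v (λ ys → g ys + h ys) xs ≈ δ v g xs + δ v h xs
    δ-+ v g h []       = sym (+-identityˡ 0#)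
    δ-+ v g h (x ∷ xs) = trans (+-congˡ (-‿cong (δ-+ v _ _ xs)))
      (solve 5 (λ x y z p q → x :* (y :+ z) :- (p :+ q) := (x :* y :- p) :+ (x :* z :- q))
        refl _ _ _ _ _)

    δ-scale : ∀ v k g xs → δ v (λ ys → k * g ys) xs ≈ k * δ v g xs
    δ-scale v k g []       = sym (zeroʳ k)
    δ-scale v k g (x ∷ xs) = trans (+-congˡ (-‿cong (δ-scale v k _ xs)))
      (solve 4 (λ x k y p → x :* (k :* y) :- k :* p := k :* (x :* y :- p)) refl _ _ _ _)

    δ-neg : ∀ v g xs → δ v (λ ys → - g ys) xs ≈ - δ v g xs
    δ-neg v g []       = sym -0#≈0#
    δ-neg v g (x ∷ xs) = trans (+-congˡ (-‿cong (δ-neg v _ xs)))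
      (solve 3 (λ x y p → x :* :- y :- :- p := :- (x :* y :- p)) refl _ _ _)

    δ-negˡ : ∀ v g xs → δ (λ x → - v x) g xs ≈ - δ v g xs
    δ-negˡ v g []       = sym -0#≈0#
    δ-negˡ v g (x ∷ xs) = trans (+-congˡ (-‿cong (δ-negˡ v _ xs)))
      (solve 3 (λ x y p → (:- x) :* y :- :- p := :- (x :* y :- p)) refl _ _ _)

    δ-sum : ∀ {n} v (k : Fin n → Carrier) (g : Fin n → Form) xs →
            δ v (λ ys → sum λ i → k i * g i ys) xs ≈ sum λ i → k i * δ v (g i) xs
    δ-sum {zero}  v k g xs = δ-zero v (λ _ → refl) xs
    δ-sum {suc n} v k g xs = trans (δ-+ v _ _ xs)
      (+-cong (δ-scale v (k zero) (g zero) xs) (δ-sum v (k ∘ suc) (g ∘ suc) xs))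

    -- Splitting off the head letter turns each double contraction into two mixed terms and one
    -- double contraction of the tail. The mixed terms change sign when v and w are exchanged, and
    -- the tail is handled by induction.
    δ-anticomm : ∀ v w g xs → δ v (δ w g) xs ≈ - δ w (δ v g) xs
    δ-anticomm v w g []       = sym -0#≈0#
    δ-anticomm v w g (x ∷ xs) = begin
      v x * δ w g xs - δ v (λ ys → w x * g ys - δ w (g ∘ (x ∷_)) ys) xs
        ≈⟨ +-congˡ (-‿cong (expand v w)) ⟩
      v x * δ w g xs - (w x * δ v g xs - δ v (δ w (g ∘ (x ∷_))) xs)
        ≈⟨ +-congˡ (-‿cong (+-congˡ (-‿cong (δ-anticomm v w (g ∘ (x ∷_)) xs)))) ⟩
      v x * δ w g xs - (w x * δ v g xs - - δ w (δ v (g ∘ (x ∷_))) xs)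
        ≈⟨ solve 3 (λ p q r → p :- (q :- :- r) := :- (q :- (p :- r))) refl _ _ _ ⟩
      - (w x * δ v g xs - (v x * δ w g xs - δ w (δ v (g ∘ (x ∷_))) xs))
        ≈⟨ -‿cong (+-congˡ (-‿cong (expand w v))) ⟨
      - (w x * δ v g xs - δ w (λ ys → v x * g ys - δ v (g ∘ (x ∷_)) ys) xs) ∎
      where
      expand : ∀ v w → δ v (λ ys → w x * g ys - δ w (g ∘ (x ∷_)) ys) xs ≈
                       w x * δ v g xs - δ v (δ w (g ∘ (x ∷_))) xs
      expand v w = trans (δ-+ v _ _ xs) (+-cong (δ-scale v (w x) g xs) (δ-neg v _ xs))

    -- Anticommutation gives only 2 δ² = 0, and the ring may have 2-torsion. The two terms in which
    -- the head is removed first or second cancel directly.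
    δ-square : ∀ v g xs → δ v (δ v g) xs ≈ 0#
    δ-square v g []       = refl
    δ-square v g (x ∷ xs) = begin
      v x * δ v g xs - δ v (λ ys → v x * g ys - δ v (g ∘ (x ∷_)) ys) xs
        ≈⟨ +-congˡ (-‿cong (trans (δ-+ v _ _ xs)
             (+-cong (δ-scale v (v x) g xs) (trans (δ-neg v _ xs) (-‿cong (δ-square v _ xs)))))) ⟩
      v x * δ v g xs - (v x * δ v g xs - 0#)
        ≈⟨ solve 1 (λ p → p :- (p :- :0) := :0) refl _ ⟩
      0# ∎

    δ-tabulate : ∀ {n} v g (f : Fin (suc n) → X) → δ v g (tabulate f) ≈
                 sum λ j → v (f j) * ((- 1#) ^ toℕ j * g (tabulate (f ∘ punchIn j)))
    δ-tabulate {zero}  v g f = solve 2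
      (λ x y → x :* y :- :0 := x :* (:1 :* y) :+ :0) refl _ _
    δ-tabulate {suc n} v g f = +-cong (*-congˡ (sym (*-identityˡ _)))
      (trans (-‿cong (δ-tabulate v (g ∘ (f zero ∷_)) (f ∘ suc)))
        (negate (λ j → v (f (suc j))) (λ j → (- 1#) ^ toℕ j) λ j → g (tabulate (f ∘ punchIn (suc j)))))

    -- Both laws are recorded because `swap` yields only twice `dup` over a general commutative
    -- ring.
    record Alternating (w : Form) : Set ℓ where
      field
        swap : ∀ ps x y zs → w (ps ++ x ∷ y ∷ zs) ≈ - w (ps ++ y ∷ x ∷ zs)
        dup  : ∀ ps x zs → w (ps ++ x ∷ x ∷ zs) ≈ 0#

    open Alternating

    alternating-∷ : ∀ {w} → Alternating w → ∀ x → Alternating (w ∘ (x ∷_))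
    alternating-∷ alt x = record { swap = λ ps → swap alt (x ∷ ps) ; dup = λ ps → dup alt (x ∷ ps) }

    unit-alternating : Alternating unit
    unit-alternating = record { swap = swap₁ ; dup = dup₁ }
      where
      swap₁ : ∀ ps x y zs → unit (ps ++ x ∷ y ∷ zs) ≈ - unit (ps ++ y ∷ x ∷ zs)
      swap₁ []      x y zs = sym -0#≈0#
      swap₁ (_ ∷ _) x y zs = sym -0#≈0#
      dup₁ : ∀ ps x zs → unit (ps ++ x ∷ x ∷ zs) ≈ 0#
      dup₁ []      x zs = refl
      dup₁ (_ ∷ _) x zs = refl

    δ-alternating : ∀ v {g} → Alternating g → Alternating (δ v g)
    δ-alternating v alt = record { swap = swap₁ alt ; dup = dup₁ alt }
      where
      swap₁ : ∀ {g} → Alternating g → ∀ ps x y zs → δ v g (ps ++ x ∷ y ∷ zs) ≈ - δ v g (ps ++ y ∷ x ∷ zs)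
      swap₁ {g} alt (p ∷ ps) x y zs = trans
        (+-cong (*-congˡ (swap alt ps x y zs)) (-‿cong (swap₁ (alternating-∷ alt p) ps x y zs)))
        (solve 3 (λ a b c → a :* :- b :- :- c := :- (a :* b :- c)) refl _ _ _)
      swap₁ {g} alt [] x y zs = trans
        (+-congˡ (-‿cong (+-congˡ (-‿cong
          (trans (δ-congʳ (λ ys → swap alt [] x y ys) zs) (δ-neg v _ zs))))))
        (solve 3 (λ a b c → a :- (b :- :- c) := :- (b :- (a :- c))) refl _ _ _)
      dup₁ : ∀ {g} → Alternating g → ∀ ps x zs → δ v g (ps ++ x ∷ x ∷ zs) ≈ 0#
      dup₁ {g} alt (p ∷ ps) x zs = trans
        (+-cong (*-congˡ (dup alt ps x zs)) (-‿cong (dup₁ (alternating-∷ alt p) ps x zs)))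
        (solve 1 (λ a → a :* :0 :- :0 := :0) refl _)
      dup₁ {g} alt [] x zs = trans
        (+-congˡ (-‿cong (+-congˡ (-‿cong (δ-zero v (dup alt [] x) zs)))))
        (solve 1 (λ a → a :- (a :- :0) := :0) refl _)

    Δ-alternating : ∀ {n} (M : Fin n → X → Carrier) {g} → Alternating g → Alternating (Δ M g)
    Δ-alternating {zero}  M alt = alt
    Δ-alternating {suc n} M alt = δ-alternating (M zero) (Δ-alternating (M ∘ suc) alt)

    alternating-rotate : ∀ {n w} → Alternating w → ∀ (f : Fin (suc n) → X) j →
      w (f j ∷ tabulate (f ∘ punchIn j)) ≈ (- 1#) ^ toℕ j * w (tabulate f)
    alternating-rotate             alt f zero    = sym (*-identityˡ _)
    alternating-rotate {suc n} {w} alt f (suc j) = begin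
      w (f (suc j) ∷ f zero ∷ tabulate (f ∘ suc ∘ punchIn j))   ≈⟨ swap alt [] _ _ _ ⟩
      - w (f zero ∷ f (suc j) ∷ tabulate (f ∘ suc ∘ punchIn j))
        ≈⟨ -‿cong (alternating-rotate (alternating-∷ alt (f zero)) (f ∘ suc) j) ⟩
      - ((- 1#) ^ toℕ j * w (tabulate f))
        ≈⟨ solve 2 (λ x y → :- (x :* y) := (:- :1 :* x) :* y) refl _ _ ⟩
      (- 1#) ^ suc (toℕ j) * w (tabulate f)                     ∎

    alternating-repeat : ∀ {n w} → Alternating w → ∀ (f : Fin n → X) k → w (f k ∷ tabulate f) ≈ 0#
    alternating-repeat alt f zero    = dup alt [] _ _
    alternating-repeat alt f (suc k) = trans (swap alt [] _ _ _)
      (trans (-‿cong (alternating-repeat (alternating-∷ alt (f zero)) (f ∘ suc) k)) -0#≈0#)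

    -- Row k, applied in front of the others, moves back to its place past k rows, and each exchange
    -- costs a sign by anticommutation.
    δ-Δ-insert : ∀ {n} (M : Fin (suc n) → X → Carrier) g k →
      δ (M k) (Δ (M ∘ punchIn k) g) ≈ᶠ λ xs → (- 1#) ^ toℕ k * Δ M g xs
    δ-Δ-insert         M g zero    xs = sym (*-identityˡ _)
    δ-Δ-insert {suc n} M g (suc k) xs = begin
      δ (M (suc k)) (δ (M zero) (Δ (M ∘ suc ∘ punchIn k) g)) xs   ≈⟨ δ-anticomm _ _ _ xs ⟩
      - δ (M zero) (δ (M (suc k)) (Δ (M ∘ suc ∘ punchIn k) g)) xs
        ≈⟨ -‿cong (trans (δ-congʳ (δ-Δ-insert (M ∘ suc) g k) xs) (δ-scale _ _ _ xs)) ⟩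
      - ((- 1#) ^ toℕ k * Δ M g xs)
        ≈⟨ solve 2 (λ x y → :- (x :* y) := (:- :1 :* x) :* y) refl _ _ ⟩
      (- 1#) ^ suc (toℕ k) * Δ M g xs                             ∎

    -- The extra copy of row k is moved next to the original, where the square of a contraction
    -- vanishes.
    δ-Δ-repeat : ∀ {n} (M : Fin n → X → Carrier) g k xs → δ (M k) (Δ M g) xs ≈ 0#
    δ-Δ-repeat M g zero    xs = δ-square _ _ xs
    δ-Δ-repeat M g (suc k) xs = trans (δ-anticomm _ _ _ xs)
      (trans (-‿cong (δ-zero _ (δ-Δ-repeat (M ∘ suc) g k) xs)) -0#≈0#)

    -- Some row has to remove the leading letter x, since `g` vanishes on every nonempty list. If it
    -- is row i, the i contractions before it pass over x with a sign each. This is expansion along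
    -- a column for an object built from rows.
    Δ-expand-column : ∀ {n} (M : Fin (suc n) → X → Carrier) {g} → (∀ x xs → g (x ∷ xs) ≈ 0#) →
      ∀ x ys → sum (λ i → M i x * ((- 1#) ^ toℕ i * Δ (M ∘ punchIn i) g ys)) ≈ Δ M g (x ∷ ys)
    Δ-expand-column {zero}  M {g} g∷≈0 x ys = trans
      (solve 2 (λ a b → a :* (:1 :* b) :+ :0 := a :* b :- :0) refl _ _)
      (+-congˡ (-‿cong (sym (δ-zero _ (g∷≈0 x) ys))))
    Δ-expand-column {suc n} M {g} g∷≈0 x ys = sym (+-cong (*-congˡ (sym (*-identityˡ _)))
      (trans (-‿cong expand) (negate (λ i → M (suc i) x) (λ i → (- 1#) ^ toℕ i)
        λ i → Δ (M ∘ punchIn (suc i)) g ys)))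
      where
      term : Fin (suc n) → Form
      term i = Δ (M ∘ suc ∘ punchIn i) g
      expand : δ (M zero) (Δ (M ∘ suc) g ∘ (x ∷_)) ys ≈
               sum λ i → M (suc i) x * ((- 1#) ^ toℕ i * δ (M zero) (term i) ys)
      expand = begin
        δ (M zero) (Δ (M ∘ suc) g ∘ (x ∷_)) ys
          ≈⟨ δ-congʳ (λ zs → trans (sym (Δ-expand-column (M ∘ suc) g∷≈0 x zs))
               (reassoc (λ i → M (suc i) x) (λ i → (- 1#) ^ toℕ i) (λ i → term i zs))) ys ⟩
        δ (M zero) (λ zs → sum λ i → (M (suc i) x * (- 1#) ^ toℕ i) * term i zs) ys
          ≈⟨ δ-sum (M zero) (λ i → M (suc i) x * (- 1#) ^ toℕ i) term ys ⟩
        sum (λ i → (M (suc i) x * (- 1#) ^ toℕ i) * δ (M zero) (term i) ys)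
          ≈⟨ reassoc (λ i → M (suc i) x) (λ i → (- 1#) ^ toℕ i) (λ i → δ (M zero) (term i) ys) ⟨
        sum (λ i → M (suc i) x * ((- 1#) ^ toℕ i * δ (M zero) (term i) ys)) ∎

  δ-map : ∀ {X Y : Set} (f : X → Y) v g xs → δ v g (map f xs) ≈ δ (v ∘ f) (g ∘ map f) xs
  δ-map f v g []       = refl
  δ-map f v g (x ∷ xs) = +-congˡ (-‿cong (δ-map f v (g ∘ (f x ∷_)) xs))

  Δ-map : ∀ {X Y : Set} (f : X → Y) {n} (M : Fin n → Y → Carrier) g xs →
          Δ M g (map f xs) ≈ Δ (λ i → M i ∘ f) (g ∘ map f) xs
  Δ-map f {zero}  M g xs = refl
  Δ-map f {suc n} M g xs = trans (δ-map f _ _ xs) (δ-congʳ (Δ-map f (M ∘ suc) g) xs)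

  det-Δ : ∀ {X : Set} {n} (M : Fin n → X → Carrier) (f : Fin n → X) →
          det (λ i j → M i (f j)) ≈ Δ M unit (tabulate f)
  det-Δ {n = zero}  M f = refl
  det-Δ {n = suc n} M f = trans
    (sum-cong (λ j → M zero (f j) * ((- 1#) ^ toℕ j * det λ p q → M (suc p) (f (punchIn j q))))
              (λ j → M zero (f j) * ((- 1#) ^ toℕ j * Δ (M ∘ suc) unit (tabulate (f ∘ punchIn j))))
      λ j → *-congˡ (*-congˡ (det-Δ (M ∘ suc) (f ∘ punchIn j))))
    (sym (δ-tabulate (M zero) (Δ (M ∘ suc) unit) f))

  det-cong : ∀ {n} {M N : Matrix n n} → (∀ i j → M i j ≈ N i j) → det M ≈ det N
  det-cong {n} {M} {N} M≈N = trans (det-Δ M id)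
    (trans (Δ-cong M≈N (λ _ → refl) (allFin n)) (sym (det-Δ N id)))

  det-identity : ∀ n → det (identity {n}) ≈ 1#
  det-identity zero    = refl
  det-identity (suc n) = trans
    (+-cong (trans (*-identityˡ _) (trans (*-identityˡ _)
        (trans (det-cong {M = minor (identity {suc n}) zero zero} identity-suc) (det-identity n))))
      (sum-zero {n} {λ j → 0# * ((- 1#) ^ toℕ (suc j) * det (minor (identity {suc n}) zero (suc j)))}
        λ j → zeroˡ _))
    (+-identityʳ 1#)

  -- Up to the sign of j, the sum is the determinant in which column k is put in front of all
  -- columns except j. For k = j, rotating it back restores `det M`; otherwise column k occurs
  -- twice.
  adj-⊗ : ∀ {n} (M : Matrix n n) j k → (adj M ⊗ M) j k ≈ det M * identity j k
  adj-⊗ {suc n} M j k = begin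
    sum (λ i → ((- 1#) ^ (toℕ i ℕ.+ toℕ j) * det (minor M i j)) * M i k)
      ≈⟨ sum-cong (λ i → ((- 1#) ^ (toℕ i ℕ.+ toℕ j) * det (minor M i j)) * M i k)
           (λ i → (- 1#) ^ toℕ j * term i) (λ i → trans (*-congʳ (*-cong (^-homo-* (- 1#) (toℕ i) (toℕ j))
           (det-Δ (M ∘ punchIn i) (punchIn j))))
           (solve 4 (λ x y z w → ((x :* y) :* z) :* w := y :* (w :* (x :* z))) refl _ _ _ _)) ⟩
    sum (λ i → (- 1#) ^ toℕ j * term i)
      ≈⟨ *-distribˡ-sum ((- 1#) ^ toℕ j) term ⟨
    (- 1#) ^ toℕ j * sum term
      ≈⟨ *-congˡ (Δ-expand-column M (λ _ _ → refl) k _) ⟩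
    (- 1#) ^ toℕ j * Δ M unit (k ∷ tabulate (punchIn j))
      ≈⟨ last-step ⟩
    det M * identity j k ∎
    where
    term : Fin (suc n) → Carrier
    term i = M i k * ((- 1#) ^ toℕ i * Δ (M ∘ punchIn i) unit (tabulate (punchIn j)))
    alt = Δ-alternating M unit-alternating
    last-step : (- 1#) ^ toℕ j * Δ M unit (k ∷ tabulate (punchIn j)) ≈ det M * identity j k
    last-step with j Fin.≟ k
    ... | yes ≡.refl = trans (*-congˡ (alternating-rotate alt id j)) (trans (sym (*-assoc _ _ _))
      (trans (*-congʳ (sign² (toℕ j))) (trans (*-comm _ _) (*-congʳ (sym (det-Δ M id))))))
    ... | no j≢k = trans (*-congˡ (trans
        (reflexive (≡.cong (λ k → Δ M unit (k ∷ tabulate (punchIn j))) (≡.sym (Fin.punchIn-punchOut j≢k))))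
        (alternating-repeat alt (punchIn j) (punchOut j≢k))))
      (trans (zeroʳ _) (sym (zeroʳ _)))

  -- The row counterpart: row i contracts in front of all rows except k. For i = k anticommutation
  -- restores the order of the rows; otherwise a row is repeated.
  ⊗-adj : ∀ {n} (M : Matrix n n) i k → (M ⊗ adj M) i k ≈ det M * identity i k
  ⊗-adj {suc n} M i k = begin
    sum (λ j → M i j * ((- 1#) ^ (toℕ k ℕ.+ toℕ j) * det (minor M k j)))
      ≈⟨ sum-cong (λ j → M i j * ((- 1#) ^ (toℕ k ℕ.+ toℕ j) * det (minor M k j)))
           (λ j → (- 1#) ^ toℕ k * term j) (λ j → trans (*-congˡ (*-cong (^-homo-* (- 1#) (toℕ k) (toℕ j))
           (det-Δ (M ∘ punchIn k) (punchIn j))))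
           (solve 4 (λ x y z w → x :* ((y :* z) :* w) := y :* (x :* (z :* w))) refl _ _ _ _)) ⟩
    sum (λ j → (- 1#) ^ toℕ k * term j)
      ≈⟨ *-distribˡ-sum ((- 1#) ^ toℕ k) term ⟨
    (- 1#) ^ toℕ k * sum term
      ≈⟨ *-congˡ (δ-tabulate (M i) (Δ (M ∘ punchIn k) unit) id) ⟨
    (- 1#) ^ toℕ k * δ (M i) (Δ (M ∘ punchIn k) unit) (allFin (suc n))
      ≈⟨ last-step ⟩
    det M * identity i k ∎
    where
    term : Fin (suc n) → Carrier
    term j = M i j * ((- 1#) ^ toℕ j * Δ (M ∘ punchIn k) unit (tabulate (punchIn j)))
    last-step : (- 1#) ^ toℕ k * δ (M i) (Δ (M ∘ punchIn k) unit) (allFin (suc n)) ≈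
                det M * identity i k
    last-step with i Fin.≟ k
    ... | yes ≡.refl = trans (*-congˡ (δ-Δ-insert M unit k (allFin (suc n)))) (trans (sym (*-assoc _ _ _))
      (trans (*-congʳ (sign² (toℕ k))) (trans (*-comm _ _) (*-congʳ (sym (det-Δ M id))))))
    ... | no i≢k = trans (*-congˡ (trans
        (reflexive (≡.cong (λ i → δ (M i) (Δ (M ∘ punchIn k) unit) (allFin (suc n)))
          (≡.sym (Fin.punchIn-punchOut (i≢k ∘ ≡.sym)))))
        (δ-Δ-repeat (M ∘ punchIn k) unit (punchOut (i≢k ∘ ≡.sym)) (allFin (suc n)))))
      (trans (zeroʳ _) (sym (zeroʳ _)))

  _divides_ : Carrier → Carrier → Set (c ⊔ ℓ)
  d divides x = ∃ λ q → x ≈ d * q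

  divides-zero : ∀ {d x} → x ≈ 0# → d divides x
  divides-zero x≈0 = 0# , trans x≈0 (sym (zeroʳ _))

  divides-neg : ∀ {d x y} → x ≈ - y → d divides y → d divides x
  divides-neg x≈-y (q , y≈dq) = - q , trans x≈-y
    (trans (-‿cong y≈dq) (solve 2 (λ d q → :- (d :* q) := d :* :- q) refl _ _))

  divides-sum : ∀ {n d} (k : Fin n → Carrier) {f : Fin n → Carrier} →
                (∀ i → d divides f i) → d divides sum (λ i → k i * f i)
  divides-sum {zero}  k d∣f = divides-zero refl
  divides-sum {suc n} k d∣f =
    let (p , eq) = d∣f zero ; (q , eq′) = divides-sum (k ∘ suc) (d∣f ∘ suc)
    in k zero * p + q , trans (+-cong (*-congˡ eq) eq′)
         (solve 4 (λ k d p q → k :* (d :* p) :+ d :* q := d :* (k :* p :+ q)) refl _ _ _ _)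

  module _ {n : ℕ} where
    open IncreasingLists {_<_ = Fin._<_ {n} {n}} Fin.<-trans Fin.<-irrefl

    open Alternating

    -- Insertion sort, read as a reduction of the values of w to increasing lists.
    private
      insert : ∀ {d w} → Alternating w → ∀ x ys → Increasing ys →
        (∀ zs → Increasing zs → length zs ≡ suc (length ys) → (∀ {z} → z ∈ zs → z ∈ x ∷ ys) →
          d divides w zs) →
        d divides w (x ∷ ys)
      insert alt x []       _   hyp = hyp (x ∷ []) ([] ∷ []) ≡.refl id
      insert {d} {w} alt x (y ∷ ys) (y<ys ∷ inc) hyp with Fin.<-cmp x y
      ... | tri< x<y _ _ = hyp (x ∷ y ∷ ys)
        ((x<y ∷ All.map (Fin.<-trans x<y) y<ys) ∷ y<ys ∷ inc) ≡.refl id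
      ... | tri≈ _ ≡.refl _ = divides-zero (dup alt [] _ _)
      ... | tri> _ _ y<x = divides-neg (swap alt [] _ _ _)
        (insert (alternating-∷ alt y) x ys inc λ zs inc′ len zs⊆ →
          hyp (y ∷ zs) (All.tabulate (λ z∈zs → All.lookup (y<x ∷ y<ys) (zs⊆ z∈zs)) ∷ inc′)
            (≡.cong suc len) (λ { (here eq) → there (here eq) ; (there z∈zs) → weaken (zs⊆ z∈zs) }))
        where
        weaken : ∀ {z} → z ∈ x ∷ ys → z ∈ x ∷ y ∷ ys
        weaken (here eq)  = here eq
        weaken (there z∈) = there (there z∈)

      sort : ∀ {d w} → Alternating w → ∀ xs →
        (∀ ys → Increasing ys → length ys ≡ length xs → d divides w ys) → d divides w xs
      sort alt []       hyp = hyp [] [] ≡.refl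
      sort alt (x ∷ xs) hyp = sort (alternating-∷ alt x) xs λ ys inc len →
        insert alt x ys inc λ zs inc′ len′ _ → hyp zs inc′ (≡.trans len′ (≡.cong suc len))

    -- An increasing list of n elements of `Fin n` is `allFin n`, so sorting reduces every value
    -- either to zero or, up to sign, to that single one.
    alternating-divides : ∀ {w} → Alternating w → ∀ xs → length xs ≡ n → w (allFin n) divides w xs
    alternating-divides {w} alt xs |xs|≡n = sort alt xs λ ys inc |ys|≡|xs| →
      1# , trans (reflexive (≡.cong w (⊑⇒≡
        (increasing-⊑ inc (AllPairs.tabulate⁺-< id) (λ {x} _ → ∈.∈-allFin x))
        (≡.trans |ys|≡|xs| (≡.trans |xs|≡n (≡.sym (List.length-tabulate id)))))))
      (sym (*-identityʳ _))

  -- Pushing a form forward along S, so that δ (v S) (Φ g) = Φ (δ v g).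
  module _ {n : ℕ} {Y : Set} (S : Fin n → Y → Carrier) where

    Φ : (List (Fin n) → Carrier) → List Y → Carrier
    Φ g []       = g []
    Φ g (y ∷ ys) = sum λ x → S x y * Φ (g ∘ (x ∷_)) ys

    Φ-cong : ∀ {g h} → (∀ xs → g xs ≈ h xs) → ∀ ys → Φ g ys ≈ Φ h ys
    Φ-cong g≈h []       = g≈h []
    Φ-cong g≈h (y ∷ ys) = sum-cong-≋ λ x → *-congˡ {S x y} (Φ-cong (g≈h ∘ (x ∷_)) ys)

    Φ-zero : ∀ {g} → (∀ xs → g xs ≈ 0#) → ∀ ys → Φ g ys ≈ 0#
    Φ-zero g≈0 []       = g≈0 []
    Φ-zero g≈0 (y ∷ ys) = sum-zero λ x → trans (*-congˡ (Φ-zero (g≈0 ∘ (x ∷_)) ys)) (zeroʳ (S x y))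

    Φ-linear : ∀ k g h ys → Φ (λ xs → k * g xs - h xs) ys ≈ k * Φ g ys - Φ h ys
    Φ-linear k g h []       = refl
    Φ-linear k g h (y ∷ ys) = begin
      sum (λ x → S x y * Φ (λ xs → k * g (x ∷ xs) - h (x ∷ xs)) ys)
        ≈⟨ sum-cong-≋ (λ x → trans (*-congˡ {S x y} (Φ-linear k (g ∘ (x ∷_)) (h ∘ (x ∷_)) ys))
             (solve 4 (λ s k g h → s :* (k :* g :- h) := k :* (s :* g) :- s :* h) refl
               (S x y) k (Φ (g ∘ (x ∷_)) ys) (Φ (h ∘ (x ∷_)) ys))) ⟩
      sum (λ x → k * (S x y * Φ (g ∘ (x ∷_)) ys) - S x y * Φ (h ∘ (x ∷_)) ys)
        ≈⟨ sum-sub (λ x → k * (S x y * Φ (g ∘ (x ∷_)) ys)) (λ x → S x y * Φ (h ∘ (x ∷_)) ys) ⟩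
      sum (λ x → k * (S x y * Φ (g ∘ (x ∷_)) ys)) - sum (λ x → S x y * Φ (h ∘ (x ∷_)) ys)
        ≈⟨ +-congʳ (*-distribˡ-sum k (λ x → S x y * Φ (g ∘ (x ∷_)) ys)) ⟨
      _ ∎

    δ-Φ : ∀ v g ys → δ (λ y → sum λ x → v x * S x y) (Φ g) ys ≈ Φ (δ v g) ys
    δ-Φ v g []       = refl
    δ-Φ v g (y ∷ ys) = begin
      sum (λ x → v x * S x y) * Φ g ys - δ vS (λ zs → sum λ x → S x y * Φ (g ∘ (x ∷_)) zs) ys
        ≈⟨ +-cong (trans (*-comm _ _) (*-distribˡ-sum (Φ g ys) (λ x → v x * S x y)))
             (-‿cong (trans (δ-sum vS (λ x → S x y) (λ x → Φ (g ∘ (x ∷_))) ys)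
               (sum-cong-≋ λ x → *-congˡ {S x y} (δ-Φ v (g ∘ (x ∷_)) ys)))) ⟩
      sum (λ x → Φ g ys * (v x * S x y)) - sum (λ x → S x y * Φ (δ v (g ∘ (x ∷_))) ys)
        ≈⟨ sum-sub (λ x → Φ g ys * (v x * S x y)) (λ x → S x y * Φ (δ v (g ∘ (x ∷_))) ys) ⟨
      sum (λ x → Φ g ys * (v x * S x y) - S x y * Φ (δ v (g ∘ (x ∷_))) ys)
        ≈⟨ sum-cong-≋ (λ x → trans
             (solve 4 (λ p v s q → p :* (v :* s) :- s :* q := s :* (v :* p :- q)) refl
               (Φ g ys) (v x) (S x y) (Φ (δ v (g ∘ (x ∷_))) ys))
             (*-congˡ {S x y} (sym (Φ-linear (v x) g (δ v (g ∘ (x ∷_))) ys)))) ⟩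
      sum (λ x → S x y * Φ (λ xs → v x * g xs - δ v (g ∘ (x ∷_)) xs) ys) ∎
      where
      vS : Y → Carrier
      vS y = sum λ x → v x * S x y

    Δ-Φ : ∀ {m} (T : Fin m → Fin n → Carrier) g ys →
          Δ (λ i y → sum λ x → T i x * S x y) (Φ g) ys ≈ Φ (Δ T g) ys
    Δ-Φ {zero}  T g ys = refl
    Δ-Φ {suc m} T g ys = trans (δ-congʳ (Δ-Φ (T ∘ suc) g) ys) (δ-Φ (T zero) _ ys)

    Φ-unit : ∀ ys → Φ unit ys ≈ unit ys
    Φ-unit []       = refl
    Φ-unit (y ∷ ys) = sum-zero λ x → trans (*-congˡ (Φ-zero {λ _ → 0#} (λ _ → refl) ys)) (zeroʳ (S x y))

    Φ-divides : ∀ {d} g ys → (∀ xs → length xs ≡ length ys → d divides g xs) → d divides Φ g ys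
    Φ-divides g []       d∣g = d∣g [] ≡.refl
    Φ-divides g (y ∷ ys) d∣g = divides-sum (λ x → S x y) λ x →
      Φ-divides (g ∘ (x ∷_)) ys λ xs len → d∣g (x ∷ xs) (≡.cong suc len)

  -- Expanding the columns of `T ⊗ S` multilinearly through `Φ` writes its determinant as a
  -- combination of values of the alternating form `Δ T unit` on lists of n columns of T. Each value
  -- is a multiple of `det T`, and the combination equals 1.
  det-invertible : ∀ {n} {T S : Matrix n n} → (∀ i j → (T ⊗ S) i j ≈ identity i j) → det T divides 1#
  det-invertible {n} {T} {S} TS≈1 =
    let (q , eq) = Φ-divides S (Δ T unit) (allFin n) λ xs len → alternating-divides
                     (Δ-alternating T unit-alternating) xs (≡.trans len (List.length-tabulate id))
    in q , (begin
      1#                          ≈⟨ det-identity n ⟨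
      det (identity {n})          ≈⟨ det-cong TS≈1 ⟨
      det (T ⊗ S)                 ≈⟨ det-Δ (T ⊗ S) id ⟩
      Δ (T ⊗ S) unit (allFin n)   ≈⟨ Δ-cong {M = T ⊗ S} (λ _ _ → refl) (Φ-unit S) (allFin n) ⟨
      Δ (T ⊗ S) (Φ S unit) (allFin n) ≈⟨ Δ-Φ S T unit (allFin n) ⟩
      Φ S (Δ T unit) (allFin n)   ≈⟨ eq ⟩
      Δ T unit (allFin n) * q     ≈⟨ *-congʳ (det-Δ T id) ⟨
      det T * q                   ∎)

  ⊗-assoc : ∀ {k l m n} (L : Matrix k l) (M : Matrix l m) (N : Matrix m n) i j →
            ((L ⊗ M) ⊗ N) i j ≈ (L ⊗ (M ⊗ N)) i j
  ⊗-assoc L M N i j = begin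
    sum (λ q → sum (λ p → L i p * M p q) * N q j)
      ≈⟨ sum-cong-≋ (λ q → trans (*-comm _ _) (*-distribˡ-sum (N q j) (λ p → L i p * M p q))) ⟩
    sum (λ q → sum λ p → N q j * (L i p * M p q))
      ≈⟨ ∑-comm (λ q p → N q j * (L i p * M p q)) ⟩
    sum (λ p → sum λ q → N q j * (L i p * M p q))
      ≈⟨ sum-cong-≋ (λ p → trans
           (sum-cong-≋ λ q → solve 3 (λ x y z → x :* (y :* z) := y :* (z :* x)) refl (N q j) (L i p) (M p q))
           (sym (*-distribˡ-sum (L i p) (λ q → M p q * N q j)))) ⟩
    sum (λ p → L i p * sum (λ q → M p q * N q j)) ∎

  ⊗-congˡ : ∀ {l m n} {L : Matrix l m} {M N : Matrix m n} → (∀ i j → M i j ≈ N i j) →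
            ∀ i j → (L ⊗ M) i j ≈ (L ⊗ N) i j
  ⊗-congˡ {L = L} M≈N i j = sum-cong-≋ λ p → *-congˡ {L i p} (M≈N p j)

  ⊗-congʳ : ∀ {l m n} {L M : Matrix l m} {N : Matrix m n} → (∀ i j → L i j ≈ M i j) →
            ∀ i j → (L ⊗ N) i j ≈ (M ⊗ N) i j
  ⊗-congʳ {N = N} L≈M i j = sum-cong-≋ λ p → *-congʳ {N p j} (L≈M i p)

  -- Since `det T` is invertible, multiplying `T ⊗ S = 1` on the left by the adjugate identifies S
  -- with `adj T` divided by `det T`, and that matrix is also a left inverse.
  ⊗-inverse-comm : ∀ {n} {T S : Matrix n n} → (∀ i j → (T ⊗ S) i j ≈ identity i j) →
                   ∀ i j → (S ⊗ T) i j ≈ identity i j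
  ⊗-inverse-comm {n} {T} {S} TS≈1 i j = let (q , 1≈dq) = det-invertible {T = T} {S} TS≈1 in begin
    (S ⊗ T) i j                          ≈⟨ ⊗-congʳ {M = λ i j → q * adj T i j} {N = T} (S≈ q 1≈dq) i j ⟩
    sum (λ p → (q * adj T i p) * T p j)  ≈⟨ sum-cong-≋ (λ p → *-assoc q (adj T i p) (T p j)) ⟩
    sum (λ p → q * (adj T i p * T p j))  ≈⟨ *-distribˡ-sum q (λ p → adj T i p * T p j) ⟨
    q * (adj T ⊗ T) i j                  ≈⟨ *-congˡ (adj-⊗ T i j) ⟩
    q * (det T * identity i j)           ≈⟨ *-assoc q _ _ ⟨
    (q * det T) * identity i j           ≈⟨ *-congʳ (trans (*-comm q _) (sym 1≈dq)) ⟩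
    1# * identity i j                    ≈⟨ *-identityˡ _ ⟩
    identity i j                         ∎
    where
    S≈ : ∀ q → 1# ≈ det T * q → ∀ i j → S i j ≈ q * adj T i j
    S≈ q 1≈dq i j = begin
      S i j                                ≈⟨ *-identityˡ _ ⟨
      1# * S i j                           ≈⟨ *-congʳ 1≈dq ⟩
      (det T * q) * S i j                  ≈⟨ solve 3 (λ d q s → (d :* q) :* s := q :* (d :* s)) refl _ q _ ⟩
      q * (det T * S i j)                  ≈⟨ *-congˡ (*-congˡ (sum-identityˡ i (λ p → S p j))) ⟨
      q * (det T * sum (λ p → identity i p * S p j))
        ≈⟨ *-congˡ (*-distribˡ-sum (det T) (λ p → identity i p * S p j)) ⟩
      q * sum (λ p → det T * (identity i p * S p j))
        ≈⟨ *-congˡ (sum-cong-≋ λ p → trans (sym (*-assoc _ _ (S p j))) (*-congʳ {S p j} (sym (adj-⊗ T i p)))) ⟩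
      q * ((adj T ⊗ T) ⊗ S) i j            ≈⟨ *-congˡ (⊗-assoc (adj T) T S i j) ⟩
      q * (adj T ⊗ (T ⊗ S)) i j            ≈⟨ *-congˡ (⊗-congˡ {L = adj T} TS≈1 i j) ⟩
      q * (adj T ⊗ identity) i j           ≈⟨ *-congˡ (sum-identityʳ j (adj T i)) ⟩
      q * adj T i j                        ∎

  -- Here y N = 1 - pencil.
  module _ {n : ℕ} (y : Carrier) (N : Matrix n n) where
    private
      pencil : Matrix n n
      pencil = identity ⊖ y · N
      A = adj pencil

    pencil-⊗-adj : ∀ i j → y * (N ⊗ A) i j ≈ A i j - det pencil * identity i j
    pencil-⊗-adj i j = begin
      y * (N ⊗ A) i j
        ≈⟨ solve 2 (λ a b → b := a :- (a :- b)) refl (A i j) _ ⟩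
      A i j - (A i j - y * (N ⊗ A) i j)
        ≈⟨ +-congˡ (-‿cong (+-cong (sym (sum-identityˡ i (λ k → A k j)))
             (-‿cong (*-distribˡ-sum y (λ k → N i k * A k j))))) ⟩
      A i j - (sum (λ k → identity i k * A k j) - sum (λ k → y * (N i k * A k j)))
        ≈⟨ +-congˡ (-‿cong (trans
             (sym (sum-sub (λ k → identity i k * A k j) (λ k → y * (N i k * A k j))))
             (sum-cong (λ k → identity i k * A k j - y * (N i k * A k j)) (λ k → pencil i k * A k j)
               λ k → solve 4 (λ e y t a → e :* a :- y :* (t :* a) := (e :- y :* t) :* a) refl
                 (identity i k) y (N i k) (A k j)))) ⟩
      A i j - (pencil ⊗ A) i j
        ≈⟨ +-congˡ (-‿cong (⊗-adj pencil i j)) ⟩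
      A i j - det pencil * identity i j ∎

    adj-⊗-pencil : ∀ i j → y * (A ⊗ N) i j ≈ A i j - det pencil * identity i j
    adj-⊗-pencil i j = begin
      y * (A ⊗ N) i j
        ≈⟨ solve 2 (λ a b → b := a :- (a :- b)) refl (A i j) _ ⟩
      A i j - (A i j - y * (A ⊗ N) i j)
        ≈⟨ +-congˡ (-‿cong (+-cong (sym (sum-identityʳ j (A i)))
             (-‿cong (*-distribˡ-sum y (λ k → A i k * N k j))))) ⟩
      A i j - (sum (λ k → A i k * identity k j) - sum (λ k → y * (A i k * N k j)))
        ≈⟨ +-congˡ (-‿cong (trans
             (sym (sum-sub (λ k → A i k * identity k j) (λ k → y * (A i k * N k j))))
             (sum-cong (λ k → A i k * identity k j - y * (A i k * N k j)) (λ k → A i k * pencil k j)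
               λ k → solve 4 (λ e y t a → a :* e :- y :* (a :* t) := a :* (e :- y :* t)) refl
                 (identity k j) y (N k j) (A i k)))) ⟩
      A i j - (A ⊗ pencil) i j
        ≈⟨ +-congˡ (-‿cong (adj-⊗ pencil i j)) ⟩
      A i j - det pencil * identity i j ∎

-- Determinants and evaluation under ring homomorphisms

module Homomorphisms (R : CommutativeRing c ℓ) (A : CommutativeRing c′ ℓ′)
  (ι : CommutativeRing.Carrier R → CommutativeRing.Carrier A)
  (isHom : IsRingHomomorphism (CommutativeRing.rawRing R) (CommutativeRing.rawRing A) ι) where
  private
    module R = CommutativeRing R
    module ΣR = SemiringSum R.semiring
    module ΣA = SemiringSum (CommutativeRing.semiring A)
    module ER = SemiringExp R.semiring
    module EA = SemiringExp (CommutativeRing.semiring A)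
    module MR = Matrices R.rawRing
    module MA = Matrices (CommutativeRing.rawRing A)
    module DA = Determinants A
  open CommutativeRing A hiding (zero)
  open IsRingHomomorphism isHom
  open IntegerCoefficientSolver A

  homo-sum : ∀ {n} (f : Fin n → R.Carrier) → ι (ΣR.sum f) ≈ ΣA.sum (ι ∘ f)
  homo-sum {zero}  f = 0#-homo
  homo-sum {suc n} f = trans (+-homo _ _) (+-congˡ (homo-sum (f ∘ suc)))

  homo-sign : ∀ n → ι ((R.- R.1#) ER.^ n) ≈ (- 1#) EA.^ n
  homo-sign zero    = 1#-homo
  homo-sign (suc n) = trans (*-homo _ _)
    (*-cong (trans (-‿homo R.1#) (-‿cong 1#-homo)) (homo-sign n))

  homo-^ : ∀ x n → ι (x ER.^ n) ≈ ι x EA.^ n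
  homo-^ x zero    = 1#-homo
  homo-^ x (suc n) = trans (*-homo _ _) (*-congˡ (homo-^ x n))

  homo-⊗ : ∀ {k m n} (M : MR.Matrix k m) (N : MR.Matrix m n) i j →
           ι ((M MR.⊗ N) i j) ≈ ((λ i p → ι (M i p)) MA.⊗ (λ p j → ι (N p j))) i j
  homo-⊗ M N i j = trans (homo-sum λ p → M i p R.* N p j)
    (DA.sum-cong (λ p → ι (M i p R.* N p j)) (λ p → ι (M i p) * ι (N p j)) λ p → *-homo _ _)

  homo-identity : ∀ {n} (i j : Fin n) → ι (MR.identity i j) ≈ MA.identity i j
  homo-identity i j with i Fin.≟ j
  ... | yes _ = 1#-homo
  ... | no  _ = 0#-homo

  homo-det : ∀ {n} (M : MR.Matrix n n) → ι (MR.det M) ≈ MA.det (λ i j → ι (M i j))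
  homo-det {zero}  M = 1#-homo
  homo-det {suc n} M = trans
    (homo-sum λ j → M zero j R.* ((R.- R.1#) ER.^ toℕ j R.* MR.det (MR.minor M zero j)))
    (DA.sum-cong
      (λ j → ι (M zero j R.* ((R.- R.1#) ER.^ toℕ j R.* MR.det (MR.minor M zero j))))
      (λ j → ι (M zero j) * ((- 1#) EA.^ toℕ j * MA.det (MA.minor (λ i j → ι (M i j)) zero j)))
      λ j → trans (*-homo _ _) (*-congˡ (trans (*-homo _ _)
        (*-cong (homo-sign (toℕ j)) (homo-det (MR.minor M zero j))))))

  private
    ev : List R.Carrier → Carrier → Carrier
    ev = evaluate R.rawRing rawRing ι
    module PR = Polynomials R.rawRing
    module PolyR = CommutativeRing (Polys.commutativeRing R)

  module _ (x : Carrier) where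

    evaluate-zero : ∀ p → (∀ n → PR.coeff p n R.≈ R.0#) → ev p x ≈ 0#
    evaluate-zero []      p≈0 = refl
    evaluate-zero (r ∷ p) p≈0 = trans
      (+-cong (trans (⟦⟧-cong (p≈0 0)) 0#-homo) (*-congˡ (evaluate-zero p (p≈0 ∘ suc))))
      (solve 1 (λ x → :0 :+ x :* :0 := :0) refl x)

    evaluate-cong : ∀ p q → p PR.≈ₚ q → ev p x ≈ ev q x
    evaluate-cong []      q       p≈q = sym (evaluate-zero q (R.sym ∘ p≈q))
    evaluate-cong (r ∷ p) []      p≈q = evaluate-zero (r ∷ p) p≈q
    evaluate-cong (r ∷ p) (s ∷ q) p≈q =
      +-cong (⟦⟧-cong (p≈q 0)) (*-congˡ (evaluate-cong p q (p≈q ∘ suc)))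

    evaluate-+ : ∀ p q → ev (p PR.+ₚ q) x ≈ ev p x + ev q x
    evaluate-+ []      q       = sym (+-identityˡ _)
    evaluate-+ (r ∷ p) []      = sym (+-identityʳ _)
    evaluate-+ (r ∷ p) (s ∷ q) = trans (+-cong (+-homo r s) (*-congˡ (evaluate-+ p q)))
      (solve 5 (λ r s x p q → (r :+ s) :+ x :* (p :+ q) := (r :+ x :* p) :+ (s :+ x :* q))
        refl _ _ _ _ _)

    evaluate-scale : ∀ r q → ev (map (r R.*_) q) x ≈ ι r * ev q x
    evaluate-scale r []      = sym (zeroʳ _)
    evaluate-scale r (s ∷ q) = trans (+-cong (*-homo r s) (*-congˡ (evaluate-scale r q)))
      (solve 4 (λ r s x q → r :* s :+ x :* (r :* q) := r :* (s :+ x :* q)) refl _ _ _ _)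

    evaluate-* : ∀ p q → ev (p PR.*ₚ q) x ≈ ev p x * ev q x
    evaluate-* []      q = sym (zeroˡ _)
    evaluate-* (r ∷ p) q = trans (evaluate-+ (map (r R.*_) q) _) (trans
      (+-cong (evaluate-scale r q) (+-cong 0#-homo (*-congˡ (evaluate-* p q))))
      (solve 4 (λ r q x p → r :* q :+ (:0 :+ x :* (p :* q)) := (r :+ x :* p) :* q) refl _ _ _ _))

    evaluate-neg : ∀ p → ev (map R.-_ p) x ≈ - ev p x
    evaluate-neg []      = solve 0 (:0 := :- :0) refl
    evaluate-neg (r ∷ p) = trans (+-cong (-‿homo r) (*-congˡ (evaluate-neg p)))
      (solve 3 (λ r x p → :- r :+ x :* :- p := :- (r :+ x :* p)) refl _ _ _)

    evaluate-constant : ∀ r → ev (PR.constant r) x ≈ ι r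
    evaluate-constant r = solve 2 (λ r x → r :+ x :* :0 := r) refl (ι r) x

    evaluate-X : ev PR.X x ≈ x
    evaluate-X = trans (+-cong 0#-homo (*-congˡ (trans (evaluate-constant R.1#) 1#-homo)))
      (solve 1 (λ x → :0 :+ x :* :1 := x) refl x)

    evaluate-pencil : ∀ {n} (T : MR.Matrix n n) i j →
      let module MP = Matrices PolyR.rawRing in
      ev ((MP.identity MP.⊖ PR.X MP.· (λ i j → PR.constant (T i j))) i j) x ≈
      (MA.identity MA.⊖ x MA.· (λ i j → ι (T i j))) i j
    evaluate-pencil T i j = trans (evaluate-+ (identity i j) _)
      (+-cong entry (trans (evaluate-neg (PR.X PR.*ₚ PR.constant (T i j)))
        (-‿cong (trans (evaluate-* PR.X (PR.constant (T i j)))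
          (*-cong evaluate-X (evaluate-constant (T i j)))))))
      where
      open Matrices PolyR.rawRing using (identity)
      entry : ev (identity i j) x ≈ MA.identity i j
      entry with i Fin.≟ j
      ... | yes _ = trans (evaluate-constant R.1#) 1#-homo
      ... | no  _ = refl

    evaluate-isHom : IsRingHomomorphism PolyR.rawRing rawRing (λ p → ev p x)
    evaluate-isHom = mkIsRingHomomorphism PolyR.rawRing rawRing
      (λ {p} {q} → evaluate-cong p q) evaluate-+ refl evaluate-*
      (trans (evaluate-constant R.1#) 1#-homo) evaluate-neg

module ConstantPolynomial (R : CommutativeRing c ℓ) where
  open CommutativeRing R hiding (zero)
  open Polynomials rawRing using (constant)
  private module P = CommutativeRing (Polys.commutativeRing R)

  constant-isHom : IsRingHomomorphism rawRing P.rawRing constant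
  constant-isHom = mkIsRingHomomorphism rawRing P.rawRing
    (λ { x≈y zero → x≈y ; x≈y (suc n) → refl }) (λ x y → P.refl {constant (x + y)})
    (λ { zero → refl ; (suc n) → refl }) (λ { x y zero → sym (+-identityʳ _) ; x y (suc n) → refl })
    (P.refl {P.1#}) (λ x → P.refl {constant (- x)})

-- Degree bounds and top coefficients

module Degrees (R : CommutativeRing c ℓ) where
  open CommutativeRing R hiding (zero)
  open SemiringExp semiring using (_^_)
  open SemiringSum semiring using (sum; *-distribˡ-sum)
  open Polynomials rawRing using (Poly; coeff; constant; X; DegreeAtMost)
  open Polys R using (coeff-+; coeff-map; coeff-*)
  open Determinants R using (sum-zero; sum-cong)
  open IntegerCoefficientSolver R
  open RingProperties ring using (-0#≈0#)
  private
    module S = CommutativeRing (Series.commutativeRing R)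
    module P = CommutativeRing (Polys.commutativeRing R)
    module ΣP = SemiringSum P.semiring
    module EP = SemiringExp P.semiring
    module M = Matrices rawRing
    module MP = Matrices P.rawRing

  coeff-neg : ∀ p n → coeff (P.- p) n ≈ - coeff p n
  coeff-neg = coeff-map (λ x → - x) -0#≈0#

  coeff-sum : ∀ {n} (f : Fin n → Poly) k → coeff (ΣP.sum f) k ≈ sum (λ i → coeff (f i) k)
  coeff-sum {zero}  f k = refl
  coeff-sum {suc n} f k = trans (coeff-+ (f zero) (ΣP.sum (f ∘ suc)) k) (+-congˡ (coeff-sum (f ∘ suc) k))

  coeff-0-isHom : IsRingHomomorphism P.rawRing rawRing (λ p → coeff p 0)
  coeff-0-isHom = mkIsRingHomomorphism P.rawRing rawRing
    (λ p≈q → p≈q 0) (λ p q → coeff-+ p q 0) refl (λ p q → trans (coeff-* p q 0) (+-identityʳ _))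
    refl (λ p → coeff-neg p 0)

  -- The coefficient `x` may be zero: n bounds the degree and x sits at that bound. In this form the
  -- data are additive for sums and multiplicative for products over any commutative ring.
  record Top (p : Poly) (n : ℕ) (x : Carrier) : Set ℓ where
    constructor top
    field
      bound : DegreeAtMost p n
      lead  : coeff p n ≈ x
  open Top public

  Top-cong : ∀ {p q n x y} → p P.≈ q → x ≈ y → Top p n x → Top q n y
  Top-cong p≈q x≈y t = top (λ m n<m → trans (sym (p≈q m)) (bound t m n<m))
    (trans (sym (p≈q _)) (trans (lead t) x≈y))

  constant-* : ∀ (f g : ℕ → Carrier) → (∀ k → f (suc k) ≈ 0#) → ∀ k → (f S.* g) k ≈ f 0 * g k
  constant-* f g f↓ zero    = +-identityʳ _
  constant-* f g f↓ (suc k) = trans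
    (+-congˡ (trans (S.*-congʳ {g} {f ∘ suc} f↓ k) (S.zeroˡ g k))) (+-identityʳ _)

  private
    series-top : ∀ m n (f g : ℕ → Carrier) → (∀ k → m < k → f k ≈ 0#) → (∀ k → n < k → g k ≈ 0#) →
      (∀ k → m ℕ.+ n < k → (f S.* g) k ≈ 0#) × (f S.* g) (m ℕ.+ n) ≈ f m * g n
    series-top zero n f g f↓ g↓ = 
      (λ k n<k → trans (constant-* f g f↓′ k) (trans (*-congˡ (g↓ k n<k)) (zeroʳ _))) ,
      constant-* f g f↓′ n
      where
      f↓′ : ∀ k → f (suc k) ≈ 0#
      f↓′ k = f↓ (suc k) (s≤s z≤n)
    series-top (suc m) n f g f↓ g↓ =
      (λ { (suc k) (s≤s m+n<k) → vanish (g↓ (suc k) (ℕ.m≤n⇒m≤1+n (ℕ.≤-<-trans (ℕ.m≤n+m n m) m+n<k)))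
                                         (proj₁ ih k m+n<k) }) ,
      trans (+-cong (trans (*-congˡ (g↓ (suc (m ℕ.+ n)) (s≤s (ℕ.m≤n+m n m)))) (zeroʳ _)) (proj₂ ih))
        (+-identityˡ _)
      where
      ih = series-top m n (f ∘ suc) g (λ k m<k → f↓ (suc k) (s≤s m<k)) g↓
      vanish : ∀ {x y} → y ≈ 0# → ∀ {z} → z ≈ 0# → x * y + z ≈ 0#
      vanish y≈0 z≈0 = trans (+-cong (trans (*-congˡ y≈0) (zeroʳ _)) z≈0) (+-identityˡ _)

  Top-* : ∀ {p q m n x y} → Top p m x → Top q n y → Top (p P.* q) (m ℕ.+ n) (x * y)
  Top-* {p} {q} {m} {n} s t =
    let (b , l) = series-top m n (coeff p) (coeff q) (bound s) (bound t) in
    top (λ k m+n<k → trans (coeff-* p q k) (b k m+n<k))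
        (trans (coeff-* p q (m ℕ.+ n)) (trans l (*-cong (lead s) (lead t))))

  Top-constant : ∀ x → Top (constant x) 0 x
  Top-constant x = top (λ { (suc m) _ → refl }) refl

  Top-*ʳ : ∀ {p n x} → Top p n x → ∀ y → Top (p P.* constant y) n (x * y)
  Top-*ʳ {p} {x = x} t y =
    Top-cong (P.*-comm (constant y) p) (*-comm y x) (Top-* (Top-constant y) t)

  Top-⊖ : ∀ {p q n x y} → Top p n x → Top q n y → Top (p P.- q) n (x - y)
  Top-⊖ {p} {q} s t = top
    (λ m n<m → trans (coeff-+ p (P.- q) m) (trans
      (+-cong (bound s m n<m) (trans (coeff-neg q m) (-‿cong (bound t m n<m))))
      (solve 0 (:0 :- :0 := :0) refl)))
    (trans (coeff-+ p (P.- q) _) (+-cong (lead s) (trans (coeff-neg q _) (-‿cong (lead t)))))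

  Top-sum : ∀ {k n} {p : Fin k → Poly} {x : Fin k → Carrier} →
            (∀ i → Top (p i) n (x i)) → Top (ΣP.sum p) n (sum x)
  Top-sum {p = p} {x} t = top
    (λ m n<m → trans (coeff-sum p m) (sum-zero λ i → bound (t i) m n<m))
    (trans (coeff-sum p _) (sum-cong (λ i → coeff (p i) _) x λ i → lead (t i)))

  Top-sign : ∀ n → Top ((P.- P.1#) EP.^ n) 0 ((- 1#) ^ n)
  Top-sign zero    = Top-constant 1#
  Top-sign (suc n) = Top-* (Top-constant (- 1#)) (Top-sign n)

  Top-det : ∀ {n} {M : MP.Matrix n n} {N : M.Matrix n n} →
            (∀ i j → Top (M i j) 1 (N i j)) → Top (MP.det M) n (M.det N)
  Top-det {zero}          t = Top-constant 1#
  Top-det {suc n} {M} {N} t = Top-sum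
    {p = λ j → M zero j P.* ((P.- P.1#) EP.^ toℕ j P.* MP.det (MP.minor M zero j))}
    {x = λ j → N zero j * ((- 1#) ^ toℕ j * M.det (M.minor N zero j))}
    λ j → Top-* (t zero j) (Top-* (Top-sign (toℕ j)) (Top-det λ p q → t (suc p) (punchIn j q)))

  -- A cofactor is a determinant of size one less than n, and each entry contributes degree at most
  -- one.
  adj-bound : ∀ {n} {M : MP.Matrix n n} {N : M.Matrix n n} →
              (∀ i j → Top (M i j) 1 (N i j)) → ∀ i j k → n ℕ.≤ k → coeff (MP.adj M i j) k ≈ 0#
  adj-bound {suc n} t i j k n<k =
    bound (Top-* (Top-sign (toℕ j ℕ.+ toℕ i)) (Top-det λ p q → t (punchIn j p) (punchIn i q))) k n<k

  -- Ã and A have too small a degree to contribute to the top coefficient.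
  module _ {m n} {Ã : MP.Matrix m m} {A : MP.Matrix n n} {d̃ d : Poly} {D̃ D : Carrier}
    (Ã-bound : ∀ i j k → m ℕ.≤ k → coeff (Ã i j) k ≈ 0#) (A-bound : ∀ i j k → n ℕ.≤ k → coeff (A i j) k ≈ 0#)
    (d̃-top : Top d̃ m D̃) (d-top : Top d n D)
    (ρ : M.Matrix 1 m) (U : M.Matrix m n) (σ : M.Matrix n 1) where
    private
      ρᶜ : MP.Matrix 1 m
      ρᶜ i j = constant (ρ i j)
      Uᶜ : MP.Matrix m n
      Uᶜ i j = constant (U i j)
      σᶜ : MP.Matrix n 1
      σᶜ i j = constant (σ i j)

      L : MP.Matrix 1 m
      L = (ρᶜ MP.⊗ Ã) MP.⊖ d̃ MP.· ρᶜ
      R′ : MP.Matrix n 1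
      R′ = (A MP.⊗ σᶜ) MP.⊖ d MP.· σᶜ

      small : ∀ {p n} → (∀ k → n ℕ.≤ k → coeff p k ≈ 0#) → Top p n 0#
      small p↓ = top (λ k n<k → p↓ k (ℕ.<⇒≤ n<k)) (p↓ _ ℕ.≤-refl)

      L-top : ∀ p → Top (L zero p) m (- (D̃ * ρ zero p))
      L-top p = Top-cong (P.refl {L zero p})
        (trans (+-congʳ (sum-zero λ q → zeroʳ (ρ zero q))) (+-identityˡ _))
        (Top-⊖ (Top-sum {p = λ q → ρᶜ zero q P.* Ã q p} λ q →
          Top-* (Top-constant (ρ zero q)) (small {Ã q p} (Ã-bound q p))) (Top-*ʳ d̃-top (ρ zero p)))

      R-top : ∀ q → Top (R′ q zero) n (- (D * σ q zero))
      R-top q = Top-cong (P.refl {R′ q zero})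
        (trans (+-congʳ (sum-zero λ p → zeroˡ (σ p zero))) (+-identityˡ _))
        (Top-⊖ (Top-sum {p = λ p → A q p P.* σᶜ p zero} λ p →
          Top-*ʳ (small {A q p} (A-bound q p)) (σ p zero)) (Top-*ʳ d-top (σ q zero)))

    Top-form : Top (((L MP.⊗ Uᶜ) MP.⊗ R′) zero zero) (m ℕ.+ n) ((D̃ * D) * ((ρ M.⊗ U) M.⊗ σ) zero zero)
    Top-form = Top-cong (P.refl {((L MP.⊗ Uᶜ) MP.⊗ R′) zero zero}) lead≈
      (Top-sum {p = λ q → (L MP.⊗ Uᶜ) zero q P.* R′ q zero} λ q →
        Top-* (Top-sum {p = λ p → L zero p P.* Uᶜ p q} λ p → Top-*ʳ (L-top p) (U p q)) (R-top q))
      where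
      inner : ∀ q → sum (λ p → (- (D̃ * ρ zero p)) * U p q) ≈ - D̃ * (ρ M.⊗ U) zero q
      inner q = trans
        (sum-cong (λ p → (- (D̃ * ρ zero p)) * U p q) (λ p → - D̃ * (ρ zero p * U p q)) λ p →
          solve 3 (λ d r u → (:- (d :* r)) :* u := (:- d) :* (r :* u)) refl D̃ (ρ zero p) (U p q))
        (sym (*-distribˡ-sum (- D̃) (λ p → ρ zero p * U p q)))
      lead≈ : sum (λ q → sum (λ p → (- (D̃ * ρ zero p)) * U p q) * (- (D * σ q zero))) ≈
              (D̃ * D) * ((ρ M.⊗ U) M.⊗ σ) zero zero
      lead≈ = trans
        (sum-cong (λ q → sum (λ p → (- (D̃ * ρ zero p)) * U p q) * (- (D * σ q zero)))
                  (λ q → (D̃ * D) * ((ρ M.⊗ U) zero q * σ q zero)) λ q →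
          trans (*-congʳ (inner q)) (solve 4 (λ e d x s → ((:- e) :* x) :* (:- (d :* s)) := (e :* d) :* (x :* s))
            refl D̃ D ((ρ M.⊗ U) zero q) (σ q zero)))
        (sym (*-distribˡ-sum (D̃ * D) (λ q → (ρ M.⊗ U) zero q * σ q zero)))

  -- The monomial y = s z, described by its coefficients. The cases s = 1 for z and s = u for uz
  -- allow both pencils to be treated at once.
  record Linear (y : Poly) (s : Carrier) : Set ℓ where
    constructor linear
    field
      coeff₀ : coeff y 0 ≈ 0#
      coeff₁ : coeff y 1 ≈ s
      coeff₂ : ∀ k → coeff y (suc (suc k)) ≈ 0#
  open Linear public

  X-linear : Linear X 1#
  X-linear = linear refl refl λ k → refl

  module _ {y s} (y-lin : Linear y s) where

    linear-*₀ : ∀ p → coeff (y P.* p) 0 ≈ 0#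
    linear-*₀ p = trans (coeff-* y p 0) (trans (+-congʳ (*-congʳ (coeff₀ y-lin)))
      (solve 1 (λ x → :0 :* x :+ :0 := :0) refl _))

    linear-* : ∀ p k → coeff (y P.* p) (suc k) ≈ s * coeff p k
    linear-* p k = trans (coeff-* y p (suc k)) (trans
      (+-cong (trans (*-congʳ (coeff₀ y-lin)) (zeroˡ _))
        (trans (constant-* (coeff y ∘ suc) (coeff p) (coeff₂ y-lin) k) (*-congʳ (coeff₁ y-lin))))
      (+-identityˡ _))

    linear-^ : ∀ n p k → coeff ((y EP.^ n) P.* p) (n ℕ.+ k) ≈ s ^ n * coeff p k
    linear-^ zero    p k = trans (P.*-identityˡ p k) (sym (*-identityˡ _))
    linear-^ (suc n) p k = trans (P.*-assoc y (y EP.^ n) p (suc n ℕ.+ k))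
      (trans (linear-* ((y EP.^ n) P.* p) (n ℕ.+ k)) (trans (*-congˡ (linear-^ n p k))
        (sym (*-assoc s (s ^ n) _))))

    module _ {n} (T : M.Matrix n n) where

      pencil : MP.Matrix n n
      pencil = MP.identity MP.⊖ y MP.· (λ i j → constant (T i j))

      private
        identity-coeff₀ : ∀ (i j : Fin n) → coeff (MP.identity i j) 0 ≈ M.identity i j
        identity-coeff₀ i j with i Fin.≟ j
        ... | yes _ = refl
        ... | no  _ = refl

        identity-coeff₊ : ∀ (i j : Fin n) k → coeff (MP.identity i j) (suc k) ≈ 0#
        identity-coeff₊ i j k with i Fin.≟ j
        ... | yes _ = refl
        ... | no  _ = refl

        entry : ∀ i j k → coeff (pencil i j) k ≈
                coeff (MP.identity i j) k - coeff (y P.* constant (T i j)) k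
        entry i j k = trans (coeff-+ (MP.identity i j) _ k)
          (+-congˡ (coeff-neg (y P.* constant (T i j)) k))

      pencil-coeff₀ : ∀ i j → coeff (pencil i j) 0 ≈ M.identity i j
      pencil-coeff₀ i j = trans (entry i j 0) (trans
        (+-cong (identity-coeff₀ i j) (-‿cong (linear-*₀ (constant (T i j)))))
        (solve 1 (λ x → x :- :0 := x) refl _))

      pencil-top : ∀ i j → Top (pencil i j) 1 (- (s * T i j))
      pencil-top i j = top
        (λ { (suc zero) (s≤s ()) ; (suc (suc k)) _ → trans (entry i j (suc (suc k))) (trans
          (+-cong (identity-coeff₊ i j (suc k)) (-‿cong (linear-* (constant (T i j)) (suc k))))
          (solve 1 (λ s → :0 :- s :* :0 := :0) refl s)) })
        (trans (entry i j 1) (trans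
          (+-cong (identity-coeff₊ i j 0) (-‿cong (linear-* (constant (T i j)) 0)))
          (+-identityˡ _)))

      pencil-series₀ : ∀ (v : Fin n → ℕ → Carrier) i →
                       sum (λ j → (coeff (pencil i j) S.* v j) 0) ≈ v i 0
      pencil-series₀ v i = trans
        (sum-cong (λ j → (coeff (pencil i j) S.* v j) 0) (λ j → M.identity i j * v j 0)
          λ j → trans (+-identityʳ _) (*-congʳ (pencil-coeff₀ i j)))
        (Determinants.sum-identityˡ R i (λ j → v j 0))

      -- Multiplication by 1 - yT subtracts s T times the previous coefficient. A recursion
      -- `v (k+1) = s T v k`, possibly with an inhomogeneous term, thus becomes a linear system over
      -- power series.
      pencil-series₊ : ∀ (v : Fin n → ℕ → Carrier) i k →
                       sum (λ j → (coeff (pencil i j) S.* v j) (suc k)) ≈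
                       v i (suc k) - s * sum (λ j → T i j * v j k)
      pencil-series₊ v i k = begin
        sum (λ j → (coeff (pencil i j) S.* v j) (suc k))
          ≈⟨ sum-cong (λ j → (coeff (pencil i j) S.* v j) (suc k))
               (λ j → M.identity i j * v j (suc k) - s * (T i j * v j k)) (λ j → trans
               (+-cong (*-congʳ (pencil-coeff₀ i j)) (trans
                 (constant-* (coeff (pencil i j) ∘ suc) (v j)
                   (λ m → bound (pencil-top i j) (suc (suc m)) (s≤s (s≤s z≤n))) k)
                 (*-congʳ (lead (pencil-top i j)))))
               (solve 4 (λ e s t x → e :+ (:- (s :* t)) :* x := e :- s :* (t :* x)) refl
                 (M.identity i j * v j (suc k)) s (T i j) (v j k))) ⟩
        sum (λ j → M.identity i j * v j (suc k) - s * (T i j * v j k))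
          ≈⟨ Determinants.sum-sub R (λ j → M.identity i j * v j (suc k)) (λ j → s * (T i j * v j k)) ⟩
        sum (λ j → M.identity i j * v j (suc k)) - sum (λ j → s * (T i j * v j k))
          ≈⟨ +-cong (Determinants.sum-identityˡ R i (λ j → v j (suc k)))
               (-‿cong (sym (SemiringSum.*-distribˡ-sum semiring s (λ j → T i j * v j k)))) ⟩
        v i (suc k) - s * sum (λ j → T i j * v j k) ∎
        where open SetoidReasoning setoid

      -- Taking the constant coefficient is a ring homomorphism that sends the pencil to the
      -- identity matrix.
      det-pencil-coeff₀ : coeff (MP.det pencil) 0 ≈ 1#
      det-pencil-coeff₀ = trans (Homomorphisms.homo-det (Polys.commutativeRing R) R (λ p → coeff p 0) coeff-0-isHom pencil)
        (trans (Determinants.det-cong R pencil-coeff₀) (Determinants.det-identity R n))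

      det-pencil-top : Top (MP.det pencil) n (M.det (λ i j → - (s * T i j)))
      det-pencil-top = Top-det pencil-top

      adj-pencil-bound : ∀ i j k → n ℕ.≤ k → coeff (MP.adj pencil i j) k ≈ 0#
      adj-pencil-bound = adj-bound pencil-top

  module _ (Q : CommutativeRing c′ ℓ′) {ι : CommutativeRing.Carrier Q → Carrier}
           (isHom : IsRingHomomorphism (CommutativeRing.rawRing Q) rawRing ι)
           {y s} (y-lin : Linear y s) where
    private
      module Q = CommutativeRing Q
      module PQ = Polynomials Q.rawRing
    open IsRingHomomorphism isHom using (0#-homo)

    -- Substituting y = s z scales the k-th coefficient by the k-th power of s. For s = u this is
    -- the origin of the power of u in the leading coefficient of Ñ.
    coeff-evaluate : ∀ p k → coeff (evaluate Q.rawRing P.rawRing (constant ∘ ι) p y) k ≈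
                             ι (PQ.coeff p k) * s ^ k
    coeff-evaluate []      k       = sym (trans (*-congʳ 0#-homo) (zeroˡ _))
    coeff-evaluate (r ∷ p) zero    = trans
      (coeff-+ (constant (ι r)) (y P.* evaluate Q.rawRing P.rawRing (constant ∘ ι) p y) 0)
      (trans (+-congˡ (linear-*₀ y-lin (evaluate Q.rawRing P.rawRing (constant ∘ ι) p y)))
        (solve 1 (λ x → x :+ :0 := x :* :1) refl _))
    coeff-evaluate (r ∷ p) (suc k) = trans
      (coeff-+ (constant (ι r)) (y P.* evaluate Q.rawRing P.rawRing (constant ∘ ι) p y) (suc k))
      (trans (+-cong refl (linear-* y-lin (evaluate Q.rawRing P.rawRing (constant ∘ ι) p y) k))
        (trans (+-congˡ (*-congˡ (coeff-evaluate p k)))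
          (solve 3 (λ s x t → :0 :+ s :* (x :* t) := x :* (s :* t)) refl s _ (s ^ k))))

-- Units and cancellation

module Units (R : CommutativeRing c ℓ) where
  open CommutativeRing R hiding (zero)
  open SemiringExp semiring using (_^_)
  open IntegerCoefficientSolver R

  Unit : Carrier → Set _
  Unit x = ∃ λ y → x * y ≈ 1#

  unit-cong : ∀ {x y} → x ≈ y → Unit x → Unit y
  unit-cong x≈y (z , xz≈1) = z , trans (*-congʳ (sym x≈y)) xz≈1

  unit-1 : Unit 1#
  unit-1 = 1# , *-identityˡ 1#

  unit-inverse : ∀ {x y} → x * y ≈ 1# → Unit y
  unit-inverse {x} xy≈1 = x , trans (*-comm _ _) xy≈1

  unit-* : ∀ {x y} → Unit x → Unit y → Unit (x * y)
  unit-* {x} {y} (p , xp≈1) (q , yq≈1) = p * q , trans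
    (solve 4 (λ x y p q → (x :* y) :* (p :* q) := (x :* p) :* (y :* q)) refl x y p q)
    (trans (*-cong xp≈1 yq≈1) (*-identityˡ 1#))

  unit-neg : ∀ {x} → Unit x → Unit (- x)
  unit-neg {x} (p , xp≈1) = - p , trans (solve 2 (λ x p → (:- x) :* (:- p) := x :* p) refl x p) xp≈1

  unit-^ : ∀ {x} → Unit x → ∀ n → Unit (x ^ n)
  unit-^ u zero    = unit-1
  unit-^ u (suc n) = unit-* u (unit-^ u n)

  unit-cancel : ∀ {g x y} → Unit g → g * x ≈ g * y → x ≈ y
  unit-cancel {g} {x} {y} (h , gh≈1) gx≈gy = trans (expand x) (trans (*-congˡ gx≈gy) (sym (expand y)))
    where
    expand : ∀ x → x ≈ h * (g * x)
    expand x = trans (sym (*-identityˡ x)) (trans (*-congʳ (sym gh≈1))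
      (solve 3 (λ g h x → (g :* h) :* x := h :* (g :* x)) refl g h x))

  -- Bookkeeping for `Ñ-lead`: the left side is the top coefficient computed from the determinants,
  -- with p the full power of u and o a power of 1; on the right, the part e of that power which has
  -- to be cancelled stands in front.
  collect : ∀ {a b c e o p q s x} → o ≈ 1# → p ≈ e * q → s * x ≈ (a * b) * c →
            ((a * p) * (b * o)) * c ≈ e * (s * (x * q))
  collect {a} {b} {c} {e} {o} {p} {q} {s} {x} o≈1 p≈eq sx≈abc = trans
    (*-congʳ (*-cong (*-congˡ p≈eq) (*-congˡ o≈1)))
    (trans (solve 5 (λ a b c e q → ((a :* (e :* q)) :* (b :* :1)) :* c := ((a :* b) :* c) :* (e :* q))
        refl a b c e q)
      (trans (*-congʳ (sym sx≈abc))
        (solve 4 (λ s x e q → (s :* x) :* (e :* q) := e :* (s :* (x :* q))) refl s x e q)))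

-- Cramer's rule, and stepping along chains of rows and columns

module MatrixAlgebra (R : CommutativeRing c ℓ) where
  open CommutativeRing R hiding (zero)
  open Determinants R
  open Matrices rawRing using (Matrix; identity; _⊗_; _⊖_; _·_)
  open SemiringSum semiring using (*-distribˡ-sum)
  open IntegerCoefficientSolver R
  open SetoidReasoning setoid

  open CommutativeSemiringExp commutativeSemiring using (_^_; ^-distrib-*)

  geometric : ∀ {r} y (x : Fin (suc r) → Carrier) → (∀ i → y * x (inject₁ i) ≈ x (suc i)) →
              y ^ r * x zero ≈ x (fromℕ r)
  geometric {zero}  y x step = *-identityˡ _
  geometric {suc r} y x step = trans
    (solve 3 (λ y p x → (y :* p) :* x := p :* (y :* x)) refl y (y ^ r) (x zero))
    (trans (*-congˡ (step zero)) (geometric y (x ∘ suc) (step ∘ suc)))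

  infix 4 _≈ᴹ_
  _≈ᴹ_ : ∀ {m n} → Matrix m n → Matrix m n → Set ℓ
  M ≈ᴹ N = ∀ i j → M i j ≈ N i j

  private
    variable
      k m n : ℕ

  ·-⊗ : ∀ x (M : Matrix k m) (N : Matrix m n) → x · (M ⊗ N) ≈ᴹ (x · M) ⊗ N
  ·-⊗ x M N i j = trans (*-distribˡ-sum x (λ p → M i p * N p j))
    (sum-cong (λ p → x * (M i p * N p j)) (λ p → (x * M i p) * N p j) λ p → sym (*-assoc _ _ _))

  ⊗-· : ∀ x (M : Matrix k m) (N : Matrix m n) → x · (M ⊗ N) ≈ᴹ M ⊗ (x · N)
  ⊗-· x M N i j = trans (*-distribˡ-sum x (λ p → M i p * N p j))
    (sum-cong (λ p → x * (M i p * N p j)) (λ p → M i p * (x * N p j))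
      λ p → solve 3 (λ x m n → x :* (m :* n) := m :* (x :* n)) refl _ _ _)

  ⊖-⊗ : ∀ (L M : Matrix k m) (N : Matrix m n) → (L ⊖ M) ⊗ N ≈ᴹ (L ⊗ N) ⊖ (M ⊗ N)
  ⊖-⊗ L M N i j = trans
    (sum-cong (λ p → (L i p - M i p) * N p j) (λ p → L i p * N p j - M i p * N p j)
      λ p → solve 3 (λ l m n → (l :- m) :* n := l :* n :- m :* n) refl _ _ _)
    (sum-sub (λ p → L i p * N p j) (λ p → M i p * N p j))

  ⊗-⊖ : ∀ (L : Matrix k m) (M N : Matrix m n) → L ⊗ (M ⊖ N) ≈ᴹ (L ⊗ M) ⊖ (L ⊗ N)
  ⊗-⊖ L M N i j = trans
    (sum-cong (λ p → L i p * (M p j - N p j)) (λ p → L i p * M p j - L i p * N p j)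
      λ p → solve 3 (λ l m n → l :* (m :- n) := l :* m :- l :* n) refl _ _ _)
    (sum-sub (λ p → L i p * M p j) (λ p → L i p * N p j))

  -- Here A = adj (1 - y T) and Ã = adj (1 - ỹ T̃), with determinants d and d̃.
  module AdjugateForm (ỹ d̃ : Carrier) {T̃ Ã : Matrix m m}
    (right : ỹ · (T̃ ⊗ Ã) ≈ᴹ Ã ⊖ d̃ · identity) (U : Matrix m n) (y d : Carrier) {T A : Matrix n n}
    (left : y · (A ⊗ T) ≈ᴹ A ⊖ d · identity) where

    -- The entries of `Ã U A` are the values at unit vectors. Admitting arbitrary ρ and σ lets a
    -- value be transported along T̃ and T.
    form : Matrix 1 m → Matrix n 1 → Carrier
    form ρ σ = ((ρ ⊗ Ã) ⊗ (U ⊗ (A ⊗ σ))) zero zero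

    row-step : ∀ {g} (ρ ρ′ : Matrix 1 m) → ρ ⊗ T̃ ≈ᴹ g · ρ′ →
               ỹ · (g · (ρ′ ⊗ Ã)) ≈ᴹ (ρ ⊗ Ã) ⊖ d̃ · ρ
    row-step {g} ρ ρ′ ρT̃ i j = begin
      ỹ * (g * (ρ′ ⊗ Ã) i j)                  ≈⟨ *-congˡ (·-⊗ g ρ′ Ã i j) ⟩
      ỹ * ((g · ρ′) ⊗ Ã) i j                  ≈⟨ *-congˡ (⊗-congʳ {N = Ã} ρT̃ i j) ⟨
      ỹ * ((ρ ⊗ T̃) ⊗ Ã) i j                   ≈⟨ *-congˡ (⊗-assoc ρ T̃ Ã i j) ⟩
      ỹ * (ρ ⊗ (T̃ ⊗ Ã)) i j                   ≈⟨ ⊗-· ỹ ρ (T̃ ⊗ Ã) i j ⟩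
      (ρ ⊗ (ỹ · (T̃ ⊗ Ã))) i j                 ≈⟨ ⊗-congˡ {L = ρ} right i j ⟩
      (ρ ⊗ (Ã ⊖ d̃ · identity)) i j            ≈⟨ ⊗-⊖ ρ Ã (d̃ · identity) i j ⟩
      (ρ ⊗ Ã) i j - (ρ ⊗ (d̃ · identity)) i j  ≈⟨ +-congˡ (-‿cong (⊗-· d̃ ρ identity i j)) ⟨
      (ρ ⊗ Ã) i j - d̃ * (ρ ⊗ identity) i j    ≈⟨ +-congˡ (-‿cong (*-congˡ (sum-identityʳ j (ρ i)))) ⟩
      (ρ ⊗ Ã) i j - d̃ * ρ i j                 ∎

    column-step : ∀ {g} (σ σ′ : Matrix n 1) → T ⊗ σ ≈ᴹ g · σ′ →
                  y · (g · (A ⊗ σ′)) ≈ᴹ (A ⊗ σ) ⊖ d · σ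
    column-step {g} σ σ′ Tσ i j = begin
      y * (g * (A ⊗ σ′) i j)                  ≈⟨ *-congˡ (⊗-· g A σ′ i j) ⟩
      y * (A ⊗ (g · σ′)) i j                  ≈⟨ *-congˡ (⊗-congˡ {L = A} Tσ i j) ⟨
      y * (A ⊗ (T ⊗ σ)) i j                   ≈⟨ *-congˡ (⊗-assoc A T σ i j) ⟨
      y * ((A ⊗ T) ⊗ σ) i j                   ≈⟨ ·-⊗ y (A ⊗ T) σ i j ⟩
      ((y · (A ⊗ T)) ⊗ σ) i j                 ≈⟨ ⊗-congʳ {N = σ} left i j ⟩
      ((A ⊖ d · identity) ⊗ σ) i j            ≈⟨ ⊖-⊗ A (d · identity) σ i j ⟩
      (A ⊗ σ) i j - ((d · identity) ⊗ σ) i j  ≈⟨ +-congˡ (-‿cong (·-⊗ d identity σ i j)) ⟨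
      (A ⊗ σ) i j - d * (identity ⊗ σ) i j    ≈⟨ +-congˡ (-‿cong (*-congˡ (sum-identityˡ i (λ p → σ p j)))) ⟩
      (A ⊗ σ) i j - d * σ i j                 ∎

    -- By `row-step`, ỹ ρ T̃ Ã differs from ρ Ã by the correction d̃ ρ. It meets U next, and ρ U = 0
    -- removes it, so the step changes the form only by a scalar.
    form-row : ∀ {g} (ρ ρ′ : Matrix 1 m) σ → ρ ⊗ T̃ ≈ᴹ g · ρ′ → (∀ j → (ρ ⊗ U) zero j ≈ 0#) →
               ỹ * (g * form ρ′ σ) ≈ form ρ σ
    form-row {g} ρ ρ′ σ ρT̃ ρU≈0 = begin
      ỹ * (g * ((ρ′ ⊗ Ã) ⊗ X) zero zero)             ≈⟨ *-congˡ (·-⊗ g (ρ′ ⊗ Ã) X zero zero) ⟩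
      ỹ * ((g · (ρ′ ⊗ Ã)) ⊗ X) zero zero             ≈⟨ ·-⊗ ỹ (g · (ρ′ ⊗ Ã)) X zero zero ⟩
      ((ỹ · (g · (ρ′ ⊗ Ã))) ⊗ X) zero zero           ≈⟨ ⊗-congʳ {N = X} (row-step ρ ρ′ ρT̃) zero zero ⟩
      (((ρ ⊗ Ã) ⊖ d̃ · ρ) ⊗ X) zero zero              ≈⟨ ⊖-⊗ (ρ ⊗ Ã) (d̃ · ρ) X zero zero ⟩
      form ρ σ - ((d̃ · ρ) ⊗ X) zero zero             ≈⟨ +-congˡ (-‿cong (·-⊗ d̃ ρ X zero zero)) ⟨
      form ρ σ - d̃ * (ρ ⊗ (U ⊗ (A ⊗ σ))) zero zero   ≈⟨ +-congˡ (-‿cong (*-congˡ (⊗-assoc ρ U (A ⊗ σ) zero zero))) ⟨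
      form ρ σ - d̃ * ((ρ ⊗ U) ⊗ (A ⊗ σ)) zero zero
        ≈⟨ +-congˡ (-‿cong (*-congˡ (sum-zero λ j →
             trans (*-congʳ {(A ⊗ σ) j zero} (ρU≈0 j)) (zeroˡ _)))) ⟩
      form ρ σ - d̃ * 0#                              ≈⟨ solve 2 (λ x d → x :- d :* :0 := x) refl _ d̃ ⟩
      form ρ σ                                       ∎
      where
      X = U ⊗ (A ⊗ σ)

    form-column : ∀ {g} ρ (σ σ′ : Matrix n 1) → T ⊗ σ ≈ᴹ g · σ′ → (∀ i → (U ⊗ σ) i zero ≈ 0#) →
                  y * (g * form ρ σ′) ≈ form ρ σ
    form-column {g} ρ σ σ′ Tσ Uσ≈0 = begin
      y * (g * (ρÃ ⊗ (U ⊗ (A ⊗ σ′))) zero zero)   ≈⟨ *-congˡ (⊗-· g ρÃ (U ⊗ (A ⊗ σ′)) zero zero) ⟩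
      y * (ρÃ ⊗ (g · (U ⊗ (A ⊗ σ′)))) zero zero   ≈⟨ ⊗-· y ρÃ (g · (U ⊗ (A ⊗ σ′))) zero zero ⟩
      (ρÃ ⊗ (y · (g · (U ⊗ (A ⊗ σ′))))) zero zero ≈⟨ ⊗-congˡ {L = ρÃ} inner zero zero ⟩
      form ρ σ                                    ∎
      where
      ρÃ = ρ ⊗ Ã
      inner : y · (g · (U ⊗ (A ⊗ σ′))) ≈ᴹ U ⊗ (A ⊗ σ)
      inner i zero = begin
        y * (g * (U ⊗ (A ⊗ σ′)) i zero)     ≈⟨ *-congˡ (⊗-· g U (A ⊗ σ′) i zero) ⟩
        y * (U ⊗ (g · (A ⊗ σ′))) i zero     ≈⟨ ⊗-· y U (g · (A ⊗ σ′)) i zero ⟩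
        (U ⊗ (y · (g · (A ⊗ σ′)))) i zero   ≈⟨ ⊗-congˡ {L = U} (column-step σ σ′ Tσ) i zero ⟩
        (U ⊗ ((A ⊗ σ) ⊖ d · σ)) i zero      ≈⟨ ⊗-⊖ U (A ⊗ σ) (d · σ) i zero ⟩
        (U ⊗ (A ⊗ σ)) i zero - (U ⊗ (d · σ)) i zero
          ≈⟨ +-congˡ (-‿cong (trans (sym (⊗-· d U σ i zero)) (trans (*-congˡ (Uσ≈0 i)) (zeroʳ d)))) ⟩
        (U ⊗ (A ⊗ σ)) i zero - 0#           ≈⟨ solve 1 (λ x → x :- :0 := x) refl _ ⟩
        (U ⊗ (A ⊗ σ)) i zero                ∎

    -- In the last step on each side the corrections are kept, since nothing is assumed about ρ U
    -- and U σ. They are the terms that reach the top degree in `Top-form`.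
    form-last : ∀ (ρ ρ′ : Matrix 1 m) (σ σ′ : Matrix n 1) → ρ ⊗ T̃ ≈ᴹ ρ′ → T ⊗ σ ≈ᴹ σ′ →
                ỹ * (y * form ρ′ σ′) ≈ ((((ρ ⊗ Ã) ⊖ d̃ · ρ) ⊗ U) ⊗ ((A ⊗ σ) ⊖ d · σ)) zero zero
    form-last ρ ρ′ σ σ′ ρT̃ Tσ = begin
      ỹ * (y * (ρ′Ã ⊗ (U ⊗ Aσ′)) zero zero)        ≈⟨ *-congˡ (*-congˡ (⊗-assoc ρ′Ã U Aσ′ zero zero)) ⟨
      ỹ * (y * ((ρ′Ã ⊗ U) ⊗ Aσ′) zero zero)        ≈⟨ *-congˡ (⊗-· y (ρ′Ã ⊗ U) Aσ′ zero zero) ⟩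
      ỹ * ((ρ′Ã ⊗ U) ⊗ (y · Aσ′)) zero zero        ≈⟨ ·-⊗ ỹ (ρ′Ã ⊗ U) (y · Aσ′) zero zero ⟩
      ((ỹ · (ρ′Ã ⊗ U)) ⊗ (y · Aσ′)) zero zero      ≈⟨ ⊗-congʳ {N = y · Aσ′} rows zero zero ⟩
      ((((ρ ⊗ Ã) ⊖ d̃ · ρ) ⊗ U) ⊗ (y · Aσ′)) zero zero
        ≈⟨ ⊗-congˡ {L = ((ρ ⊗ Ã) ⊖ d̃ · ρ) ⊗ U} columns zero zero ⟩
      ((((ρ ⊗ Ã) ⊖ d̃ · ρ) ⊗ U) ⊗ ((A ⊗ σ) ⊖ d · σ)) zero zero ∎
      where
      ρ′Ã = ρ′ ⊗ Ã
      Aσ′ = A ⊗ σ′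
      unscale : ∀ {i j} {M N : Matrix i j} → M ≈ᴹ N → M ≈ᴹ 1# · N
      unscale M≈N i j = trans (M≈N i j) (sym (*-identityˡ _))
      columns : y · Aσ′ ≈ᴹ (A ⊗ σ) ⊖ d · σ
      columns i j = trans (*-congˡ (sym (*-identityˡ _))) (column-step σ σ′ (unscale Tσ) i j)
      rows : ỹ · (ρ′Ã ⊗ U) ≈ᴹ ((ρ ⊗ Ã) ⊖ d̃ · ρ) ⊗ U
      rows i j = trans (·-⊗ ỹ ρ′Ã U i j) (⊗-congʳ {N = U} (λ i j →
        trans (*-congˡ (sym (*-identityˡ _))) (row-step ρ ρ′ (unscale ρT̃) i j)) i j)

    form-entry : ∀ {p₀ q₀} (ρ : Matrix 1 m) (σ : Matrix n 1) →
      (∀ p → ρ zero p ≈ identity p₀ p) → (∀ q → σ q zero ≈ identity q q₀) →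
      form ρ σ ≈ ((Ã ⊗ U) ⊗ A) p₀ q₀
    form-entry {p₀} {q₀} ρ σ ρ≈ σ≈ = begin
      ((ρ ⊗ Ã) ⊗ (U ⊗ (A ⊗ σ))) zero zero   ≈⟨ ⊗-assoc (ρ ⊗ Ã) U (A ⊗ σ) zero zero ⟨
      (((ρ ⊗ Ã) ⊗ U) ⊗ (A ⊗ σ)) zero zero
        ≈⟨ sum-cong (λ q → ((ρ ⊗ Ã) ⊗ U) zero q * (A ⊗ σ) q zero) (λ q → (Ã ⊗ U) p₀ q * A q q₀) (λ q →
             *-cong (sum-cong (λ p → (ρ ⊗ Ã) zero p * U p q) (λ p → Ã p₀ p * U p q) λ p →
                       *-congʳ (trans (sum-cong (λ i → ρ zero i * Ã i p) (λ i → identity p₀ i * Ã i p)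
                         λ i → *-congʳ (ρ≈ i)) (sum-identityˡ p₀ (λ i → Ã i p))))
                    (trans (sum-cong (λ j → A q j * σ j zero) (λ j → A q j * identity j q₀)
                      λ j → *-congˡ (σ≈ j)) (sum-identityʳ q₀ (A q)))) ⟩
      ((Ã ⊗ U) ⊗ A) p₀ q₀                   ∎

    -- The chains run from the given entry at index zero to their ends, each index being one
    -- application of T̃ or T short of the next. The final step to ρ and σ adds one more factor,
    -- hence the exponents `suc r` and `suc s`.
    form-chain : ∀ {r s g h} (ρs : Fin (suc r) → Matrix 1 m) (σs : Fin (suc s) → Matrix n 1) ρ σ →
      (∀ i → ρs (suc i) ⊗ T̃ ≈ᴹ g · ρs (inject₁ i)) → (∀ i j → (ρs (suc i) ⊗ U) zero j ≈ 0#) →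
      (∀ i → T ⊗ σs (suc i) ≈ᴹ h · σs (inject₁ i)) → (∀ i j → (U ⊗ σs (suc i)) j zero ≈ 0#) →
      ρ ⊗ T̃ ≈ᴹ ρs (fromℕ r) → T ⊗ σ ≈ᴹ σs (fromℕ s) →
      ((((ρ ⊗ Ã) ⊖ d̃ · ρ) ⊗ U) ⊗ ((A ⊗ σ) ⊖ d · σ)) zero zero ≈
      ỹ ^ suc r * (y ^ suc s * ((g ^ r * h ^ s) * form (ρs zero) (σs zero)))
    form-chain {r} {s} {g} {h} ρs σs ρ σ ρT̃ ρU Tσ Uσ last-ρ last-σ = sym (begin
      ỹ ^ suc r * (y ^ suc s * ((g ^ r * h ^ s) * x))
        ≈⟨ solve 7 (λ ỹ ỹr y ys gr hs x → (ỹ :* ỹr) :* ((y :* ys) :* ((gr :* hs) :* x)) :=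
             ỹ :* (y :* ((ys :* hs) :* ((ỹr :* gr) :* x)))) refl ỹ (ỹ ^ r) y (y ^ s) (g ^ r) (h ^ s) x ⟩
      ỹ * (y * ((y ^ s * h ^ s) * ((ỹ ^ r * g ^ r) * x)))
        ≈⟨ *-congˡ (*-congˡ (*-cong (^-distrib-* y h s) (*-congʳ (^-distrib-* ỹ g r)))) ⟨
      ỹ * (y * ((y * h) ^ s * ((ỹ * g) ^ r * x)))
        ≈⟨ *-congˡ (*-congˡ (*-congˡ (geometric (ỹ * g) (λ i → form (ρs i) (σs zero)) λ i →
             trans (*-assoc ỹ g _) (form-row (ρs (suc i)) (ρs (inject₁ i)) (σs zero) (ρT̃ i) (ρU i))))) ⟩
      ỹ * (y * ((y * h) ^ s * form (ρs (fromℕ r)) (σs zero)))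
        ≈⟨ *-congˡ (*-congˡ (geometric (y * h) (λ i → form (ρs (fromℕ r)) (σs i)) λ i →
             trans (*-assoc y h _) (form-column (ρs (fromℕ r)) (σs (suc i)) (σs (inject₁ i)) (Tσ i) (Uσ i)))) ⟩
      ỹ * (y * form (ρs (fromℕ r)) (σs (fromℕ s)))
        ≈⟨ form-last ρ (ρs (fromℕ r)) σ (σs (fromℕ s)) last-ρ last-σ ⟩
      ((((ρ ⊗ Ã) ⊖ d̃ · ρ) ⊗ U) ⊗ ((A ⊗ σ) ⊖ d · σ)) zero zero ∎)
      where
      x = form (ρs zero) (σs zero)

  cramer : ∀ {d} {Q Q′ : Matrix n n} {v w : Matrix n 1} → Q′ ⊗ Q ≈ᴹ d · identity → Q ⊗ v ≈ᴹ w → Q′ ⊗ w ≈ᴹ d · v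
  cramer {d = d} {Q} {Q′} {v} {w} Q′Q≈d Qv≈w i j = begin
    (Q′ ⊗ w) i j                ≈⟨ ⊗-congˡ {L = Q′} Qv≈w i j ⟨
    (Q′ ⊗ (Q ⊗ v)) i j          ≈⟨ ⊗-assoc Q′ Q v i j ⟨
    ((Q′ ⊗ Q) ⊗ v) i j          ≈⟨ ⊗-congʳ {N = v} Q′Q≈d i j ⟩
    ((d · identity) ⊗ v) i j    ≈⟨ ·-⊗ d identity v i j ⟨
    d * (identity ⊗ v) i j      ≈⟨ *-congˡ (sum-identityˡ i (λ p → v p j)) ⟩
    d * v i j                   ∎

  -- Z solves the system of Q with a unit vector on the right, and W solves that of Q̃ with
  -- right-hand side U Z. Applying the two adjugates in turn brings out one determinant each.
  cramer-twice : ∀ {d d̃} {Q Q′ : Matrix n n} {Q̃ Q̃′ : Matrix m m} {U : Matrix m n}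
    {Z : Matrix n 1} {V W : Matrix m 1} q₀ → Q′ ⊗ Q ≈ᴹ d · identity → Q̃′ ⊗ Q̃ ≈ᴹ d̃ · identity →
    Q ⊗ Z ≈ᴹ (λ q _ → identity q q₀) → U ⊗ Z ≈ᴹ V → Q̃ ⊗ W ≈ᴹ V →
    ∀ p₀ → ((Q̃′ ⊗ U) ⊗ Q′) p₀ q₀ ≈ W p₀ zero * (d̃ * d)
  cramer-twice {d = d} {d̃} {Q} {Q′} {Q̃} {Q̃′} {U} {Z} {V} {W} q₀ Q′Q≈d Q̃′Q̃≈d̃ QZ≈E UZ≈V Q̃W≈V p₀ = begin
    ((Q̃′ ⊗ U) ⊗ Q′) p₀ q₀
      ≈⟨ sum-cong (λ q → (Q̃′ ⊗ U) p₀ q * Q′ q q₀) (λ q → (Q̃′ ⊗ U) p₀ q * (d * Z q zero)) (λ q →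
           *-congˡ (trans (sym (sum-identityʳ q₀ (Q′ q)))
             (cramer {Q = Q} {Q′} {Z} {λ q _ → identity q q₀} Q′Q≈d QZ≈E q zero))) ⟩
    ((Q̃′ ⊗ U) ⊗ (d · Z)) p₀ zero    ≈⟨ ⊗-· d (Q̃′ ⊗ U) Z p₀ zero ⟨
    d * ((Q̃′ ⊗ U) ⊗ Z) p₀ zero      ≈⟨ *-congˡ (⊗-assoc Q̃′ U Z p₀ zero) ⟩
    d * (Q̃′ ⊗ (U ⊗ Z)) p₀ zero      ≈⟨ *-congˡ (⊗-congˡ {L = Q̃′} UZ≈V p₀ zero) ⟩
    d * (Q̃′ ⊗ V) p₀ zero            ≈⟨ *-congˡ (cramer {Q = Q̃} {Q̃′} {W} Q̃′Q̃≈d̃ Q̃W≈V p₀ zero) ⟩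
    d * (d̃ * W p₀ zero)             ≈⟨ solve 3 (λ d e w → d :* (e :* w) := w :* (e :* d)) refl _ _ _ ⟩
    W p₀ zero * (d̃ * d)             ∎

-- Finite sets of integers as increasing lists

module IntegerSubsets where
  open ≡ using (refl; sym; trans; cong; cong₂; subst)
  open IncreasingLists {_<_ = ℤ._<_} ℤ.<-trans ℤ.<-irrefl public

  -- Subsets

  ∈-subsets⁺ : ∀ {A : Set} {X Y : List A} → X ⊑ Y → X ∈ subsets (length X) Y
  ∈-subsets⁺ {X = []}            _            = here refl
  ∈-subsets⁺ {X = x ∷ X} {y ∷ Y} (skip _ X⊑Y) =
    ∈.∈-++⁺ʳ (map (y ∷_) (subsets (length X) Y)) (∈-subsets⁺ X⊑Y)
  ∈-subsets⁺                     (refl ∷ X⊑Y) = ∈.∈-++⁺ˡ (∈.∈-map⁺ (_ ∷_) (∈-subsets⁺ X⊑Y))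

  ∈-subsets⁻ : ∀ {A : Set} n {X : List A} {Y} → X ∈ subsets n Y → X ⊑ Y × length X ≡ n
  ∈-subsets⁻ zero    {Y = Y}     (here refl) = minimum Y , refl
  ∈-subsets⁻ (suc n) {Y = y ∷ Y} X∈ with ∈.∈-++⁻ (map (y ∷_) (subsets n Y)) X∈
  ... | inj₂ X∈′ = let (X⊑Y , len) = ∈-subsets⁻ (suc n) X∈′ in skip y X⊑Y , len
  ... | inj₁ X∈′ with ∈.∈-map⁻ (y ∷_) X∈′
  ...   | _ , X′∈ , refl = let (X⊑Y , len) = ∈-subsets⁻ n X′∈ in refl ∷ X⊑Y , cong suc len

  subsets-unique : ∀ {A : Set} n {X : List A} → Unique X → Unique (subsets n X)
  subsets-unique zero    _  = [] ∷ []
  subsets-unique (suc n) [] = []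
  subsets-unique (suc n) {x ∷ X} (x∉X ∷ uniq) = Unique.++⁺
    (Unique.map⁺ List.∷-injectiveʳ (subsets-unique n uniq)) (subsets-unique (suc n) uniq) disjoint
    where
    disjoint : ∀ {Y} → Y ∈ map (x ∷_) (subsets n X) × Y ∈ subsets (suc n) X → _
    disjoint (Y∈ , Y∈′) with ∈.∈-map⁻ (x ∷_) Y∈
    ... | _ , _ , refl = All.lookup x∉X (⊑⇒⊆ (proj₁ (∈-subsets⁻ (suc n) Y∈′)) (here refl)) refl

  length-subsets : ∀ {A : Set} n (X : List A) → length (subsets n X) ≡ length X C n
  length-subsets zero    X       = refl
  length-subsets (suc n) []      = refl
  length-subsets (suc n) (x ∷ X) = trans (List.length-++ (map (x ∷_) (subsets n X)))
    (trans (cong₂ ℕ._+_ (trans (List.length-map (x ∷_) (subsets n X)) (length-subsets n X))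
                        (length-subsets (suc n) X))
      (nCk+nC[k+1]≡[n+1]C[k+1] (length X) n))

  unique-lookup : ∀ {A : Set} {xs : List A} → Unique xs → ∀ i j → lookup xs i ≡ lookup xs j → i ≡ j
  unique-lookup (_    ∷ uniq) zero    zero    _  = refl
  unique-lookup (x∉xs ∷ uniq) zero    (suc j) eq = contradiction eq (All.lookup x∉xs (∈.∈-lookup j))
  unique-lookup (x∉xs ∷ uniq) (suc i) zero    eq =
    contradiction (sym eq) (All.lookup x∉xs (∈.∈-lookup i))
  unique-lookup (_    ∷ uniq) (suc i) (suc j) eq = cong suc (unique-lookup uniq i j eq)

  increasing⇒unique : ∀ {X} → Increasing X → Unique X
  increasing⇒unique = AllPairs.map λ x<y x≡y → ℤ.<-irrefl x≡y x<y

  increasing-map-suc : ∀ {X} → Increasing X → Increasing (map ℤ.suc X)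
  increasing-map-suc = AllPairs.map⁺ ∘ AllPairs.map (ℤ.+-monoʳ-< ℤ.1ℤ)

  increasing-map-pred : ∀ {X} → Increasing X → Increasing (map ℤ.pred X)
  increasing-map-pred = AllPairs.map⁺ ∘ AllPairs.map (ℤ.+-monoʳ-< ℤ.-1ℤ)

  increasing-resp-⊑ : ∀ {X Y} → X ⊑ Y → Increasing Y → Increasing X
  increasing-resp-⊑ []          _            = []
  increasing-resp-⊑ (skip _ τ)  (_ ∷ inc)    = increasing-resp-⊑ τ inc
  increasing-resp-⊑ (refl ∷ τ)  (y<Y ∷ inc)  = PropositionalSublist.All-resp-⊆ τ y<Y ∷ increasing-resp-⊑ τ inc

  increasing-remove : ∀ ps {s qs} → Increasing (ps ++ s ∷ qs) → Increasing (ps ++ qs)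
  increasing-remove []       (_ ∷ inc)   = inc
  increasing-remove (p ∷ ps) (p<  ∷ inc) =
    All.++⁺ (All.++⁻ˡ ps p<) (All.tail (All.++⁻ʳ ps p<)) ∷ increasing-remove ps inc

  length-insert : ∀ {A : Set} ps {s : A} {qs} → length (ps ++ s ∷ qs) ≡ suc (length (ps ++ qs))
  length-insert []       = refl
  length-insert (p ∷ ps) = cong suc (length-insert ps)

  ∈-insert : ∀ {A : Set} ps {s : A} {qs x} → x ∈ ps ++ qs → x ∈ ps ++ s ∷ qs
  ∈-insert []       x∈          = there x∈
  ∈-insert (p ∷ ps) (here refl) = here refl
  ∈-insert (p ∷ ps) (there x∈)  = there (∈-insert ps x∈)

  unique-remove : ∀ {A : Set} ps {s : A} {qs} → Unique (ps ++ s ∷ qs) → s ∉ ps ++ qs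
  unique-remove []       (s∉ ∷ _)   s∈          = All.lookup s∉ s∈ refl
  unique-remove (p ∷ ps) (p∉ ∷ _)   (here refl) = All.head (All.++⁻ʳ ps p∉) refl
  unique-remove (p ∷ ps) (_ ∷ uniq) (there s∈)  = unique-remove ps uniq s∈

  -- Removing one element of an increasing list

  removal : ∀ {L K s} → Increasing L → Increasing K → length L ≡ suc (length K) → L ≐ s ∷ K →
            ∃₂ λ ps qs → L ≡ ps ++ s ∷ qs × K ≡ ps ++ qs
  removal {L} {K} {s} incL incK len (L⊆ , ⊆L) with ∈.∈-∃++ (⊆L (here refl))
  ... | ps , qs , refl = ps , qs , refl ,
    sym (⊑⇒≡ (increasing-⊑ (increasing-remove ps incL) incK rest⊆K)
      (ℕ.suc-injective (trans (sym (length-insert ps)) len)))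
    where
    rest⊆K : ∀ {x} → x ∈ ps ++ qs → x ∈ K
    rest⊆K x∈ with L⊆ (∈-insert ps x∈)
    ... | here refl = contradiction x∈ (unique-remove ps (increasing⇒unique incL))
    ... | there x∈K = x∈K

  -- Intervals

  length-consecutive : ∀ m l → length (consecutive m l) ≡ l
  length-consecutive m zero    = refl
  length-consecutive m (suc l) = cong suc (length-consecutive (ℤ.suc m) l)

  map-suc-consecutive : ∀ m l → map ℤ.suc (consecutive m l) ≡ consecutive (ℤ.suc m) l
  map-suc-consecutive m zero    = refl
  map-suc-consecutive m (suc l) = cong (ℤ.suc m ∷_) (map-suc-consecutive (ℤ.suc m) l)

  map-pred-suc : ∀ L → map ℤ.pred (map ℤ.suc L) ≡ L
  map-pred-suc L = trans (sym (List.map-∘ L)) (trans (List.map-cong ℤ.pred-suc L) (List.map-id L))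

  map-suc-pred : ∀ L → map ℤ.suc (map ℤ.pred L) ≡ L
  map-suc-pred L = trans (sym (List.map-∘ L)) (trans (List.map-cong ℤ.suc-pred L) (List.map-id L))

  map-pred-consecutive : ∀ m l → map ℤ.pred (consecutive (ℤ.suc m) l) ≡ consecutive m l
  map-pred-consecutive m l = trans (cong (map ℤ.pred) (sym (map-suc-consecutive m l))) (map-pred-suc _)

  shift-end : ∀ m l → ℤ.suc m ℤ.+ + l ≡ m ℤ.+ + suc l
  shift-end m l = lemma m (+ l)
    where
    lemma : ∀ m l → (ℤ.1ℤ ℤ.+ m) ℤ.+ l ≡ m ℤ.+ (ℤ.1ℤ ℤ.+ l)
    lemma = solve-∀

  consecutive-++ : ∀ m k l → consecutive m (k ℕ.+ l) ≡ consecutive m k ++ consecutive (m ℤ.+ + k) l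
  consecutive-++ m zero    l = cong (λ i → consecutive i l) (sym (ℤ.+-identityʳ m))
  consecutive-++ m (suc k) l = cong (m ∷_) (trans (consecutive-++ (ℤ.suc m) k l)
    (cong (λ i → consecutive (ℤ.suc m) k ++ consecutive i l) (shift-end m k)))

  ∈-consecutive⁻ : ∀ m l {i} → i ∈ consecutive m l → m ℤ.≤ i × i ℤ.< m ℤ.+ + l
  ∈-consecutive⁻ m (suc l) (here refl) = ℤ.≤-refl ,
    subst (ℤ._< m ℤ.+ + suc l) (ℤ.+-identityʳ m) (ℤ.+-monoʳ-< m (ℤ.+<+ (ℕ.s≤s ℕ.z≤n)))
  ∈-consecutive⁻ m (suc l) (there i∈)  = let (m<i , i<) = ∈-consecutive⁻ (ℤ.suc m) l i∈ in
    ℤ.≤-trans (ℤ.i≤suc[i] m) m<i , subst (_ ℤ.<_) (shift-end m l) i<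

  ∈-consecutive⁺ : ∀ m l {i} → m ℤ.≤ i → i ℤ.< m ℤ.+ + l → i ∈ consecutive m l
  ∈-consecutive⁺ m zero    {i} m≤i i<m =
    contradiction (ℤ.≤-<-trans m≤i (subst (i ℤ.<_) (ℤ.+-identityʳ m) i<m)) (ℤ.<-irrefl refl)
  ∈-consecutive⁺ m (suc l) {i} m≤i i<m with i ℤ.≟ m
  ... | yes refl = here refl
  ... | no  i≢m  = there (∈-consecutive⁺ (ℤ.suc m) l (ℤ.i<j⇒suc[i]≤j (ℤ.≤∧≢⇒< m≤i (i≢m ∘ sym)))
    (subst (i ℤ.<_) (sym (shift-end m l)) i<m))

  increasing-consecutive : ∀ m l → Increasing (consecutive m l)
  increasing-consecutive m zero    = []
  increasing-consecutive m (suc l) =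
    All.tabulate (λ i∈ → ℤ.suc[i]≤j⇒i<j (proj₁ (∈-consecutive⁻ (ℤ.suc m) l i∈))) ∷
    increasing-consecutive (ℤ.suc m) l

  tabulate-consecutive : ∀ m l → tabulate {n = l} (λ i → m ℤ.+ + toℕ i) ≡ consecutive m l
  tabulate-consecutive m zero    = refl
  tabulate-consecutive m (suc l) = cong₂ _∷_ (ℤ.+-identityʳ m)
    (trans (List.tabulate-cong λ i → sym (shift-end m (toℕ i))) (tabulate-consecutive (ℤ.suc m) l))

  consecutive-∷ʳ : ∀ m l → consecutive m (suc l) ≡ consecutive m l ∷ʳ (m ℤ.+ + l)
  consecutive-∷ʳ m l = trans (cong (consecutive m) (sym (ℕ.+-comm l 1))) (consecutive-++ m l 1)

  -- Binomial coefficients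

  0<nCk : ∀ {n k} → k ℕ.≤ n → 0 ℕ.< n C k
  0<nCk {n}     {zero}  _         = ℕ.s≤s ℕ.z≤n
  0<nCk {suc n} {suc k} (ℕ.s≤s k≤n) = subst (0 ℕ.<_) (nCk+nC[k+1]≡[n+1]C[k+1] n k)
    (ℕ.≤-trans (0<nCk k≤n) (ℕ.m≤m+n _ _))

  -- Guards the truncated subtractions: this bound makes the degree of Ñ and the exponent of u
  -- genuine differences. Pascal's rule reduces the claim to the preceding row, where one summand
  -- supplies the bound and the other is positive.
  n<[n+1]C[k+1] : ∀ {n k} → k ℕ.< n → n ℕ.< suc n C suc k
  n<[n+1]C[k+1] {suc n} {k} k<1+n = subst (suc n ℕ.<_) (nCk+nC[k+1]≡[n+1]C[k+1] (suc n) k)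
    (bound (ℕ.m≤n⇒m<n∨m≡n (ℕ.s≤s⁻¹ k<1+n)))
    where
    top-row : ∀ n → n ℕ.< suc n C n
    top-row zero    = ℕ.s≤s ℕ.z≤n
    top-row (suc n) = n<[n+1]C[k+1] (ℕ.n<1+n n)
    bound : k ℕ.< n ⊎ k ≡ n → suc n ℕ.< (suc n C k) ℕ.+ (suc n C suc k)
    bound (inj₁ k<n)  = ℕ.+-mono-≤-< (0<nCk (ℕ.m≤n⇒m≤1+n (ℕ.<⇒≤ k<n))) (n<[n+1]C[k+1] k<n)
    bound (inj₂ refl) = subst (ℕ._< (suc n C n) ℕ.+ (suc n C suc n)) (ℕ.+-comm n 1)
      (ℕ.+-mono-<-≤ (top-row n) (0<nCk (ℕ.≤-refl {suc n})))

open IntegerSubsets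

-- Contraction of indicator functions of lists

module IndicatorForms (R : CommutativeRing c ℓ) where
  open CommutativeRing R hiding (zero)
  open Determinants R
  open Matrices rawRing using (identity)
  open SemiringExp semiring using (_^_)
  open SemiringSum semiring using (sum)
  open IntegerCoefficientSolver R

  -- A contraction reads its form only at the lists with one letter removed. Two forms may therefore
  -- be exchanged even if they agree only on increasing lists of the right length.
  δ-local : ∀ {X : Set} v {g h : List X → Carrier} xs →
            (∀ ps x qs → xs ≡ ps ++ x ∷ qs → g (ps ++ qs) ≈ h (ps ++ qs)) → δ v g xs ≈ δ v h xs
  δ-local v []       g≈h = refl
  δ-local v (x ∷ xs) g≈h = +-cong (*-congˡ (g≈h [] x xs ≡.refl))
    (-‿cong (δ-local v xs λ ps y qs eq → g≈h (x ∷ ps) y qs (≡.cong (x ∷_) eq)))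

  δ-vanish : ∀ {X : Set} v {g : List X → Carrier} xs →
             (∀ ps x qs → xs ≡ ps ++ x ∷ qs → g (ps ++ qs) ≈ 0#) → δ v g xs ≈ 0#
  δ-vanish v xs g≈0 = trans (δ-local v xs g≈0) (δ-zero v (λ _ → refl) xs)

  -- The hypothesis kills every term in which a letter of `ys` is removed, leaving the removals from
  -- `xs`, whose signs do not see `ys`.
  δ-++ˡ : ∀ {X : Set} v (g : List X → Carrier) xs ys →
          (∀ ps y qs → ys ≡ ps ++ y ∷ qs → g (xs ++ ps ++ qs) ≈ 0#) →
          δ v g (xs ++ ys) ≈ δ v (λ zs → g (zs ++ ys)) xs
  δ-++ˡ v g []       ys g≈0 = δ-vanish v ys g≈0
  δ-++ˡ v g (x ∷ xs) ys g≈0 = +-congˡ (-‿cong (δ-++ˡ v (g ∘ (x ∷_)) xs ys g≈0))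

  -- The companion of `δ-++ˡ` in which the weights of the letters of `ys` vanish instead of the
  -- form.
  δ-++ˡ′ : ∀ {X : Set} v (g : List X → Carrier) xs ys → (∀ {y} → y ∈ ys → v y ≈ 0#) →
           δ v g (xs ++ ys) ≈ δ v (λ zs → g (zs ++ ys)) xs
  δ-++ˡ′ v g []       []       v≈0 = refl
  δ-++ˡ′ v g []       (y ∷ ys) v≈0 = trans
    (+-cong (trans (*-congʳ (v≈0 (here ≡.refl))) (zeroˡ _))
      (-‿cong (δ-++ˡ′ v (g ∘ (y ∷_)) [] ys (v≈0 ∘ there))))
    (solve 0 (:0 :- :0 := :0) refl)
  δ-++ˡ′ v g (x ∷ xs) ys       v≈0 = +-congˡ (-‿cong (δ-++ˡ′ v (g ∘ (x ∷_)) xs ys v≈0))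

  -- Every other removal leaves t at the end of the list, where `g` vanishes.
  δ-last : ∀ {X : Set} v {g : List X → Carrier} xs t → (∀ ys → g (ys ∷ʳ t) ≈ 0#) →
           δ v g (xs ∷ʳ t) ≈ (- 1#) ^ length xs * (v t * g xs)
  δ-last v []       t g≈0 = solve 1 (λ x → x :- :0 := :1 :* x) refl _
  δ-last v (x ∷ xs) t g≈0 = trans
    (+-cong (trans (*-congˡ (g≈0 xs)) (zeroʳ _)) (-‿cong (δ-last v xs t (g≈0 ∘ (x ∷_)))))
    (solve 2 (λ s p → :0 :- s :* p := (:- :1 :* s) :* p) refl _ _)

  𝟙 : List ℤ → List ℤ → Carrier
  𝟙 J L with List.≡-dec ℤ._≟_ L J
  ... | yes _ = 1#
  ... | no  _ = 0#

  𝟙-≡ : ∀ J → 𝟙 J J ≈ 1#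
  𝟙-≡ J with List.≡-dec ℤ._≟_ J J
  ... | yes _ = refl
  ... | no J≢J = contradiction ≡.refl J≢J

  𝟙-≢ : ∀ {J L} → L ≢ J → 𝟙 J L ≈ 0#
  𝟙-≢ {J} {L} L≢J with List.≡-dec ℤ._≟_ L J
  ... | yes L≡J = contradiction L≡J L≢J
  ... | no  _   = refl

  𝟙-injective : ∀ {f : List ℤ → List ℤ} → (∀ {L J} → f L ≡ f J → L ≡ J) →
                ∀ J L → 𝟙 (f J) (f L) ≈ 𝟙 J L
  𝟙-injective {f} inj J L with List.≡-dec ℤ._≟_ L J
  ... | yes ≡.refl = 𝟙-≡ (f J)
  ... | no  L≢J    = 𝟙-≢ {f J} {f L} (L≢J ∘ inj)

  𝟙-map-pred : ∀ J L → 𝟙 J (map ℤ.pred L) ≈ 𝟙 (map ℤ.suc J) L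
  𝟙-map-pred J L = trans
    (reflexive (≡.cong (λ J → 𝟙 J (map ℤ.pred L)) (≡.sym (map-pred-suc J))))
    (𝟙-injective {map ℤ.pred} inj (map ℤ.suc J) L)
    where
    inj : ∀ {L J} → map ℤ.pred L ≡ map ℤ.pred J → L ≡ J
    inj eq = ≡.trans (≡.sym (map-suc-pred _)) (≡.trans (≡.cong (map ℤ.suc) eq) (map-suc-pred _))

  -- The letters of an increasing list are distinct, so removing any letter but s gives a different
  -- list. A single term survives, with the sign of the position of s.
  δ-𝟙-removal : ∀ v ps s qs → Increasing (ps ++ s ∷ qs) →
    δ v (𝟙 (ps ++ qs)) (ps ++ s ∷ qs) ≈ (- 1#) ^ length ps * v s
  δ-𝟙-removal v [] s qs (s<qs ∷ _) = trans
    (+-cong (*-congˡ (𝟙-≡ qs)) (-‿cong (δ-zero v {𝟙 qs ∘ (s ∷_)} (λ ys → 𝟙-≢ (s∷ys≢qs ys)) qs)))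
    (solve 1 (λ x → x :* :1 :- :0 := :1 :* x) refl _)
    where
    s∷ys≢qs : ∀ ys → s ∷ ys ≢ qs
    s∷ys≢qs ys ≡.refl = ℤ.<-irrefl ≡.refl (All.head s<qs)
  δ-𝟙-removal v (p ∷ ps) s qs (p< ∷ inc) = trans
    (+-cong (trans (*-congˡ (𝟙-≢ rest≢)) (zeroʳ _))
      (-‿cong (trans (δ-congʳ (𝟙-injective {p ∷_} List.∷-injectiveʳ (ps ++ qs)) (ps ++ s ∷ qs))
        (δ-𝟙-removal v ps s qs inc))))
    (solve 2 (λ s p → :0 :- s :* p := (:- :1 :* s) :* p) refl _ _)
    where
    rest≢ : ps ++ s ∷ qs ≢ p ∷ ps ++ qs
    rest≢ eq = ℤ.<-irrefl ≡.refl
      (All.lookup p< (≡.subst (p ∈_) (≡.sym eq) (here ≡.refl)))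

  module _ {xs : List (List ℤ)} (uniq : Unique xs) where

    𝟙-lookup : ∀ i j → 𝟙 (lookup xs j) (lookup xs i) ≈ identity i j
    𝟙-lookup i j with i Fin.≟ j
    ... | yes ≡.refl = 𝟙-≡ (lookup xs i)
    ... | no  i≢j    = 𝟙-≢ (i≢j ∘ unique-lookup uniq i j)

    𝟙-expand : ∀ φ i → sum (λ j → φ (lookup xs j) * 𝟙 (lookup xs j) (lookup xs i)) ≈ φ (lookup xs i)
    𝟙-expand φ i = trans
      (sum-cong (λ j → φ (lookup xs j) * 𝟙 (lookup xs j) (lookup xs i))
                (λ j → identity i j * φ (lookup xs j))
        λ j → trans (*-comm _ _) (*-congʳ (𝟙-lookup i j)))
      (sum-identityˡ i (φ ∘ lookup xs))

    𝟙-expand-∈ : ∀ φ {L} → L ∈ xs → sum (λ j → φ (lookup xs j) * 𝟙 (lookup xs j) L) ≈ φ L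
    𝟙-expand-∈ φ {L} L∈ = ≡.subst
      (λ L → sum (λ j → φ (lookup xs j) * 𝟙 (lookup xs j) L) ≈ φ L)
      (≡.sym (lookup-index L∈)) (𝟙-expand φ (index L∈))

    𝟙-expand-∉ : ∀ (φ : List ℤ → Carrier) {L} → L ∉ xs → sum (λ j → φ (lookup xs j) * 𝟙 (lookup xs j) L) ≈ 0#
    𝟙-expand-∉ φ {L} L∉ = sum-zero {f = λ j → φ (lookup xs j) * 𝟙 (lookup xs j) L} λ j → trans
      (*-congˡ (𝟙-≢ {lookup xs j} {L} λ L≡ → L∉ (≡.subst (_∈ xs) (≡.sym L≡) (∈.∈-lookup j)))) (zeroʳ _)

-- The transfer matrix on the subsets of an interval, and its inverse

module Transfer (K : HeytingField c ℓ₁ ℓ₂) (S : List ℤ) (weight : ℤ → HeytingField.Carrier K) (a b : ℕ) where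
  KR : CommutativeRing _ _
  KR = HeytingCommutativeRing.commutativeRing (HeytingField.heytingCommutativeRing K)

  open CommutativeRing KR hiding (zero)
  open Setup K S weight a b using (transferEntry; unionEntry; ε)
  open Determinants KR
  open IndicatorForms KR
  open Matrices rawRing using (Matrix; identity; _⊗_)
  open SemiringExp semiring using (_^_)
  open SemiringSum semiring using (sum; sum-cong-≋)
  open IntegerCoefficientSolver KR

  -- In the increasing list of I with t appended, the letters below s are those in front of it, and
  -- t is never one of them because s ≤ t. Counting over I alone thus gives the position of s.
  ε-split : ∀ {I t ps s qs} → Increasing (ps ++ s ∷ qs) → I ∷ʳ t ≡ ps ++ s ∷ qs → s ℤ.≤ t →
            ε s I ≈ (- 1#) ^ length ps
  ε-split {I} {t} {ps} {s} {qs} inc eq s≤t = reflexive (≡.cong (λ L → (- 1#) ^ length L)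
    (≡.trans (≡.sym (List.++-identityʳ _)) (≡.trans (≡.cong (filter (ℤ._<? s) I ++_) (≡.sym t-rejected))
      (≡.trans (≡.sym (List.filter-++ (ℤ._<? s) I (t ∷ []))) (≡.trans (≡.cong (filter (ℤ._<? s)) eq)
        (≡.trans (List.filter-++ (ℤ._<? s) ps (s ∷ qs))
          (≡.trans (≡.cong₂ _++_ (List.filter-all (ℤ._<? s) (below ps inc))
                             (List.filter-none (ℤ._<? s) (above ps inc)))
            (List.++-identityʳ ps))))))))
    where
    t-rejected : filter (ℤ._<? s) (t ∷ []) ≡ []
    t-rejected = List.filter-none (ℤ._<? s) ((λ t<s → ℤ.<-irrefl ≡.refl (ℤ.<-≤-trans t<s s≤t)) ∷ [])
    below : ∀ ps → Increasing (ps ++ s ∷ qs) → All (ℤ._< s) ps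
    below []       _          = []
    below (p ∷ ps) (p< ∷ inc) = All.head (All.++⁻ʳ ps p<) ∷ below ps inc
    above : ∀ ps → Increasing (ps ++ s ∷ qs) → All (λ q → ¬ q ℤ.< s) (s ∷ qs)
    above []       (s<qs ∷ _) = ℤ.<-irrefl ≡.refl ∷ All.map (λ s<q q<s → ℤ.<-asym s<q q<s) s<qs
    above (p ∷ ps) (_ ∷ inc)  = above ps inc

  -- An s with I ∪ {t} = (J + 1) ∪ {s} is a letter whose removal from the sorted list leaves J + 1.
  -- The sign of its position is `ε`, so the searched entry is one contraction of an indicator.
  transferEntry-δ : ∀ t γ I J → Increasing (I ∷ʳ t) → Increasing J → length I ≡ length J →
    (∀ {i} → i ∈ I ∷ʳ t → i ℤ.≤ t) → transferEntry t γ I J ≈ δ γ (𝟙 J ∘ map ℤ.pred) (I ∷ʳ t)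
  transferEntry-δ t γ I J incI incJ len ≤t = trans entry (sym (δ-congʳ (𝟙-map-pred J) (I ∷ʳ t)))
    where
    K′ = map ℤ.suc J
    rotate⁺ : ∀ {M} → t ∷ I ≐ M → I ∷ʳ t ≐ M
    rotate⁺ (⊆M , M⊆) = ⊆M ∘ ∈-resp-↭ (↭-sym (∷↭∷ʳ t I)) , ∈-resp-↭ (∷↭∷ʳ t I) ∘ M⊆
    removed : ∀ ps s qs → I ∷ʳ t ≡ ps ++ s ∷ qs → t ∷ I ≐ s ∷ ps ++ qs
    removed ps s qs eq = ∈-resp-↭ ↭ , ∈-resp-↭ (↭-sym ↭)
      where
      ↭ : t ∷ I ↭ s ∷ ps ++ qs
      ↭ = ↭-trans (∷↭∷ʳ t I) (≡.subst (_↭ s ∷ ps ++ qs) (≡.sym eq) (shift s ps qs))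
    incK : Increasing K′
    incK = increasing-map-suc incJ
    entry : transferEntry t γ I J ≈ δ γ (𝟙 K′) (I ∷ʳ t)
    entry with shift? t I J
    ... | no none = sym (δ-vanish γ (I ∷ʳ t) λ ps s qs eq → 𝟙-≢ λ { eq′ →
      none (s , ≡.subst (λ L → t ∷ I ≐ s ∷ L) eq′ (removed ps s qs eq)) })
    ... | yes (s , ≐) with removal incI incK
          (≡.trans (List.length-++ I) (≡.trans (ℕ.+-comm (length I) 1)
            (≡.cong suc (≡.trans len (≡.sym (List.length-map ℤ.suc J)))))) (rotate⁺ ≐)
    ...   | ps , qs , eq , K≡ = sym (trans
      (reflexive (≡.cong₂ (λ K L → δ γ (𝟙 K) L) K≡ eq))
      (trans (δ-𝟙-removal γ ps s qs inc) (*-congʳ (sym (ε-split inc eq s≤t)))))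
      where
      inc = ≡.subst Increasing eq incI
      s≤t = ≤t (≡.subst (s ∈_) (≡.sym eq) (∈.∈-++⁺ʳ ps (here ≡.refl)))

  unionEntry-≢ : ∀ r {I J x} → x ∈ I → x ∉ J → unionEntry r I J ≈ 0#
  unionEntry-≢ r {I} {J} x∈I x∉J with r ∷ I ≐? J
  ... | yes (⊆J , _) = contradiction (⊆J (there x∈I)) x∉J
  ... | no _         = refl

  -- The n-subsets of an interval [lo, t).
  module Window (lo t : ℤ) (n : ℕ) {X : List ℤ} (X-increasing : Increasing X)
    (X⁻ : ∀ {i} → i ∈ X → lo ℤ.≤ i × i ℤ.< t) (X⁺ : ∀ {i} → lo ℤ.≤ i → i ℤ.< t → i ∈ X) where

    idx : List (List ℤ)
    idx = subsets n X

    w : Fin (length idx) → List ℤ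
    w = lookup idx

    idx-unique : Unique idx
    idx-unique = subsets-unique n (increasing⇒unique X-increasing)

    w-increasing : ∀ i → Increasing (w i)
    w-increasing i = increasing-resp-⊑ (proj₁ (∈-subsets⁻ n (∈.∈-lookup i))) X-increasing

    w-length : ∀ i → length (w i) ≡ n
    w-length i = proj₂ (∈-subsets⁻ n (∈.∈-lookup {xs = idx} i))

    w⁻ : ∀ i {x} → x ∈ w i → lo ℤ.≤ x × x ℤ.< t
    w⁻ i x∈ = X⁻ (⊑⇒⊆ (proj₁ (∈-subsets⁻ n (∈.∈-lookup i))) x∈)

    idx⁺ : ∀ {L} → Increasing L → length L ≡ n → (∀ {x} → x ∈ L → lo ℤ.≤ x × x ℤ.< t) → L ∈ idx
    idx⁺ {L} inc ≡.refl L⁻ = ∈-subsets⁺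
      (increasing-⊑ inc X-increasing λ x∈ → X⁺ (proj₁ (L⁻ x∈)) (proj₂ (L⁻ x∈)))

    -- Removal followed by `pred` may move the head below `lo`, and the matrix has no index for such
    -- a list. A supported function gives it the value zero as well.
    Supported : (List ℤ → Carrier) → Set _
    Supported φ = ∀ x L → x ℤ.< lo → φ (x ∷ L) ≈ 0#

    -- An increasing list below t fails to be an index only if its head is below `lo`. Then the sum
    -- is zero because no index matches, and φ is zero because it is supported.
    expand : ∀ {φ} → Supported φ → ∀ L → Increasing L → length L ≡ n → (∀ {x} → x ∈ L → x ℤ.< t) →
             sum (λ j → φ (w j) * 𝟙 (w j) L) ≈ φ L
    expand {φ} supp []      inc len <t = 𝟙-expand-∈ idx-unique φ (idx⁺ inc len λ ())
    expand {φ} supp (x ∷ L) inc@(x<L ∷ _) len <t with x ℤ.<? lo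
    ... | yes x<lo = trans (𝟙-expand-∉ idx-unique φ x∷L∉) (sym (supp x L x<lo))
      where
      x∷L∉ : x ∷ L ∉ idx
      x∷L∉ x∷L∈ = ℤ.<-irrefl ≡.refl (ℤ.<-≤-trans x<lo
        (proj₁ (X⁻ (⊑⇒⊆ (proj₁ (∈-subsets⁻ n x∷L∈)) (here ≡.refl)))))
    ... | no  x≮lo = 𝟙-expand-∈ idx-unique φ (idx⁺ inc len λ y∈ → ≥lo y∈ , <t y∈)
      where
      ≥lo : ∀ {y} → y ∈ x ∷ L → lo ℤ.≤ y
      ≥lo (here ≡.refl) = ℤ.≮⇒≥ x≮lo
      ≥lo (there y∈)    = ℤ.≤-trans (ℤ.≮⇒≥ x≮lo) (ℤ.<⇒≤ (All.lookup x<L y∈))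

    w∷ʳt-increasing : ∀ i → Increasing (w i ∷ʳ t)
    w∷ʳt-increasing i = AllPairs.++⁺ (w-increasing i) ([] ∷ [])
      (All.tabulate λ x∈ → proj₂ (w⁻ i x∈) ∷ [])

    w∷ʳt-≤ : ∀ i {x} → x ∈ w i ∷ʳ t → x ℤ.≤ t
    w∷ʳt-≤ i x∈ with ∈.∈-++⁻ (w i) x∈
    ... | inj₁ x∈w         = ℤ.<⇒≤ (proj₂ (w⁻ i x∈w))
    ... | inj₂ (here ≡.refl) = ℤ.≤-refl

    𝟙-w-low : ∀ j {x} L → x ℤ.< lo → 𝟙 (w j) (x ∷ L) ≈ 0#
    𝟙-w-low j L x<lo = 𝟙-≢ λ eq → ℤ.<-irrefl ≡.refl
      (ℤ.<-≤-trans x<lo (proj₁ (w⁻ j (≡.subst (_ ∈_) eq (here ≡.refl)))))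

    𝟙-supported : ∀ {x L} → lo ℤ.≤ x → Supported (𝟙 (x ∷ L))
    𝟙-supported {x} {L} lo≤x y M y<lo = 𝟙-≢ {x ∷ L} {y ∷ M}
      λ { ≡.refl → ℤ.<-irrefl ≡.refl (ℤ.<-≤-trans y<lo lo≤x) }

    -- As r exceeds every letter of I, the union is the list with r appended, so the row of the
    -- union matrix is the indicator of that list.
    union-apply : ∀ {φ} → Supported φ → ∀ {r I} → r ℤ.< t → Increasing (I ∷ʳ r) → suc (length I) ≡ n →
                  sum (λ j → unionEntry r I (w j) * φ (w j)) ≈ φ (I ∷ʳ r)
    union-apply {φ} supp {r} {I} r<t inc len = trans
      (sum-cong (λ j → unionEntry r I (w j) * φ (w j)) (λ j → φ (w j) * 𝟙 (w j) (I ∷ʳ r))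
        λ j → trans (*-comm _ _) (*-congˡ (unionEntry-𝟙 j)))
      (expand {φ} supp (I ∷ʳ r) inc length≡n λ x∈ → ℤ.≤-<-trans (≤r I inc x∈) r<t)
      where
      length≡n : length (I ∷ʳ r) ≡ n
      length≡n = ≡.trans (List.length-++ I) (≡.trans (ℕ.+-comm (length I) 1) len)
      ≤r : ∀ I → Increasing (I ∷ʳ r) → ∀ {x} → x ∈ I ∷ʳ r → x ℤ.≤ r
      ≤r []      _          (here ≡.refl) = ℤ.≤-refl
      ≤r (y ∷ I) (y< ∷ inc) (here ≡.refl) = ℤ.<⇒≤ (All.lookup y< (∈.∈-++⁺ʳ I (here ≡.refl)))
      ≤r (y ∷ I) (_  ∷ inc) (there x∈)    = ≤r I inc x∈
      unionEntry-𝟙 : ∀ j → unionEntry r I (w j) ≈ 𝟙 (w j) (I ∷ʳ r)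
      unionEntry-𝟙 j with r ∷ I ≐? w j
      ... | no  ¬≐ = sym (𝟙-≢ λ eq → ¬≐ (≡.subst (r ∷ I ≐_) eq
        (∈-resp-↭ (∷↭∷ʳ r I) , ∈-resp-↭ (↭-sym (∷↭∷ʳ r I)))))
      ... | yes (⊆w , _) = sym (trans
        (reflexive (≡.cong (λ L → 𝟙 (w j) L) (⊑⇒≡
          (increasing-⊑ inc (w-increasing j) (⊆w ∘ ∈-resp-↭ (↭-sym (∷↭∷ʳ r I))))
          (≡.trans length≡n (≡.sym (w-length j))))))
        (𝟙-≡ (w j)))

    module Operator (γ : ℤ → Carrier) where

      T : Matrix (length idx) (length idx)
      T i j = transferEntry t γ (w i) (w j)

      T-δ : ∀ i j → T i j ≈ δ γ (𝟙 (w j) ∘ map ℤ.pred) (w i ∷ʳ t)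
      T-δ i j = transferEntry-δ t γ (w i) (w j) (w∷ʳt-increasing i) (w-increasing j)
        (≡.trans (w-length i) (≡.sym (w-length j))) (w∷ʳt-≤ i)

      removed⁻ : ∀ i ps s qs → w i ∷ʳ t ≡ ps ++ s ∷ qs → let L = map ℤ.pred (ps ++ qs) in
        Increasing L × length L ≡ n × (∀ {x} → x ∈ L → x ℤ.< t)
      removed⁻ i ps s qs eq =
        increasing-map-pred (increasing-remove ps (≡.subst Increasing eq (w∷ʳt-increasing i))) ,
        ℕ.suc-injective (≡.trans (≡.cong suc (List.length-map ℤ.pred (ps ++ qs)))
          (≡.trans (≡.sym (length-insert ps)) (≡.trans (≡.cong length (≡.sym eq))
            (≡.trans (List.length-++ (w i)) (≡.trans (ℕ.+-comm (length (w i)) 1)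
              (≡.cong suc (w-length i))))))) ,
        below
        where
        below : ∀ {x} → x ∈ map ℤ.pred (ps ++ qs) → x ℤ.< t
        below x∈ with ∈.∈-map⁻ ℤ.pred x∈
        ... | y , y∈ , ≡.refl = ℤ.<-≤-trans (ℤ.i≤pred[j]⇒i<j ℤ.≤-refl)
          (w∷ʳt-≤ i (≡.subst (y ∈_) (≡.sym eq) (∈-insert ps y∈)))

      T-apply : ∀ {φ} → Supported φ → ∀ i →
                sum (λ j → T i j * φ (w j)) ≈ δ γ (φ ∘ map ℤ.pred) (w i ∷ʳ t)
      T-apply {φ} supp i = begin
        sum (λ j → T i j * φ (w j))
          ≈⟨ sum-cong-≋ (λ j → trans (*-comm (T i j) (φ (w j))) (*-congˡ {φ (w j)} (T-δ i j))) ⟩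
        sum (λ j → φ (w j) * δ γ (𝟙 (w j) ∘ map ℤ.pred) (w i ∷ʳ t))
          ≈⟨ δ-sum γ (φ ∘ w) (λ j → 𝟙 (w j) ∘ map ℤ.pred) (w i ∷ʳ t) ⟨
        δ γ (λ L → sum λ j → φ (w j) * 𝟙 (w j) (map ℤ.pred L)) (w i ∷ʳ t)
          ≈⟨ δ-local γ (w i ∷ʳ t) (λ ps s qs eq →
               let (inc , len , <t) = removed⁻ i ps s qs eq in
               expand {φ} supp (map ℤ.pred (ps ++ qs)) inc len <t) ⟩
        δ γ (φ ∘ map ℤ.pred) (w i ∷ʳ t) ∎
        where open SetoidReasoning setoid

      -- If `lo` survives the removal, the shift moves it below the window. Hence `lo` is the letter
      -- removed, and the row has at most one nonzero entry.
      T-row : ∀ i {I′} → w i ≡ lo ∷ I′ → ∀ j → T i j ≈ γ lo * 𝟙 (w j) (map ℤ.pred (I′ ∷ʳ t))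
      T-row i {I′} eq j = trans (T-δ i j) (trans
        (reflexive (≡.cong (λ I → δ γ (𝟙 (w j) ∘ map ℤ.pred) (I ∷ʳ t)) eq))
        (trans (+-congˡ (-‿cong (δ-zero γ
          (λ L → 𝟙-w-low j (map ℤ.pred L) (ℤ.i≤pred[j]⇒i<j ℤ.≤-refl)) (I′ ∷ʳ t))))
          (solve 1 (λ x → x :- :0 := x) refl _)))

      -- The target shifted up by one still lies below t, so the appended t cannot survive and the
      -- removal is forced to take it.
      T-column : ∀ {x L} → lo ℤ.≤ x → (∀ {y} → y ∈ x ∷ L → ℤ.suc y ℤ.< t) → ∀ i →
        sum (λ j → T i j * 𝟙 (x ∷ L) (w j)) ≈ ((- 1#) ^ n * γ t) * 𝟙 (map ℤ.suc (x ∷ L)) (w i)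
      T-column {x} {L} lo≤x <t i = trans (T-apply {𝟙 (x ∷ L)} (𝟙-supported lo≤x) i)
        (trans (δ-congʳ (𝟙-map-pred (x ∷ L)) (w i ∷ʳ t))
          (trans (δ-last γ {𝟙 (map ℤ.suc (x ∷ L))} (w i) t λ ys → 𝟙-≢ (t∉ ys))
            (trans (reflexive (≡.cong (λ n → (- 1#) ^ n * (γ t * 𝟙 (map ℤ.suc (x ∷ L)) (w i))) (w-length i)))
              (sym (*-assoc _ _ _)))))
        where
        t∉ : ∀ ys → ys ∷ʳ t ≢ map ℤ.suc (x ∷ L)
        t∉ ys eq with ∈.∈-map⁻ ℤ.suc (≡.subst (t ∈_) eq (∈.∈-++⁺ʳ ys (here ≡.refl)))
        ... | y , y∈ , ≡.refl = ℤ.<-irrefl ≡.refl (<t y∈)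

      step : (List ℤ → Carrier) → List ℤ → Carrier
      step W = δ γ (W ∘ map ℤ.pred)

      -- A head below `lo` has weight zero if it is removed, and moves further down if it is kept.
      step-supported : (∀ {x} → x ℤ.< lo → γ x ≈ 0#) → ∀ {W} → Supported W → Supported (step W)
      step-supported γ-low {W} supp x L x<lo = trans
        (+-cong (trans (*-congʳ (γ-low x<lo)) (zeroˡ _))
          (-‿cong (δ-zero γ (λ ys → supp (ℤ.pred x) (map ℤ.pred ys)
            (ℤ.<-trans (ℤ.i≤pred[j]⇒i<j ℤ.≤-refl) x<lo)) L)))
        (solve 0 (:0 :- :0 := :0) refl)

      -- The letters t, t+1, ... are supplied in advance. Each step shifts the tail down by one, so
      -- the next letter arrives at t just when T would append it; until then it has weight zero and
      -- cannot be removed. Powers of T thus become iterated contractions of one list.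
      T-step : (∀ {x} → t ℤ.< x → γ x ≈ 0#) → ∀ {W} → Supported W → ∀ m i →
               sum (λ j → T i j * W (w j ++ consecutive t m)) ≈ step W (w i ++ consecutive t (suc m))
      T-step γ-high {W} supp m i = begin
        sum (λ j → T i j * W (w j ++ consecutive t m))
          ≈⟨ T-apply {λ L → W (L ++ consecutive t m)} (λ x L → supp x (L ++ consecutive t m)) i ⟩
        δ γ (λ L → W (map ℤ.pred L ++ consecutive t m)) (w i ∷ʳ t)
          ≈⟨ δ-congʳ (λ L → reflexive (≡.cong W (≡.sym (≡.trans
               (List.map-++ ℤ.pred L (consecutive (ℤ.suc t) m))
               (≡.cong (map ℤ.pred L ++_) (map-pred-consecutive t m)))))) (w i ∷ʳ t) ⟩
        δ γ (λ L → W (map ℤ.pred (L ++ consecutive (ℤ.suc t) m))) (w i ∷ʳ t)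
          ≈⟨ δ-++ˡ′ γ (W ∘ map ℤ.pred) (w i ∷ʳ t) (consecutive (ℤ.suc t) m)
               (λ y∈ → γ-high (ℤ.suc[i]≤j⇒i<j (proj₁ (∈-consecutive⁻ (ℤ.suc t) m y∈)))) ⟨
        step W ((w i ∷ʳ t) ++ consecutive (ℤ.suc t) m)
          ≡⟨ ≡.cong (step W) (List.++-assoc (w i) (t ∷ []) (consecutive (ℤ.suc t) m)) ⟩
        step W (w i ++ consecutive t (suc m)) ∎
        where open SetoidReasoning setoid

      module Inverse (κ : Carrier) (κ-inverse : κ * (γ lo * ((- 1#) ^ n * γ t)) ≈ 1#)
                     (γ-low : ∀ {x} → x ℤ.< lo → γ x ≈ 0#) where

        -- The transfer in the opposite direction: insert lo, remove one element.
        inverseForm : Fin (length idx) → List ℤ → Carrier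
        inverseForm k J = κ * δ γ (𝟙 (w k)) (lo ∷ map ℤ.suc J)

        T⁻¹ : Matrix (length idx) (length idx)
        T⁻¹ i j = inverseForm j (w i)

        private
          repeat : ∀ k {x} L → ¬ lo ℤ.< x → 𝟙 (w k) (lo ∷ x ∷ L) ≈ 0#
          repeat k L lo≮x = 𝟙-≢ λ eq →
            lo≮x (All.head (AllPairs.head (≡.subst Increasing (≡.sym eq) (w-increasing k))))

        -- After the shift, x+1 ≤ lo stands behind the inserted `lo`, and one of the two must go
        -- since the target is increasing. If x+1 = lo, the two removals give the same list with
        -- opposite signs; if x+1 < lo, removing `lo` leaves a head outside the window and removing
        -- x+1 has weight zero.
        T⁻¹-supported : ∀ k → Supported (inverseForm k)
        T⁻¹-supported k x L x<lo = trans (*-congˡ (trans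
            (+-congˡ (-‿cong (+-congˡ (-‿cong
              (δ-zero γ {λ ys → 𝟙 (w k) (lo ∷ ℤ.suc x ∷ ys)} (λ ys → repeat k ys lo≮suc) (map ℤ.suc L))))))
            (cancel (ℤ.suc x ℤ.≟ lo))))
          (zeroʳ κ)
          where
          lo≮suc : ¬ lo ℤ.< ℤ.suc x
          lo≮suc lo<suc = ℤ.<-irrefl ≡.refl (ℤ.<-≤-trans lo<suc (ℤ.i<j⇒suc[i]≤j x<lo))
          M = map ℤ.suc L
          cancel : Dec (ℤ.suc x ≡ lo) →
            γ lo * 𝟙 (w k) (ℤ.suc x ∷ M) - (γ (ℤ.suc x) * 𝟙 (w k) (lo ∷ M) - 0#) ≈ 0#
          cancel (yes ≡.refl) = solve 1 (λ p → p :- (p :- :0) := :0) refl _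
          cancel (no  x+1≢lo) = trans
            (+-cong (trans (*-congˡ (𝟙-w-low k M x+1<lo)) (zeroʳ _))
              (-‿cong (+-congʳ (trans (*-congʳ (γ-low x+1<lo)) (zeroˡ _)))))
            (solve 0 (:0 :- (:0 :- :0) := :0) refl)
            where
            x+1<lo = ℤ.≤∧≢⇒< (ℤ.i<j⇒suc[i]≤j x<lo) x+1≢lo

        -- The shifts of the two transfers cancel. Contracting across the inserted `lo` gives γ(lo)
        -- times the identity minus a contraction; the second contraction squares the latter away,
        -- and in what remains t must be removed because `w k` does not contain it.
        T-T⁻¹ : ∀ i k → (T ⊗ T⁻¹) i k ≈ identity i k
        T-T⁻¹ i k = begin
          sum (λ j → T i j * inverseForm k (w j))                    ≈⟨ T-apply {inverseForm k} (T⁻¹-supported k) i ⟩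
          δ γ (inverseForm k ∘ map ℤ.pred) (w i ∷ʳ t)                ≈⟨ δ-scale γ κ (δγ𝟙 ∘ map ℤ.pred) (w i ∷ʳ t) ⟩
          κ * δ γ (δγ𝟙 ∘ map ℤ.pred) (w i ∷ʳ t)
            ≈⟨ *-congˡ (δ-congʳ (λ L → reflexive
                 (≡.cong (λ M → δ γ (𝟙 (w k)) (lo ∷ M)) (map-suc-pred L))) (w i ∷ʳ t)) ⟩
          κ * δ γ (λ L → γ lo * 𝟙 (w k) L - δ γ (𝟙 (w k) ∘ (lo ∷_)) L) (w i ∷ʳ t)
            ≈⟨ *-congˡ (trans (δ-+ γ (λ L → γ lo * 𝟙 (w k) L) (λ L → - δ γ (𝟙 (w k) ∘ (lo ∷_)) L) (w i ∷ʳ t)) (+-cong (δ-scale γ (γ lo) (𝟙 (w k)) (w i ∷ʳ t))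
                 (trans (δ-neg γ (δ γ (𝟙 (w k) ∘ (lo ∷_))) (w i ∷ʳ t))
                   (-‿cong (δ-square γ (𝟙 (w k) ∘ (lo ∷_)) (w i ∷ʳ t)))))) ⟩
          κ * (γ lo * δ γ (𝟙 (w k)) (w i ∷ʳ t) - 0#)
            ≈⟨ *-congˡ (+-congʳ (*-congˡ (δ-last γ {𝟙 (w k)} (w i) t λ ys → 𝟙-≢ (t∉ ys)))) ⟩
          κ * (γ lo * ((- 1#) ^ length (w i) * (γ t * 𝟙 (w k) (w i))) - 0#)
            ≈⟨ solve 5 (λ κ l s t e → κ :* (l :* (s :* (t :* e)) :- :0) := (κ :* (l :* (s :* t))) :* e)
                 refl κ _ _ _ _ ⟩
          (κ * (γ lo * ((- 1#) ^ length (w i) * γ t))) * 𝟙 (w k) (w i)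
            ≡⟨ ≡.cong (λ n → (κ * (γ lo * ((- 1#) ^ n * γ t))) * 𝟙 (w k) (w i)) (w-length i) ⟩
          (κ * (γ lo * ((- 1#) ^ n * γ t))) * 𝟙 (w k) (w i)
            ≈⟨ *-cong κ-inverse (𝟙-lookup idx-unique i k) ⟩
          1# * identity i k                                ≈⟨ *-identityˡ _ ⟩
          identity i k                                     ∎
          where
          open SetoidReasoning setoid
          δγ𝟙 : List ℤ → Carrier
          δγ𝟙 J = δ γ (𝟙 (w k)) (lo ∷ map ℤ.suc J)
          t∉ : ∀ ys → ys ∷ʳ t ≢ w k
          t∉ ys eq = ℤ.<-irrefl ≡.refl
            (proj₂ (w⁻ k (≡.subst (t ∈_) eq (∈.∈-++⁺ʳ ys (here ≡.refl)))))

        T⁻¹-T : ∀ i k → (T⁻¹ ⊗ T) i k ≈ identity i k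
        T⁻¹-T = ⊗-inverse-comm {T = T} {T⁻¹} T-T⁻¹

-- Walks of the transfer matrices as cofactors

module StripForms (R : CommutativeRing c ℓ) where
  open CommutativeRing R hiding (zero)
  open Determinants R
  open IndicatorForms R

  -- No element of N is ever removed, because the forms vanish on lists missing one.
  module _ {N : List ℤ} (N-unique : Unique N) where
    private
      Vanishes : (List ℤ → Carrier) → Set _
      Vanishes g = ∀ {y} → y ∈ N → ∀ L → y ∉ L → g L ≈ 0#

      δ-vanishes : ∀ v {g} → Vanishes g → Vanishes (δ v g)
      δ-vanishes v g≈0 y∈N L y∉L = δ-vanish v L λ { ps x qs ≡.refl →
        g≈0 y∈N (ps ++ qs) (y∉L ∘ ∈-insert ps) }

      Δ-vanishes : ∀ {n} (M : Fin n → ℤ → Carrier) → Vanishes (Δ M (𝟙 N))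
      Δ-vanishes {zero}  M {y} y∈N L y∉L = 𝟙-≢ {N} {L} λ { ≡.refl → y∉L y∈N }
      Δ-vanishes {suc n} M         = δ-vanishes (M zero) (Δ-vanishes (M ∘ suc))

    Δ-strip : ∀ {n} (M : Fin n → ℤ → Carrier) L → (∀ {y} → y ∈ L → y ∉ N) →
              Δ M (𝟙 N) (L ++ N) ≈ Δ M unit L
    Δ-strip {zero}  M []      _ = 𝟙-≡ N
    Δ-strip {zero}  M (x ∷ L) _ = 𝟙-≢ {N} {x ∷ L ++ N} λ eq → ℕ.m≢1+n+m (length N)
      (≡.sym (≡.trans (≡.cong suc (≡.sym (List.length-++ L))) (≡.cong length eq)))
    Δ-strip {suc n} M L L∩N = trans
      (δ-++ˡ (M zero) (Δ (M ∘ suc) (𝟙 N)) L N λ { ps y qs N≡ →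
        Δ-vanishes (M ∘ suc) (≡.subst (y ∈_) (≡.sym N≡) (∈.∈-++⁺ʳ ps (here ≡.refl))) (L ++ ps ++ qs)
          λ y∈ → missing ps y qs N≡ (∈.∈-++⁻ L y∈) })
      (δ-local (M zero) L λ { ps x qs ≡.refl → Δ-strip (M ∘ suc) (ps ++ qs) (L∩N ∘ ∈-insert ps) })
      where
      missing : ∀ ps y qs → N ≡ ps ++ y ∷ qs → ¬ (y ∈ L ⊎ y ∈ ps ++ qs)
      missing ps y qs ≡.refl (inj₁ y∈L) = L∩N y∈L (∈.∈-++⁺ʳ ps (here ≡.refl))
      missing ps y qs ≡.refl (inj₂ y∈N) = unique-remove ps N-unique y∈N

interval-consecutive : ∀ m n {l} → n ℤ.- m ℤ.+ ℤ.1ℤ ≡ + l → [ m ⋯ n ] ≡ consecutive m l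
interval-consecutive m n eq = ≡.cong (consecutive m ∘ natPart) eq

module Walks (K : HeytingField c ℓ₁ ℓ₂) (S : List ℤ) (weight : ℤ → HeytingField.Carrier K) (a′ b : ℕ)
  (max : (+ suc a′) IsMaximumOf S) (min : (ℤ.- (+ b)) IsMinimumOf S) where

  a = suc a′

  open Transfer K S weight a b public
  open Setup K S weight a b
  open CommutativeRing KR hiding (zero)
  open Determinants KR
  open IndicatorForms KR
  open StripForms KR
  open Matrices rawRing using (identity; det; minor)
  open SemiringExp semiring using (_^_)
  open SemiringSum semiring using (sum; sum-cong-≋)
  open IntegerCoefficientSolver KR
  open RingProperties ring using (-0#≈0#)

  lo t lõ t̃ : ℤ
  lo = ℤ.- (+ b)
  t  = + a
  lõ = ℤ.- (+ b) ℤ.- + 1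
  t̃  = + a ℤ.- + 1

  private
    module IntervalWindow (m n r : ℤ) (l : ℕ) (size : n ℤ.- m ℤ.+ ℤ.1ℤ ≡ + l) (end : m ℤ.+ + l ≡ r) where
      X≡ : [ m ⋯ n ] ≡ consecutive m l
      X≡ = interval-consecutive m n size
      increasing : Increasing [ m ⋯ n ]
      increasing = ≡.subst Increasing (≡.sym X≡) (increasing-consecutive m l)
      member⁻ : ∀ {i} → i ∈ [ m ⋯ n ] → m ℤ.≤ i × i ℤ.< r
      member⁻ {i} i∈ = let (m≤i , i<) = ∈-consecutive⁻ m l (≡.subst (i ∈_) X≡ i∈)
                       in m≤i , ≡.subst (i ℤ.<_) end i<
      member⁺ : ∀ {i} → m ℤ.≤ i → i ℤ.< r → i ∈ [ m ⋯ n ]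
      member⁺ {i} m≤i i<r = ≡.subst (i ∈_) (≡.sym X≡)
        (∈-consecutive⁺ m l m≤i (≡.subst (i ℤ.<_) (≡.sym end) i<r))

    size₁ : ∀ a b → a ℤ.- + 1 ℤ.- (ℤ.- b) ℤ.+ + 1 ≡ a ℤ.+ b
    size₁ = solve-∀
    size₂ : ∀ a b → a ℤ.- + 2 ℤ.- (ℤ.- b ℤ.- + 1) ℤ.+ + 1 ≡ a ℤ.+ b
    size₂ = solve-∀
    end₁ : ∀ a b → ℤ.- b ℤ.+ (a ℤ.+ b) ≡ a
    end₁ = solve-∀
    end₂ : ∀ a b → ℤ.- b ℤ.- + 1 ℤ.+ (a ℤ.+ b) ≡ a ℤ.- + 1
    end₂ = solve-∀
    size₃ : ∀ a → a ℤ.- + 1 ℤ.- + 0 ℤ.+ + 1 ≡ a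
    size₃ = solve-∀
    size₄ : ∀ a → a ℤ.- + 2 ℤ.- + 0 ℤ.+ + 1 ≡ a ℤ.- + 1
    size₄ = solve-∀

    module I₁ = IntervalWindow lo (+ a ℤ.- + 1) t (a ℕ.+ b) (size₁ (+ a) (+ b)) (end₁ (+ a) (+ b))
    module I₂ = IntervalWindow lõ (+ a ℤ.- + 2) t̃ (a ℕ.+ b) (size₂ (+ a) (+ b)) (end₂ (+ a) (+ b))

  module W = Window lo t a I₁.increasing I₁.member⁻ I₁.member⁺
  module W̃ = Window lõ t̃ a′ I₂.increasing I₂.member⁻ I₂.member⁺
  module O = W.Operator β
  module Õ = W̃.Operator β̃

  open W using (w) public
  open W̃ using () renaming (w to w̃) public

  length-indices : length indices ≡ (a ℕ.+ b) C a
  length-indices = ≡.trans (length-subsets a [ lo ⋯ + a ℤ.- + 1 ])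
    (≡.cong (_C a) (≡.trans (≡.cong length I₁.X≡) (length-consecutive lo (a ℕ.+ b))))

  length-indices̃ : length indices̃ ≡ (a ℕ.+ b) C a′
  length-indices̃ = ≡.trans (length-subsets a′ [ lõ ⋯ + a ℤ.- + 2 ])
    (≡.cong (_C a′) (≡.trans (≡.cong length I₂.X≡) (length-consecutive lõ (a ℕ.+ b))))

  I₀≡ : I₀ ≡ consecutive (+ 0) a
  I₀≡ = interval-consecutive (+ 0) (+ a ℤ.- + 1) (size₃ (+ a))

  Ĩ₀≡ : Ĩ₀ ≡ consecutive (+ 0) a′
  Ĩ₀≡ = interval-consecutive (+ 0) (+ a ℤ.- + 2) (size₄ (+ a))

  lo≤0 : lo ℤ.≤ + 0
  lo≤0 = ℤ.neg-mono-≤ (ℤ.+≤+ ℕ.z≤n)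

  suc-lõ : ℤ.suc lõ ≡ lo
  suc-lõ = lemma (+ b)
    where
    lemma : ∀ b → ℤ.1ℤ ℤ.+ (ℤ.- b ℤ.- + 1) ≡ ℤ.- b
    lemma = solve-∀

  lõ<lo : lõ ℤ.< lo
  lõ<lo = ℤ.suc[i]≤j⇒i<j (ℤ.≤-reflexive suc-lõ)

  ω-∉ : ∀ {s} → s ∉ S → ω s ≈ 0#
  ω-∉ {s} s∉S with s ∈? S
  ... | yes s∈S = contradiction s∈S s∉S
  ... | no  _   = refl

  β-≢0 : ∀ {s} → s ≢ + 0 → β s ≈ - ω s
  β-≢0 {s} s≢0 with s ℤ.≟ + 0
  ... | yes s≡0 = contradiction s≡0 s≢0
  ... | no  _   = +-identityˡ _

  β-high : ∀ {s} → t ℤ.< s → β s ≈ 0#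
  β-high {s} t<s = trans (β-≢0 {s} (λ { ≡.refl → ℤ.<-irrefl ≡.refl (ℤ.<-≤-trans t<s (ℤ.+≤+ ℕ.z≤n)) }))
    (trans (-‿cong (ω-∉ λ s∈S → ℤ.<-irrefl ≡.refl (ℤ.<-≤-trans t<s (All.lookup (proj₂ max) s∈S)))) -0#≈0#)

  β-low : ∀ {s} → s ℤ.< lo → β s ≈ 0#
  β-low {s} s<lo = trans (β-≢0 {s} (λ { ≡.refl → ℤ.<-irrefl ≡.refl (ℤ.<-≤-trans s<lo lo≤0) }))
    (trans (-‿cong (ω-∉ λ s∈S → ℤ.<-irrefl ≡.refl (ℤ.<-≤-trans s<lo (All.lookup (proj₂ min) s∈S)))) -0#≈0#)

  β̃-high : ∀ {s} → t̃ ℤ.< s → β̃ s ≈ 0#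
  β̃-high t̃<s = trans (-‿cong (β-high (ℤ.+-monoʳ-< ℤ.1ℤ t̃<s))) -0#≈0#

  β̃-low : ∀ {s} → s ℤ.< lõ → β̃ s ≈ 0#
  β̃-low {s} s<lõ = trans
    (-‿cong (β-low (≡.subst (ℤ.suc s ℤ.<_) suc-lõ (ℤ.+-monoʳ-< ℤ.1ℤ s<lõ)))) -0#≈0#

  column : ℕ → Fin (length indices) → Carrier
  column zero    q = 𝟙 I₀ (w q)
  column (suc k) q = sum λ j → T q j * column k j

  -- `walk {k} l p` is the entry of T̃^l U T^(k-l) at row `w̃ p` and column I₀. The index in
  -- `Fin (suc k)` encodes l ≤ k, so the exponent k - l never appears.
  walk : ∀ {k} → Fin (suc k) → Fin (length indices̃) → Carrier
  walk {k}     zero    p = sum λ q → U p q * column k q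
  walk {suc k} (suc l) p = sum λ j → T̃ p j * walk l j

  -- The recursions of `column` and `walk` with matrices replaced by contractions; these act on
  -- lists that also carry the letters appended later.
  columnForm : ℕ → List ℤ → Carrier
  columnForm zero    = 𝟙 I₀
  columnForm (suc k) = O.step (columnForm k)

  walkForm : ∀ {k} → Fin (suc k) → List ℤ → Carrier
  walkForm {k}     zero    = columnForm k
  walkForm {suc k} (suc l) = Õ.step (walkForm l)

  columnForm-supported : ∀ k → W.Supported (columnForm k)
  columnForm-supported zero x L x<lo = 𝟙-≢ {I₀} {x ∷ L} λ eq → ℤ.<-irrefl ≡.refl (ℤ.<-≤-trans x<lo
    (≡.subst (lo ℤ.≤_) (≡.sym (List.∷-injectiveˡ (≡.trans eq I₀≡))) lo≤0))
  columnForm-supported (suc k) = O.step-supported β-low {columnForm k} (columnForm-supported k)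

  walkForm-supported : ∀ {k} (l : Fin (suc k)) → W̃.Supported (walkForm l)
  walkForm-supported {k}     zero    x L x<lõ = columnForm-supported k x L (ℤ.<-trans x<lõ lõ<lo)
  walkForm-supported {suc k} (suc l)          =
    Õ.step-supported β̃-low {walkForm l} (walkForm-supported l)

  column-form : ∀ k q → column k q ≈ columnForm k (w q ++ consecutive t k)
  column-form zero    q = reflexive (≡.cong (𝟙 I₀) (≡.sym (List.++-identityʳ (w q))))
  column-form (suc k) q = trans (sum-cong-≋ λ j → *-congˡ {T q j} (column-form k j))
    (O.T-step β-high {columnForm k} (columnForm-supported k) k q)

  -- U appends a-1, the same letter as a step of T̃, and the k other steps append one letter each.
  -- The tail therefore has `suc k` letters from a-1 on, whatever l is.
  walk-form : ∀ {k} (l : Fin (suc k)) p → walk l p ≈ walkForm l (w̃ p ++ consecutive t̃ (suc k))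
  walk-form {k} zero p = trans (sum-cong-≋ λ q → *-congˡ {U p q} (column-form k q))
    (trans (W.union-apply {λ L → columnForm k (L ++ consecutive t k)}
        (λ x L → columnForm-supported k x (L ++ consecutive t k))
        (ℤ.i≤pred[j]⇒i<j ℤ.≤-refl) (W̃.w∷ʳt-increasing p) (≡.cong suc (W̃.w-length p)))
      (reflexive (≡.cong (columnForm k) (List.++-assoc (w̃ p) (t̃ ∷ []) (consecutive t k)))))
  walk-form {suc k} (suc l) p = trans (sum-cong-≋ λ j → *-congˡ {T̃ p j} (walk-form l j))
    (Õ.T-step β̃-high {walkForm l} (walkForm-supported l) (suc k) p)

  -- The weights of the successive contractions read off from the original list: each step is
  -- preceded by one shift more than the previous one. The first l steps are those of T̃, the others
  -- those of T.
  rows : ∀ {k} → Fin (suc k) → Fin k → ℤ → Carrier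
  rows {suc k} zero    zero    = β
  rows {suc k} zero    (suc p) = rows {k} zero p ∘ ℤ.pred
  rows {suc k} (suc l) zero    = β̃
  rows {suc k} (suc l) (suc p) = rows l p ∘ ℤ.pred

  private
    shift-Δ : ∀ {k n} (M : Fin n → ℤ → Carrier) xs →
      Δ M (𝟙 (consecutive (+ k) a)) (map ℤ.pred xs) ≈
      Δ (λ p → M p ∘ ℤ.pred) (𝟙 (consecutive (+ suc k) a)) xs
    shift-Δ {k} M xs = trans (Δ-map ℤ.pred M (𝟙 (consecutive (+ k) a)) xs)
      (Δ-cong {M = λ p → M p ∘ ℤ.pred} (λ _ _ → refl) (λ L →
      trans (𝟙-map-pred (consecutive (+ k) a) L)
        (reflexive (≡.cong (λ J → 𝟙 J L) (map-suc-consecutive (+ k) a)))) xs)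

  -- Undoing the k shifts moves the final indicator from I₀ = [0, a-1] to [k, k+a-1].
  columnForm-Δ : ∀ k xs → columnForm k xs ≈ Δ (rows {k} zero) (𝟙 (consecutive (+ k) a)) xs
  columnForm-Δ zero    xs = reflexive (≡.cong (λ I → 𝟙 I xs) I₀≡)
  columnForm-Δ (suc k) xs = δ-congʳ
    (λ L → trans (columnForm-Δ k (map ℤ.pred L)) (shift-Δ (rows {k} zero) L)) xs

  walkForm-Δ : ∀ {k} (l : Fin (suc k)) xs → walkForm l xs ≈ Δ (rows l) (𝟙 (consecutive (+ k) a)) xs
  walkForm-Δ {k}     zero    xs = columnForm-Δ k xs
  walkForm-Δ {suc k} (suc l) xs = δ-congʳ
    (λ L → trans (walkForm-Δ l (map ℤ.pred L)) (shift-Δ (rows l) L)) xs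

  -- The rows of the minor of 1 - A obtained by deleting row l and column 0.
  minorRow : ∀ {k} → Fin (suc k) → Fin k → ℤ → Carrier
  minorRow l p c = β (ℤ.suc c ℤ.- + toℕ (punchIn l p))

  private
    cancel-suc : ∀ c → ℤ.1ℤ ℤ.+ c ℤ.- + 1 ≡ c
    cancel-suc = solve-∀
    cancel-zero : ∀ c → ℤ.1ℤ ℤ.+ c ℤ.- + 0 ≡ ℤ.1ℤ ℤ.+ c
    cancel-zero = solve-∀
    pred-shift : ∀ c m → ℤ.1ℤ ℤ.+ (ℤ.-1ℤ ℤ.+ c) ℤ.- m ≡ ℤ.1ℤ ℤ.+ c ℤ.- (ℤ.1ℤ ℤ.+ m)
    pred-shift = solve-∀

  -- Column c of the minor is column c+1 of 1 - A. For p < l its row p is row p of 1 - A and has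
  -- entry β(c+1-p) = -β̃(c-p); for p ≥ l it is row p+1, the two shifts cancel, and the entry is
  -- β(c-p). The l minus signs make up (-1)^l. The map `f` carries the shifts accumulated in the
  -- induction.
  rows-minor : ∀ {k} (l : Fin (suc k)) (f : ℤ → ℤ) {g : List ℤ → Carrier} xs →
    Δ (λ p → rows l p ∘ f) g xs ≈ (- 1#) ^ toℕ l * Δ (λ p → minorRow l p ∘ f) g xs
  rows-minor {zero}  zero    f xs = sym (*-identityˡ _)
  rows-minor {suc k} zero    f {g} xs = trans
    (δ-cong {v = β ∘ f} {minorRow {suc k} zero zero ∘ f} {Δ {n = k} (λ p → rows zero p ∘ ℤ.pred ∘ f) g} {tail}
      (λ x → reflexive (≡.cong β (≡.sym (cancel-suc (f x)))))
      (λ L → trans (rows-minor {k} zero (ℤ.pred ∘ f) L) (trans (*-identityˡ _)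
        (Δ-cong {n = k} {λ p → minorRow zero p ∘ ℤ.pred ∘ f} {λ p → minorRow zero (suc p) ∘ f} {g}
          (λ p x → reflexive (≡.cong β (pred-shift (f x) (+ suc (toℕ p))))) (λ _ → refl) L))) xs)
    (sym (*-identityˡ _))
    where
    tail : List ℤ → Carrier
    tail = Δ {n = k} (λ p → minorRow zero (suc p) ∘ f) g
  rows-minor {suc k} (suc l) f {g} xs = trans
    (δ-cong {g = Δ (λ p → rows l p ∘ ℤ.pred ∘ f) g} {h = λ L → (- 1#) ^ toℕ l * tail L}
      (λ x → -‿cong (reflexive (≡.cong β (cancel-zero′ (f x)))))
      (λ L → trans (rows-minor l (ℤ.pred ∘ f) L) (*-congˡ
        (Δ-cong {M = λ p → minorRow l p ∘ ℤ.pred ∘ f} {λ p → minorRow (suc l) (suc p) ∘ f} {g}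
          (λ p x → reflexive (≡.cong β (pred-shift (f x) (+ toℕ (punchIn l p))))) (λ _ → refl) L)))
      xs)
    (trans (δ-negˡ (minorRow (suc l) zero ∘ f) (λ L → (- 1#) ^ toℕ l * tail L) xs)
      (trans (-‿cong (δ-scale (minorRow (suc l) zero ∘ f) ((- 1#) ^ toℕ l) tail xs))
        (solve 2 (λ x y → :- (x :* y) := (:- :1 :* x) :* y) refl ((- 1#) ^ toℕ l) _)))
    where
    cancel-zero′ : ∀ c → ℤ.1ℤ ℤ.+ c ≡ ℤ.1ℤ ℤ.+ c ℤ.- + 0
    cancel-zero′ c = ≡.sym (cancel-zero c)
    tail : List ℤ → Carrier
    tail = Δ (λ p → minorRow (suc l) (suc p) ∘ f) g

  identity⊖A : ∀ k (i j : Fin (suc k)) → identity i j - A k i j ≈ β (+ toℕ j ℤ.- + toℕ i)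
  identity⊖A k i j with i Fin.≟ j | (+ toℕ j ℤ.- + toℕ i) ℤ.≟ + 0
  ... | yes _      | yes _   = refl
  ... | no _       | no _    = refl
  ... | yes ≡.refl | no  ≢0  = contradiction (ℤ.+-inverseʳ (+ toℕ i)) ≢0
  ... | no i≢j     | yes ≡0  =
    contradiction (Fin.toℕ-injective (≡.sym (ℤ.+-injective (ℤ.i-j≡0⇒i≡j (+ toℕ j) (+ toℕ i) ≡0)))) i≢j

  p₀ : Fin (length indices̃)
  p₀ = index Ĩ₀∈indices̃

  q₀ : Fin (length indices)
  q₀ = index I₀∈indices

  w̃-p₀ : w̃ p₀ ≡ consecutive (+ 0) a′
  w̃-p₀ = ≡.trans (≡.sym (lookup-index Ĩ₀∈indices̃)) Ĩ₀≡

  w-q₀ : w q₀ ≡ I₀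
  w-q₀ = ≡.sym (lookup-index I₀∈indices)

  -- One list is split in two ways. As [0, k-1] followed by [k, k+a-1], its first block is the
  -- columns of the minor and its second the letters that survive; as [0, a-2] followed by
  -- [a-1, k+a-1], it is Ĩ₀ followed by the letters the k + 1 factors append.
  F-walk : ∀ k (l : Fin (suc k)) → F k l ≈ walk l p₀
  F-walk k l = begin
    (- 1#) ^ (toℕ l ℕ.+ 0) * det (minor (λ i j → identity i j - A k i j) l zero)
      ≈⟨ *-cong (reflexive (≡.cong ((- 1#) ^_) (ℕ.+-identityʳ (toℕ l))))
           (det-cong (λ p q → identity⊖A k (punchIn l p) (suc q))) ⟩
    (- 1#) ^ toℕ l * det (λ p q → minorRow l p (+ toℕ q))
      ≈⟨ *-congˡ (det-Δ (minorRow l) (λ q → + toℕ q)) ⟩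
    (- 1#) ^ toℕ l * Δ (minorRow l) unit (tabulate (λ q → + toℕ q))
      ≡⟨ ≡.cong (λ L → (- 1#) ^ toℕ l * Δ (minorRow l) unit L) (tabulate-consecutive (+ 0) k) ⟩
    (- 1#) ^ toℕ l * Δ (minorRow l) unit (consecutive (+ 0) k)
      ≈⟨ rows-minor l id (consecutive (+ 0) k) ⟨
    Δ (rows l) unit (consecutive (+ 0) k)
      ≈⟨ Δ-strip (increasing⇒unique (increasing-consecutive (+ k) a)) (rows l) (consecutive (+ 0) k)
           (λ y∈ y∈′ → ℤ.<-irrefl ≡.refl (ℤ.<-≤-trans (proj₂ (∈-consecutive⁻ (+ 0) k y∈))
             (proj₁ (∈-consecutive⁻ (+ k) a y∈′)))) ⟨
    Δ (rows l) (𝟙 (consecutive (+ k) a)) (consecutive (+ 0) k ++ consecutive (+ k) a)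
      ≈⟨ walkForm-Δ l _ ⟨
    walkForm l (consecutive (+ 0) k ++ consecutive (+ k) a)
      ≡⟨ ≡.cong (walkForm l) list-eq ⟩
    walkForm l (w̃ p₀ ++ consecutive t̃ (suc k))
      ≈⟨ walk-form l p₀ ⟨
    walk l p₀ ∎
    where
    open SetoidReasoning setoid
    list-eq : consecutive (+ 0) k ++ consecutive (+ k) a ≡ w̃ p₀ ++ consecutive t̃ (suc k)
    list-eq = ≡.trans (≡.sym (consecutive-++ (+ 0) k a)) (≡.trans
      (≡.cong (consecutive (+ 0)) (≡.trans (ℕ.+-comm k a) (≡.sym (ℕ.+-suc a′ k))))
      (≡.trans (consecutive-++ (+ 0) a′ (suc k)) (≡.cong (_++ consecutive t̃ (suc k)) (≡.sym w̃-p₀))))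

-- The fraction for the generating function, and the top coefficient of Ñ

module Pencils (R : CommutativeRing c ℓ) {m n : ℕ}
  (T̃ : Matrices.Matrix (CommutativeRing.rawRing R) m m)
  (U : Matrices.Matrix (CommutativeRing.rawRing R) m n)
  (T : Matrices.Matrix (CommutativeRing.rawRing R) n n) where

  R[u] R[u][z] R[u]⟦z⟧ : CommutativeRing c ℓ
  R[u]    = Polys.commutativeRing R
  R[u][z] = Polys.commutativeRing R[u]
  R[u]⟦z⟧ = Series.commutativeRing R[u]

  open CommutativeRing R hiding (zero)
  module A = CommutativeRing R[u]
  module B = CommutativeRing R[u][z]
  module S = CommutativeRing R[u]⟦z⟧
  module PR = Polynomials rawRing
  module PA = Polynomials A.rawRing
  module MR = Matrices rawRing
  module MA = Matrices A.rawRing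
  module MB = Matrices B.rawRing
  module MS = Matrices S.rawRing
  module DR = Degrees R
  module DA = Degrees R[u]
  module ΣR = SemiringSum semiring
  module ΣA = SemiringSum A.semiring
  module EA = SemiringExp A.semiring
  module EB = SemiringExp B.semiring
  module κ = Homomorphisms R R[u] PR.constant (ConstantPolynomial.constant-isHom R)

  ι : Carrier → B.Carrier
  ι x = PA.constant (PR.constant x)

  ι-isHom : IsRingHomomorphism rawRing B.rawRing ι
  ι-isHom = Composition.isRingHomomorphism (λ {x} {y} {z} → B.trans {x} {y} {z})
    (ConstantPolynomial.constant-isHom R) (ConstantPolynomial.constant-isHom R[u])

  module ιH = Homomorphisms R R[u][z] ι ι-isHom
  module ιM = IsRingHomomorphism ι-isHom

  u z : B.Carrier
  u = PA.constant PR.X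
  z = PA.X

  uz-linear : DA.Linear (u B.* z) PR.X
  uz-linear = DA.linear (λ i → trans (entry 0 i) (A.zeroʳ PR.X i))
    (λ i → trans (entry 1 i) (A.*-identityʳ PR.X i)) (λ k i → trans (entry (suc (suc k)) i) (A.zeroʳ PR.X i))
    where
    entry : ∀ k → PA.coeff (u B.* z) k A.≈ PR.X A.* PA.coeff z k
    entry k i = trans (Polys.coeff-* R[u] u z k i)
      (DA.constant-* (PA.coeff u) (PA.coeff z) (λ _ → A.refl {A.0#}) k i)

  z-linear : DA.Linear z A.1#
  z-linear = DA.X-linear

  Tᶜ : MA.Matrix n n
  Tᶜ i j = PR.constant (T i j)

  T̃ᶜ : MA.Matrix m m
  T̃ᶜ i j = PR.constant (T̃ i j)

  P : MB.Matrix n n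
  P = DA.pencil z-linear Tᶜ

  P̃ : MB.Matrix m m
  P̃ = DA.pencil uz-linear T̃ᶜ

  ιU : MB.Matrix m n
  ιU i j = ι (U i j)

  D : A.Carrier
  D = Matrices.det A.rawRing (DR.pencil DR.X-linear T)

  D̃ : A.Carrier
  D̃ = Matrices.det A.rawRing (DR.pencil DR.X-linear T̃)

  D⟨z⟩ D̃⟨uz⟩ : B.Carrier
  D⟨z⟩  = evaluate rawRing B.rawRing ι D z
  D̃⟨uz⟩ = evaluate rawRing B.rawRing ι D̃ (u B.* z)

  Ñ : Fin m → Fin n → B.Carrier
  Ñ = (MB.adj P̃ MB.⊗ ιU) MB.⊗ MB.adj P

  private
    -- Substitution is a ring homomorphism, so evaluating the determinant over K[z] gives the
    -- determinant over K[u][z] that belongs to the adjugate in Ñ.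
    evaluate-det : ∀ {k} (M : MR.Matrix k k) y →
      evaluate rawRing B.rawRing ι (MA.det (DR.pencil DR.X-linear M)) y B.≈
      MB.det (MB.identity MB.⊖ y MB.· (λ i j → ι (M i j)))
    evaluate-det M y k i = trans
      (Homomorphisms.homo-det R[u] R[u][z] (λ p → evaluate rawRing B.rawRing ι p y)
        (ιH.evaluate-isHom y) (DR.pencil DR.X-linear M) k i)
      (Determinants.det-cong R[u][z]
        {M = λ i j → evaluate rawRing B.rawRing ι (DR.pencil DR.X-linear M i j) y}
        {λ i j → (MB.identity MB.⊖ y MB.· (λ i j → ι (M i j))) i j}
        (ιH.evaluate-pencil y M) k i)

  D⟨z⟩≈det : D⟨z⟩ B.≈ MB.det P
  D⟨z⟩≈det = evaluate-det T z

  D̃⟨uz⟩≈det : D̃⟨uz⟩ B.≈ MB.det P̃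
  D̃⟨uz⟩≈det = evaluate-det T̃ (u B.* z)

  -- The generating function solves the two linear systems given by P̃ and P.
  module GeneratingFunction (p₀ : Fin m) (q₀ : Fin n)
    (column : ℕ → Fin n → Carrier) (walk : ∀ {k} → Fin (suc k) → Fin m → Carrier)
    (column-zero : ∀ q → column 0 q ≈ MR.identity q q₀)
    (column-suc : ∀ k q → column (suc k) q ≈ ΣR.sum λ j → T q j * column k j)
    (walk-zero : ∀ k p → walk {k} zero p ≈ ΣR.sum λ q → U p q * column k q)
    (walk-suc : ∀ k (l : Fin (suc k)) p → walk (suc l) p ≈ ΣR.sum λ j → T̃ p j * walk l j) where

    private
      module HS = Homomorphisms R[u][z] R[u]⟦z⟧ PA.coeff (Polys.coeff-isHom R[u])
      module DetS = Determinants R[u]⟦z⟧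
      module MatS = MatrixAlgebra R[u]⟦z⟧
      module ΣS = SemiringSum S.semiring

      Ps : MS.Matrix n n
      Ps i j = PA.coeff (P i j)
      P̃s : MS.Matrix m m
      P̃s i j = PA.coeff (P̃ i j)
      Us : MS.Matrix m n
      Us i j = PA.coeff (ιU i j)
      As : MS.Matrix n n
      As i j = PA.coeff (MB.adj P i j)
      Ãs : MS.Matrix m m
      Ãs i j = PA.coeff (MB.adj P̃ i j)
      d d̃ : S.Carrier
      d = PA.coeff (MB.det P)
      d̃ = PA.coeff (MB.det P̃)

      -- With `V` and `W` below, the resolvents written coefficientwise: Z is (1 - zT)⁻¹ at the unit
      -- vector of I₀, V is U Z, and W is (1 - uzT̃)⁻¹ V, whose entry at Ĩ₀ is the generating
      -- function.
      Z : MS.Matrix n 1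
      Z q _ k = PR.constant (column k q)

      W : MS.Matrix m 1
      W p _ k = tabulate λ l → walk {k} l p

      V : MS.Matrix m 1
      V p _ k = PR.constant (walk {k} zero p)

      E : MS.Matrix n 1
      E q _ = MS.identity q q₀

      constant-sum : ∀ {k} (a b : Fin k → Carrier) →
        PR.constant (ΣR.sum λ j → a j * b j) A.≈ ΣA.sum λ j → PR.constant (a j) A.* PR.constant (b j)
      constant-sum a b = κ.homo-⊗ {1} {_} {1} (λ _ → a) (λ j _ → b j) zero zero

      constant-cong : ∀ {x y} → x ≈ y → PR.constant x A.≈ PR.constant y
      constant-cong = IsRingHomomorphism.⟦⟧-cong (ConstantPolynomial.constant-isHom R)

      PsZ : Ps MS.⊗ Z MatS.≈ᴹ E
      PsZ i zero zero = begin
        ΣS.sum (λ j → Ps i j S.* Z j zero) 0        ≈⟨ Series.sum-at R[u] (λ j → Ps i j S.* Z j zero) 0 ⟩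
        ΣA.sum (λ j → (Ps i j S.* Z j zero) 0)      ≈⟨ DA.pencil-series₀ z-linear Tᶜ (λ j → Z j zero) i ⟩
        PR.constant (column 0 i)                    ≈⟨ constant-cong (column-zero i) ⟩
        PR.constant (MR.identity i q₀)              ≈⟨ κ.homo-identity i q₀ ⟩
        MA.identity i q₀                            ≈⟨ identity-at-0 ⟩
        MS.identity i q₀ 0                          ∎
        where
        open SetoidReasoning A.setoid
        identity-at-0 : MA.identity i q₀ A.≈ MS.identity i q₀ 0
        identity-at-0 with i Fin.≟ q₀
        ... | yes _ = A.refl {A.1#}
        ... | no  _ = A.refl {A.0#}
      PsZ i zero (suc k) = begin
        ΣS.sum (λ j → Ps i j S.* Z j zero) (suc k)
          ≈⟨ Series.sum-at R[u] (λ j → Ps i j S.* Z j zero) (suc k) ⟩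
        ΣA.sum (λ j → (Ps i j S.* Z j zero) (suc k))
          ≈⟨ DA.pencil-series₊ z-linear Tᶜ (λ j → Z j zero) i k ⟩
        PR.constant (column (suc k) i) A.- A.1# A.* ΣA.sum (λ j → Tᶜ i j A.* Z j zero k)
          ≈⟨ A.+-cong {PR.constant (column (suc k) i)} {Σ} {A.- (A.1# A.* Σ)} {A.- Σ}
               (λ m → trans (constant-cong (column-suc k i) m) (constant-sum (T i) (column k) m))
               (A.-‿cong {A.1# A.* Σ} {Σ} (A.*-identityˡ Σ)) ⟩
        Σ A.- Σ
          ≈⟨ A.-‿inverseʳ Σ ⟩
        A.0# ≈⟨ identity-at-suc ⟩
        MS.identity i q₀ (suc k) ∎
        where
        open SetoidReasoning A.setoid
        Σ = ΣA.sum λ j → Tᶜ i j A.* Z j zero k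
        identity-at-suc : A.0# A.≈ MS.identity i q₀ (suc k)
        identity-at-suc with i Fin.≟ q₀
        ... | yes _ = A.refl {A.0#}
        ... | no  _ = A.refl {A.0#}

      UsZ : Us MS.⊗ Z MatS.≈ᴹ V
      UsZ p zero k = begin
        ΣS.sum (λ q → Us p q S.* Z q zero) k
          ≈⟨ Series.sum-at R[u] (λ q → Us p q S.* Z q zero) k ⟩
        ΣA.sum (λ q → (Us p q S.* Z q zero) k)
          ≈⟨ ΣA.sum-cong-≋ (λ q → DA.constant-* (Us p q) (Z q zero) (λ _ → A.refl {A.0#}) k) ⟩
        ΣA.sum (λ q → PR.constant (U p q) A.* PR.constant (column k q))
          ≈⟨ constant-sum (U p) (column k) ⟨
        PR.constant (ΣR.sum λ q → U p q * column k q)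
          ≈⟨ constant-cong (walk-zero k p) ⟨
        PR.constant (walk {k} zero p) ∎
        where open SetoidReasoning A.setoid

      coeff-tabulate-sum : ∀ {r s} (f : Fin r → Carrier) (a : Fin s → Carrier) (g : Fin s → Fin r → Carrier) →
        (∀ l → f l ≈ ΣR.sum λ j → a j * g j l) →
        ∀ i → PR.coeff (tabulate f) i ≈ ΣR.sum λ j → a j * PR.coeff (tabulate (g j)) i
      coeff-tabulate-sum {zero}  f a g f≈ i       = sym (Determinants.sum-zero R λ j → zeroʳ (a j))
      coeff-tabulate-sum {suc r} f a g f≈ zero    = f≈ zero
      coeff-tabulate-sum {suc r} f a g f≈ (suc i) =
        coeff-tabulate-sum (f ∘ suc) a (λ j → g j ∘ suc) (f≈ ∘ suc) i

      coeff-scaled-sum : ∀ {s} (a : Fin s → Carrier) (p : Fin s → A.Carrier) i →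
        PR.coeff (ΣA.sum λ j → PR.constant (a j) A.* p j) i ≈ ΣR.sum λ j → a j * PR.coeff (p j) i
      coeff-scaled-sum a p i = trans (DR.coeff-sum (λ j → PR.constant (a j) A.* p j) i)
        (Determinants.sum-cong R (λ j → PR.coeff (PR.constant (a j) A.* p j) i) (λ j → a j * PR.coeff (p j) i)
          λ j → trans (Polys.coeff-* R (PR.constant (a j)) (p j) i)
            (DR.constant-* (PR.coeff (PR.constant (a j))) (PR.coeff (p j)) (λ _ → refl) i))

      -- Multiplication by uz raises both l and k by one, so `walk-suc` cancels every coefficient
      -- with l > 0. What remains is the part l = 0, which is V.
      P̃sW : P̃s MS.⊗ W MatS.≈ᴹ V
      P̃sW p zero zero i = trans (Series.sum-at R[u] (λ j → P̃s p j S.* W j zero) 0 i)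
        (DA.pencil-series₀ uz-linear T̃ᶜ (λ j → W j zero) p i)
      P̃sW p zero (suc k) i = trans (Series.sum-at R[u] (λ j → P̃s p j S.* W j zero) (suc k) i)
        (trans (DA.pencil-series₊ uz-linear T̃ᶜ (λ j → W j zero) p k i) (at i))
        where
        tail : A.Carrier
        tail = ΣA.sum λ j → T̃ᶜ p j A.* W j zero k
        minus : ∀ i → PR.coeff (A.- (PR.X A.* tail)) i ≈ - PR.coeff (PR.X A.* tail) i
        minus = DR.coeff-neg (PR.X A.* tail)
        at : W p zero (suc k) A.- PR.X A.* tail A.≈ V p zero (suc k)
        at zero = trans (Polys.coeff-+ R (W p zero (suc k)) (A.- (PR.X A.* tail)) 0) (trans
          (+-congˡ (trans (minus 0) (-‿cong (DR.linear-*₀ DR.X-linear tail))))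
          (solve 1 (λ x → x :- :0 := x) refl _))
          where open IntegerCoefficientSolver R
        at (suc i) = trans (Polys.coeff-+ R (W p zero (suc k)) (A.- (PR.X A.* tail)) (suc i)) (trans
          (+-cong (coeff-tabulate-sum (λ l → walk (suc l) p) (T̃ p) (λ j l → walk {k} l j) (λ l → walk-suc k l p) i)
            (trans (minus (suc i)) (-‿cong (trans (DR.linear-* DR.X-linear tail i)
              (trans (*-identityˡ _) (coeff-scaled-sum (T̃ p) (λ j → W j zero k) i))))))
          (-‿inverseʳ _))

      AsPs : ∀ {k} (Q : MB.Matrix k k) i j →
        ((λ i j → PA.coeff (MB.adj Q i j)) MS.⊗ (λ i j → PA.coeff (Q i j))) i j S.≈
        PA.coeff (MB.det Q) S.* MS.identity i j
      AsPs Q i j = begin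
        ((λ i j → PA.coeff (MB.adj Q i j)) MS.⊗ (λ i j → PA.coeff (Q i j))) i j
          ≈⟨ HS.homo-⊗ (MB.adj Q) Q i j ⟨
        PA.coeff ((MB.adj Q MB.⊗ Q) i j)
          ≈⟨ Determinants.adj-⊗ R[u][z] Q i j ⟩
        PA.coeff (MB.det Q B.* MB.identity i j)
          ≈⟨ Polys.coeff-* R[u] (MB.det Q) (MB.identity i j) ⟩
        PA.coeff (MB.det Q) S.* PA.coeff (MB.identity i j)
          ≈⟨ S.*-congˡ {PA.coeff (MB.det Q)} (HS.homo-identity i j) ⟩
        PA.coeff (MB.det Q) S.* MS.identity i j ∎
        where open SetoidReasoning S.setoid

      series-Ñ : PA.coeff (Ñ p₀ q₀) S.≈ W p₀ zero S.* (d̃ S.* d)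
      series-Ñ = begin
        PA.coeff (Ñ p₀ q₀)
          ≈⟨ HS.homo-⊗ (MB.adj P̃ MB.⊗ ιU) (MB.adj P) p₀ q₀ ⟩
        ((λ i j → PA.coeff ((MB.adj P̃ MB.⊗ ιU) i j)) MS.⊗ As) p₀ q₀
          ≈⟨ DetS.⊗-congʳ {L = λ i j → PA.coeff ((MB.adj P̃ MB.⊗ ιU) i j)} {Ãs MS.⊗ Us} {As}
               (HS.homo-⊗ (MB.adj P̃) ιU) p₀ q₀ ⟩
        ((Ãs MS.⊗ Us) MS.⊗ As) p₀ q₀
          ≈⟨ MatS.cramer-twice {d = d} {d̃} {Ps} {As} {P̃s} {Ãs} {Us} {Z} {V} {W}
               q₀ (AsPs P) (AsPs P̃) PsZ UsZ P̃sW p₀ ⟩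
        W p₀ zero S.* (d̃ S.* d) ∎
        where open SetoidReasoning S.setoid

    denominator : B.Carrier
    denominator = D̃⟨uz⟩ B.* D⟨z⟩

    private
      series-denominator : PA.coeff denominator S.≈ d̃ S.* d
      series-denominator k i = trans (Polys.coeff-* R[u] D̃⟨uz⟩ D⟨z⟩ k i)
        (S.*-cong {PA.coeff D̃⟨uz⟩} {d̃} {PA.coeff D⟨z⟩} {d} D̃⟨uz⟩≈det D⟨z⟩≈det k i)

      denominator-0 : PA.coeff denominator 0 A.≈ A.1#
      denominator-0 = begin
        PA.coeff denominator 0         ≈⟨ series-denominator 0 ⟩
        d̃ 0 A.* d 0 A.+ A.0#           ≈⟨ A.+-identityʳ (d̃ 0 A.* d 0) ⟩
        d̃ 0 A.* d 0
          ≈⟨ A.*-cong {d̃ 0} {A.1#} {d 0} {A.1#} (DA.det-pencil-coeff₀ uz-linear T̃ᶜ)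
               (DA.det-pencil-coeff₀ z-linear Tᶜ) ⟩
        A.1# A.* A.1#                  ≈⟨ A.*-identityˡ A.1# ⟩
        A.1#                           ∎
        where open SetoidReasoning A.setoid

    generatingFunction-fraction : ∀ (F : ∀ k → Fin (suc k) → Carrier) → (∀ k l → F k l ≈ walk l p₀) →
      IsFraction S.rawRing (λ k → tabulate (F k)) (PA.coeff (Ñ p₀ q₀)) (PA.coeff denominator)
    generatingFunction-fraction F F≈walk = Series.isFraction R[u]
      {λ k → tabulate (F k)} {PA.coeff (Ñ p₀ q₀)} {PA.coeff denominator} denominator-0 (begin
      (λ k → tabulate (F k)) S.* PA.coeff denominator
        ≈⟨ S.*-cong {λ k → tabulate (F k)} {W p₀ zero} {PA.coeff denominator} {d̃ S.* d}
             (λ k → tabulate-cong (F≈walk k)) series-denominator ⟩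
      W p₀ zero S.* (d̃ S.* d)
        ≈⟨ series-Ñ ⟨
      PA.coeff (Ñ p₀ q₀) ∎)
      where
      open SetoidReasoning S.setoid
      tabulate-cong : ∀ {k} {f g : Fin k → Carrier} → (∀ l → f l ≈ g l) → tabulate f A.≈ tabulate g
      tabulate-cong {zero}  f≈g i       = refl
      tabulate-cong {suc k} f≈g zero    = f≈g zero
      tabulate-cong {suc k} f≈g (suc i) = tabulate-cong (f≈g ∘ suc) i

  -- Multiplying Ñ by a monomial gives a form whose top coefficient is visible.
  module TopCoefficient {p₀ : Fin m} {q₀ : Fin n} {r s : ℕ} {g h : Carrier}
    (ρs : Fin (suc r) → MR.Matrix 1 m) (σs : Fin (suc s) → MR.Matrix n 1)
    (ρ : MR.Matrix 1 m) (σ : MR.Matrix n 1)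
    (ρs-first : ∀ p → ρs zero zero p ≈ MR.identity p₀ p)
    (σs-first : ∀ q → σs zero q zero ≈ MR.identity q q₀)
    (ρs-T̃ : ∀ i j → (ρs (suc i) MR.⊗ T̃) zero j ≈ g * ρs (inject₁ i) zero j)
    (ρs-U : ∀ i j → (ρs (suc i) MR.⊗ U) zero j ≈ 0#)
    (σs-T : ∀ i j → (T MR.⊗ σs (suc i)) j zero ≈ h * σs (inject₁ i) j zero)
    (σs-U : ∀ i j → (U MR.⊗ σs (suc i)) j zero ≈ 0#)
    (ρ-T̃ : ∀ j → (ρ MR.⊗ T̃) zero j ≈ ρs (fromℕ r) zero j)
    (σ-T : ∀ j → (T MR.⊗ σ) j zero ≈ σs (fromℕ s) j zero) where

    private
      module ER = SemiringExp semiring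
      module MatB = MatrixAlgebra R[u][z]
      module DetB = Determinants R[u][z]
      open Units R

      ιᴹ : ∀ {k l} → MR.Matrix k l → MB.Matrix k l
      ιᴹ M i j = ι (M i j)

      κᴹ : ∀ {k l} → MR.Matrix k l → MA.Matrix k l
      κᴹ M i j = PR.constant (M i j)

      ι-cong : ∀ {x y} → x ≈ y → ι x B.≈ ι y
      ι-cong = ιM.⟦⟧-cong

      module Form = MatB.AdjugateForm (u B.* z) (MB.det P̃) {ιᴹ T̃} {MB.adj P̃}
        (DetB.pencil-⊗-adj (u B.* z) (ιᴹ T̃)) ιU z (MB.det P) {ιᴹ T} {MB.adj P}
        (DetB.adj-⊗-pencil z (ιᴹ T))

      Q : B.Carrier
      Q = ((((ιᴹ ρ MB.⊗ MB.adj P̃) MB.⊖ MB.det P̃ MB.· ιᴹ ρ) MB.⊗ ιU) MB.⊗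
           ((MB.adj P MB.⊗ ιᴹ σ) MB.⊖ MB.det P MB.· ιᴹ σ)) zero zero

      scalar : Carrier
      scalar = (g ER.^ r) * (h ER.^ s)

      lift-⊗ : ∀ {k l o} {L : MR.Matrix k l} {M : MR.Matrix l o} {N : MR.Matrix k o} →
        (∀ i j → (L MR.⊗ M) i j ≈ N i j) → ∀ i j → (ιᴹ L MB.⊗ ιᴹ M) i j B.≈ ι (N i j)
      lift-⊗ {L = L} {M} LM≈N i j k l = trans (sym (ιH.homo-⊗ L M i j k l)) (ι-cong (LM≈N i j) k l)

      Q≈ : Q B.≈ ((u B.* z) EB.^ suc r) B.* ((z EB.^ suc s) B.* (ι scalar B.* Ñ p₀ q₀))
      Q≈ = begin
        Q
          ≈⟨ Form.form-chain {r} {s} {ι g} {ι h} (ιᴹ ∘ ρs) (ιᴹ ∘ σs) (ιᴹ ρ) (ιᴹ σ)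
               (λ { i zero j k l → trans (lift-⊗ {L = ρs (suc i)} {T̃} {λ _ j → g * ρs (inject₁ i) zero j}
                      (λ { zero → ρs-T̃ i }) zero j k l) (ιM.*-homo g (ρs (inject₁ i) zero j) k l) })
               (λ i j k l → trans (lift-⊗ {L = ρs (suc i)} {U} {λ _ _ → 0#} (λ { zero → ρs-U i }) zero j k l)
                 (ιM.0#-homo k l))
               (λ { i j zero k l → trans (lift-⊗ {L = T} {σs (suc i)} {λ j _ → h * σs (inject₁ i) j zero}
                      (λ { j zero → σs-T i j }) j zero k l) (ιM.*-homo h (σs (inject₁ i) j zero) k l) })
               (λ i j k l → trans (lift-⊗ {L = U} {σs (suc i)} {λ _ _ → 0#} (λ { j zero → σs-U i j }) j zero k l)
                 (ιM.0#-homo k l))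
               (λ { zero j → lift-⊗ {L = ρ} {T̃} {ρs (fromℕ r)} (λ { zero → ρ-T̃ }) zero j })
               (λ { j zero → lift-⊗ {L = T} {σ} {σs (fromℕ s)} (λ { j zero → σ-T j }) j zero }) ⟩
        ((u B.* z) EB.^ suc r) B.* ((z EB.^ suc s) B.* (((ι g EB.^ r) B.* (ι h EB.^ s)) B.* form₀))
          ≈⟨ B.*-congˡ {(u B.* z) EB.^ suc r} (B.*-congˡ {z EB.^ suc s}
               (B.*-cong {(ι g EB.^ r) B.* (ι h EB.^ s)} {ι scalar} {form₀} {Ñ p₀ q₀}
                 (λ k l → sym (ι-scalar k l)) form₀≈)) ⟩
        ((u B.* z) EB.^ suc r) B.* ((z EB.^ suc s) B.* (ι scalar B.* Ñ p₀ q₀)) ∎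
        where
        open SetoidReasoning B.setoid
        form₀ : B.Carrier
        form₀ = Form.form (ιᴹ (ρs zero)) (ιᴹ (σs zero))
        form₀≈ : form₀ B.≈ Ñ p₀ q₀
        form₀≈ = Form.form-entry {p₀} {q₀} (ιᴹ (ρs zero)) (ιᴹ (σs zero))
          (λ p k l → trans (ι-cong (ρs-first p) k l) (ιH.homo-identity p₀ p k l))
          (λ q k l → trans (ι-cong (σs-first q) k l) (ιH.homo-identity q q₀ k l))
        ι-scalar : ι scalar B.≈ (ι g EB.^ r) B.* (ι h EB.^ s)
        ι-scalar k l = trans (ιM.*-homo (g ER.^ r) (h ER.^ s) k l)
          (B.*-cong {ι (g ER.^ r)} {ι g EB.^ r} {ι (h ER.^ s)} {ι h EB.^ s} (ιH.homo-^ g r) (ιH.homo-^ h s) k l)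

      one^ : ∀ k → A.1# EA.^ k A.≈ A.1#
      one^ zero      = A.refl {A.1#}
      one^ (suc k) i = trans (A.*-identityˡ (A.1# EA.^ k) i) (one^ k i)

      scaled : A.Carrier → A.Carrier
      scaled p = (PR.X EA.^ suc r) A.* (PR.constant scalar A.* p)

      coeff-Q : ∀ k → PA.coeff Q (suc r ℕ.+ (suc s ℕ.+ k)) A.≈
                      scaled (PA.coeff (Ñ p₀ q₀) k)
      coeff-Q k = begin
        PA.coeff Q (suc r ℕ.+ (suc s ℕ.+ k))
          ≈⟨ Q≈ (suc r ℕ.+ (suc s ℕ.+ k)) ⟩
        PA.coeff (((u B.* z) EB.^ suc r) B.* ((z EB.^ suc s) B.* (ι scalar B.* Ñ p₀ q₀))) (suc r ℕ.+ (suc s ℕ.+ k))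
          ≈⟨ DA.linear-^ uz-linear (suc r) ((z EB.^ suc s) B.* (ι scalar B.* Ñ p₀ q₀)) (suc s ℕ.+ k) ⟩
        (PR.X EA.^ suc r) A.* PA.coeff ((z EB.^ suc s) B.* (ι scalar B.* Ñ p₀ q₀)) (suc s ℕ.+ k)
          ≈⟨ A.*-congˡ {PR.X EA.^ suc r} (DA.linear-^ z-linear (suc s) (ι scalar B.* Ñ p₀ q₀) k) ⟩
        (PR.X EA.^ suc r) A.* ((A.1# EA.^ suc s) A.* PA.coeff (ι scalar B.* Ñ p₀ q₀) k)
          ≈⟨ A.*-congˡ {PR.X EA.^ suc r} (A.*-congʳ {PA.coeff (ι scalar B.* Ñ p₀ q₀) k} {A.1# EA.^ suc s} {A.1#} (one^ (suc s))) ⟩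
        (PR.X EA.^ suc r) A.* (A.1# A.* PA.coeff (ι scalar B.* Ñ p₀ q₀) k)
          ≈⟨ A.*-congˡ {PR.X EA.^ suc r} (A.*-identityˡ (PA.coeff (ι scalar B.* Ñ p₀ q₀) k)) ⟩
        (PR.X EA.^ suc r) A.* PA.coeff (ι scalar B.* Ñ p₀ q₀) k
          ≈⟨ A.*-congˡ {PR.X EA.^ suc r} (λ i → trans (Polys.coeff-* R[u] (ι scalar) (Ñ p₀ q₀) k i)
               (DA.constant-* (PA.coeff (ι scalar)) (PA.coeff (Ñ p₀ q₀)) (λ _ → A.refl {A.0#}) k i)) ⟩
        scaled (PA.coeff (Ñ p₀ q₀) k) ∎
        where open SetoidReasoning A.setoid

      -- The power of u is not a unit, but it only shifts coefficients. Comparing coefficients at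
      -- `suc r + i` leaves a unit of the base ring to cancel.
      scalar-cancel : Unit scalar → ∀ {p q} →
        scaled p A.≈ scaled q →
        p A.≈ q
      scalar-cancel unit {p} {q} eq i = unit-cancel unit (unit-cancel (unit-^ unit-1 (suc r))
        (trans (sym (at p)) (trans (eq (suc r ℕ.+ i)) (at q))))
        where
        at : ∀ p → PR.coeff (scaled p) (suc r ℕ.+ i) ≈
                   (1# ER.^ suc r) * (scalar * PR.coeff p i)
        at p = trans (DR.linear-^ DR.X-linear (suc r) (PR.constant scalar A.* p) i)
          (*-congˡ (trans (Polys.coeff-* R (PR.constant scalar) p i)
            (DR.constant-* (PR.coeff (PR.constant scalar)) (PR.coeff p) (λ _ → refl) i)))

      leading : ∀ {k} (M : MR.Matrix k k) y {s′} → DA.Linear y s′ →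
        PA.coeff (evaluate rawRing B.rawRing ι (MA.det (DR.pencil DR.X-linear M)) y) k A.≈
        PR.constant (PR.coeff (MA.det (DR.pencil DR.X-linear M)) k) A.* (s′ EA.^ k)
      leading {k} M y y-lin = DA.coeff-evaluate R (ConstantPolynomial.constant-isHom R) y-lin
        (MA.det (DR.pencil DR.X-linear M)) k

      d̃ d : Carrier
      d̃ = PR.coeff D̃ m
      d = PR.coeff D n

      -- The corrections d̃ ρ and d σ attain the degrees m and n in z. The factor u^m is the top
      -- coefficient of D̃ evaluated at uz, apart from the scalar.
      Q-top : DA.Top Q (m ℕ.+ n)
        (((PR.constant d̃ A.* (PR.X EA.^ m)) A.* (PR.constant d A.* (A.1# EA.^ n))) A.*
         PR.constant (((ρ MR.⊗ U) MR.⊗ σ) zero zero))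
      Q-top = DA.Top-cong {Q} {Q} {m ℕ.+ n} {leads A.* ρUσ} {leads A.* PR.constant (((ρ MR.⊗ U) MR.⊗ σ) zero zero)}
        (B.refl {Q}) (A.*-congˡ {leads} {ρUσ} (λ i → sym (constants i)))
        (DA.Top-form {Ã = MB.adj P̃} {MB.adj P} {MB.det P̃} {MB.det P}
          {PR.constant d̃ A.* (PR.X EA.^ m)} {PR.constant d A.* (A.1# EA.^ n)}
          (DA.adj-pencil-bound uz-linear T̃ᶜ) (DA.adj-pencil-bound z-linear Tᶜ)
          (DA.top (DA.bound (DA.det-pencil-top uz-linear T̃ᶜ))
            (λ i → trans (sym (D̃⟨uz⟩≈det m i)) (leading T̃ (u B.* z) uz-linear i)))
          (DA.top (DA.bound (DA.det-pencil-top z-linear Tᶜ))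
            (λ i → trans (sym (D⟨z⟩≈det n i)) (leading T z z-linear i)))
          (κᴹ ρ) (κᴹ U) (κᴹ σ))
        where
        leads ρUσ : A.Carrier
        leads = (PR.constant d̃ A.* (PR.X EA.^ m)) A.* (PR.constant d A.* (A.1# EA.^ n))
        ρUσ = ((κᴹ ρ MA.⊗ κᴹ U) MA.⊗ κᴹ σ) zero zero
        constants : PR.constant (((ρ MR.⊗ U) MR.⊗ σ) zero zero) A.≈ ρUσ
        constants i = trans (κ.homo-⊗ (ρ MR.⊗ U) σ zero zero i)
          (Determinants.⊗-congʳ R[u] {L = κᴹ (ρ MR.⊗ U)}
            {κᴹ ρ MA.⊗ κᴹ U} {κᴹ σ}
            (κ.homo-⊗ ρ U) zero zero i)

    module _ (g-unit : Unit g) (h-unit : Unit h) (r<m : suc r ℕ.≤ m) (size : suc r ℕ.+ suc s ℕ.≤ m ℕ.+ n) where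
      private
        N : ℕ
        N = (m ℕ.+ n) ℕ.∸ (suc r ℕ.+ suc s)

        unit : Unit scalar
        unit = unit-* (unit-^ g-unit r) (unit-^ h-unit s)

        reassociate : ∀ k → suc r ℕ.+ (suc s ℕ.+ k) ≡ (suc r ℕ.+ suc s) ℕ.+ k
        reassociate k = ≡.sym (ℕ.+-assoc (suc r) (suc s) k)

      Ñ-bound : PA.DegreeAtMost (Ñ p₀ q₀) N
      Ñ-bound k N<k = scalar-cancel unit {PA.coeff (Ñ p₀ q₀) k} {A.0#} (begin
        scaled (PA.coeff (Ñ p₀ q₀) k) ≈⟨ coeff-Q k ⟨
        PA.coeff Q (suc r ℕ.+ (suc s ℕ.+ k))      ≈⟨ DA.bound Q-top _ above ⟩
        A.0#                                      ≈⟨ A.zeroʳ (PR.X EA.^ suc r) ⟨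
        (PR.X EA.^ suc r) A.* A.0#                ≈⟨ A.*-congˡ {PR.X EA.^ suc r} (A.zeroʳ (PR.constant scalar)) ⟨
        scaled A.0# ∎)
        where
        open SetoidReasoning A.setoid
        above : m ℕ.+ n < suc r ℕ.+ (suc s ℕ.+ k)
        above = ≡.subst (m ℕ.+ n <_) (≡.sym (reassociate k)) (≡.subst (_< (suc r ℕ.+ suc s) ℕ.+ k)
          (ℕ.m+[n∸m]≡n size) (ℕ.+-monoʳ-< (suc r ℕ.+ suc s) N<k))

      -- Besides the leading coefficient, the equation for `x * scalar` is returned: it is what
      -- later shows that x is a unit, hence nonzero.
      Ñ-lead : ∃ λ x → x * scalar ≈ (d̃ * d) * ((ρ MR.⊗ U) MR.⊗ σ) zero zero ×
               PA.coeff (Ñ p₀ q₀) N A.≈ PR.constant x A.* (PR.X EA.^ (m ℕ.∸ suc r))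
      Ñ-lead = x , x*scalar , scalar-cancel unit {PA.coeff (Ñ p₀ q₀) N} {PR.constant x A.* (PR.X EA.^ (m ℕ.∸ suc r))} (begin
        scaled (PA.coeff (Ñ p₀ q₀) N) ≈⟨ coeff-Q N ⟨
        PA.coeff Q (suc r ℕ.+ (suc s ℕ.+ N))
          ≡⟨ ≡.cong (PA.coeff Q) (≡.trans (reassociate N) (ℕ.m+[n∸m]≡n size)) ⟩
        PA.coeff Q (m ℕ.+ n)
          ≈⟨ DA.lead Q-top ⟩
        ((PR.constant d̃ A.* (PR.X EA.^ m)) A.* (PR.constant d A.* (A.1# EA.^ n))) A.* PR.constant t
          ≈⟨ UA.collect {PR.constant d̃} {PR.constant d} {PR.constant t} {PR.X EA.^ suc r} {A.1# EA.^ n} {PR.X EA.^ m}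
               {PR.X EA.^ (m ℕ.∸ suc r)} {PR.constant scalar} {PR.constant x} (one^ n) X^m constants ⟩
        scaled (PR.constant x A.* (PR.X EA.^ (m ℕ.∸ suc r))) ∎)
        where
        open SetoidReasoning A.setoid
        module UA = Units R[u]
        t x : Carrier
        t = ((ρ MR.⊗ U) MR.⊗ σ) zero zero
        -- The scalar part of the top coefficient of Q, divided by the scalars collected along the
        -- two chains.
        x = proj₁ unit * ((d̃ * d) * t)
        x*scalar : x * scalar ≈ (d̃ * d) * t
        x*scalar = trans (*-comm x scalar) (trans (sym (*-assoc scalar (proj₁ unit) ((d̃ * d) * t)))
          (trans (*-congʳ (proj₂ unit)) (*-identityˡ _)))
        constants : PR.constant scalar A.* PR.constant x A.≈ (PR.constant d̃ A.* PR.constant d) A.* PR.constant t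
        constants zero    = solve 5 (λ s x d̃ d t → s :* x :+ :0 := s :* x) refl scalar x d̃ d t ⟨ trans ⟩
          (trans (*-comm scalar x) (trans x*scalar
            (solve 3 (λ d̃ d t → (d̃ :* d) :* t := (d̃ :* d :+ :0) :* t :+ :0) refl d̃ d t)))
          where
          open IntegerCoefficientSolver R
        constants (suc i) = refl
        X^m : PR.X EA.^ m A.≈ (PR.X EA.^ suc r) A.* (PR.X EA.^ (m ℕ.∸ suc r))
        X^m i = trans (reflexive (≡.cong (λ k → PR.coeff (PR.X EA.^ k) i) (≡.sym (ℕ.m+[n∸m]≡n r<m))))
          (EA.^-homo-* PR.X (suc r) (m ℕ.∸ suc r) i)

module FieldUnits (K : HeytingField c ℓ₁ ℓ₂) where
  open HeytingField K
  open Units (HeytingCommutativeRing.commutativeRing heytingCommutativeRing) using (Unit)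

  private
    x-0≈x : ∀ x → x - 0# ≈ x
    x-0≈x x = trans (+-congˡ (RingProperties.-0#≈0# ring)) (+-identityʳ x)
      where open CommutativeRing (HeytingCommutativeRing.commutativeRing heytingCommutativeRing) using (ring)

  #0⇒unit : ∀ {x} → x # 0# → Unit x
  #0⇒unit {x} x#0 = let (y , _ , xy≈1) = #⇒invertible x#0 in y , trans (*-congʳ (sym (x-0≈x x))) xy≈1

  unit⇒#0 : ∀ {x} → Unit x → x # 0#
  unit⇒#0 {x} (y , xy≈1) = invertible⇒# (y , trans (*-comm y _) x-0*y≈1 , x-0*y≈1)
    where
    x-0*y≈1 : (x - 0#) * y ≈ 1#
    x-0*y≈1 = trans (*-congʳ (x-0≈x x)) xy≈1

-- The chains of forced steps, and the degrees

module Conclusion (K : HeytingField c ℓ₁ ℓ₂) (S : List ℤ) (weight : ℤ → HeytingField.Carrier K) (a′ b′ : ℕ)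
  (max : (+ suc a′) IsMaximumOf S) (min : (ℤ.- (+ suc b′)) IsMinimumOf S)
  (ωa#0 : HeytingField._#_ K (Setup.ω K S weight (suc a′) (suc b′) (+ suc a′)) (HeytingField.0# K))
  (ωb#0 : HeytingField._#_ K (Setup.ω K S weight (suc a′) (suc b′) (ℤ.- (+ suc b′))) (HeytingField.0# K)) where

  b = suc b′

  open Walks K S weight a′ b max min
  open Setup K S weight a b
  open CommutativeRing KR hiding (zero)
  open HeytingField K using (_#_)
  open FieldUnits K
  open Units KR
  open Determinants KR
  open IndicatorForms KR
  open MatrixAlgebra KR using (_≈ᴹ_)
  open Matrices rawRing using (Matrix; identity; _⊗_; det)
  open SemiringExp semiring using (_^_)
  open SemiringSum semiring using (sum; sum-cong-≋; *-distribˡ-sum)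
  open IntegerCoefficientSolver KR
  module Pen = Pencils KR T̃ U T

  m n : ℕ
  m = length indices̃
  n = length indices

  βt-unit : Unit (β t)
  βt-unit = unit-cong (sym (β-≢0 λ ())) (unit-neg (#0⇒unit ωa#0))

  βlo-unit : Unit (β lo)
  βlo-unit = unit-cong (sym (β-≢0 λ ())) (unit-neg (#0⇒unit ωb#0))

  β̃t̃-unit : Unit (β̃ t̃)
  β̃t̃-unit = unit-neg βt-unit

  β̃lõ-unit : Unit (β̃ lõ)
  β̃lõ-unit = unit-neg (≡.subst (Unit ∘ β) (≡.sym suc-lõ) βlo-unit)

  private
    sign-unit : ∀ k → Unit ((- 1#) ^ k)
    sign-unit k = (- 1#) ^ k , sign² k

    inverse : ∀ {x y} k → Unit x → Unit y → Unit (x * ((- 1#) ^ k * y))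
    inverse k x-unit y-unit = unit-* x-unit (unit-* (sign-unit k) y-unit)

    κ-unit = inverse a βlo-unit βt-unit
    κ̃-unit = inverse a′ β̃lõ-unit β̃t̃-unit

    κ κ̃ : Carrier
    κ = proj₁ κ-unit
    κ̃ = proj₁ κ̃-unit

  module I = O.Inverse κ (trans (*-comm _ _) (proj₂ κ-unit)) β-low
  module Ĩ = Õ.Inverse κ̃ (trans (*-comm _ _) (proj₂ κ̃-unit)) β̃-low

  private
    -- The top coefficient of det(1 - zM) is det(-M), the factor `1#` being the linear coefficient
    -- of z; if N is a right inverse of M, then -N is one of -M.
    leading-unit : ∀ {k} (M N : Matrix k k) → M ⊗ N ≈ᴹ identity → Unit (det λ i j → - (1# * M i j))
    leading-unit M N MN≈1 = let (q , 1≈dq) = det-invertible {T = λ i j → - (1# * M i j)} {λ i j → - N i j} inv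
                            in q , sym 1≈dq
      where
      inv : ∀ i j → ((λ i j → - (1# * M i j)) ⊗ (λ i j → - N i j)) i j ≈ identity i j
      inv i j = trans
        (sum-cong (λ p → (- (1# * M i p)) * (- N p j)) (λ p → M i p * N p j) λ p →
          solve 2 (λ x y → (:- (:1 :* x)) :* (:- y) := x :* y) refl _ _)
        (MN≈1 i j)

    D-top : Pen.DR.Top D n (det λ i j → - (1# * T i j))
    D-top = Pen.DR.det-pencil-top Pen.DR.X-linear T

    D̃-top : Pen.DR.Top D̃ m (det λ i j → - (1# * T̃ i j))
    D̃-top = Pen.DR.det-pencil-top Pen.DR.X-linear T̃

  d-unit : Unit (KP.coeff D n)
  d-unit = unit-cong (sym (Pen.DR.lead D-top)) (leading-unit T I.T⁻¹ I.T-T⁻¹)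

  d̃-unit : Unit (KP.coeff D̃ m)
  d̃-unit = unit-cong (sym (Pen.DR.lead D̃-top)) (leading-unit T̃ Ĩ.T⁻¹ Ĩ.T-T⁻¹)

  D-degree : HasDegree D ((a ℕ.+ b) C a)
  D-degree = ≡.subst (HasDegree D) length-indices (unit⇒#0 d-unit , Pen.DR.bound D-top)

  D̃-degree : HasDegree D̃ ((a ℕ.+ b) C a′)
  D̃-degree = ≡.subst (HasDegree D̃) length-indices̃ (unit⇒#0 d̃-unit , Pen.DR.bound D̃-top)

  𝟙-w : ∀ {j L} → w j ≡ L → ∀ i → 𝟙 L (w i) ≈ identity i j
  𝟙-w {j} ≡.refl i = 𝟙-lookup W.idx-unique i j

  𝟙-w̃ : ∀ {j L} → w̃ j ≡ L → ∀ i → 𝟙 L (w̃ i) ≈ identity i j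
  𝟙-w̃ {j} ≡.refl i = 𝟙-lookup W̃.idx-unique i j

  fraction : IsFraction K[u]⟦z⟧ generatingFunction (toSeries Ñ) (toSeries denominator)
  fraction = Pen.GeneratingFunction.generatingFunction-fraction p₀ q₀ column walk
    (𝟙-w w-q₀) (λ k q → refl) (λ k p → refl) (λ k l p → refl) F F-walk

  -- A chain of subsets joining Ĩ₀ to the lowest one

  chain : ℕ → ℕ → List ℤ
  chain i j = consecutive lõ i ++ consecutive (+ i) j

  private
    lõ<0 : lõ ℤ.< + 0
    lõ<0 = ℤ.<-≤-trans lõ<lo lo≤0

    lõ+i<i : ∀ i → lõ ℤ.+ + i ℤ.< + i
    lõ+i<i i = ≡.subst (lõ ℤ.+ + i ℤ.<_) (ℤ.+-identityˡ (+ i)) (ℤ.+-monoˡ-< (+ i) lõ<0)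

  chain∈indices̃ : ∀ i j → i ℕ.+ j ≡ a′ → chain i j ∈ indices̃
  chain∈indices̃ i j i+j≡a′ = W̃.idx⁺
    (AllPairs.++⁺ (increasing-consecutive lõ i) (increasing-consecutive (+ i) j)
      (All.tabulate λ x∈ → All.tabulate λ y∈ → ℤ.<-≤-trans
        (ℤ.<-trans (proj₂ (∈-consecutive⁻ lõ i x∈)) (lõ+i<i i)) (proj₁ (∈-consecutive⁻ (+ i) j y∈))))
    (≡.trans (List.length-++ (consecutive lõ i))
      (≡.trans (≡.cong₂ ℕ._+_ (length-consecutive lõ i) (length-consecutive (+ i) j)) i+j≡a′))
    (λ x∈ → member (∈.∈-++⁻ (consecutive lõ i) x∈))
    where
    i≤a′ : + i ℤ.≤ + a′
    i≤a′ = ℤ.+≤+ (ℕ.≤-trans (ℕ.m≤m+n i j) (ℕ.≤-reflexive i+j≡a′))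
    member : ∀ {x} → x ∈ consecutive lõ i ⊎ x ∈ consecutive (+ i) j → lõ ℤ.≤ x × x ℤ.< t̃
    member (inj₁ x∈) = let (lõ≤x , x<) = ∈-consecutive⁻ lõ i x∈ in
      lõ≤x , ℤ.<-≤-trans (ℤ.<-trans x< (lõ+i<i i)) i≤a′
    member {x} (inj₂ x∈) = let (i≤x , x<) = ∈-consecutive⁻ (+ i) j x∈ in
      ℤ.≤-trans (ℤ.<⇒≤ lõ<0) (ℤ.≤-trans (ℤ.+≤+ ℕ.z≤n) i≤x) ,
      ≡.subst (x ℤ.<_) (≡.cong +_ i+j≡a′) x<

  private
    toℕ+rest : ∀ (i : Fin (suc a′)) → toℕ i ℕ.+ (a′ ℕ.∸ toℕ i) ≡ a′
    toℕ+rest i = ℕ.m+[n∸m]≡n (ℕ.s≤s⁻¹ (Fin.toℕ<n i))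

  chainIndex : Fin (suc a′) → Fin m
  chainIndex i = index (chain∈indices̃ (toℕ i) (a′ ℕ.∸ toℕ i) (toℕ+rest i))

  -- k and l are separate variables tied by equations, because `inject₁`, `fromℕ` and truncated
  -- subtraction do not reduce to the forms in which the chain is used.
  w̃-chainIndex : ∀ i {k l} → toℕ i ≡ k → k ℕ.+ l ≡ a′ → w̃ (chainIndex i) ≡ chain k l
  w̃-chainIndex i {k} {l} ≡.refl k+l≡a′ = ≡.trans
    (≡.sym (lookup-index (chain∈indices̃ k (a′ ℕ.∸ k) (toℕ+rest i))))
    (≡.cong (chain k) (ℕ.+-cancelˡ-≡ k _ _ (≡.trans (toℕ+rest i) (≡.sym k+l≡a′))))

  rowChain : Fin (suc a′) → Matrix 1 m
  rowChain i _ p = identity (chainIndex i) p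

  chainIndex-zero : chainIndex zero ≡ p₀
  chainIndex-zero = unique-lookup W̃.idx-unique (chainIndex zero) p₀
    (≡.trans (w̃-chainIndex zero ≡.refl ≡.refl) (≡.sym w̃-p₀))

  -- The subset starts at the lowest point of the window, so that point must be removed. Appending
  -- a-1 extends the upper block, and the shift by -1 gives the chain with one low element fewer and
  -- one high element more.
  rowChain-T̃ : ∀ i j → (rowChain (suc i) ⊗ T̃) zero j ≈ β̃ lõ * rowChain (inject₁ i) zero j
  rowChain-T̃ i j = trans (sum-identityˡ (chainIndex (suc i)) (λ q → T̃ q j)) (trans
    (Õ.T-row (chainIndex (suc i)) (w̃-chainIndex (suc i) ≡.refl 1+k+l≡a′) j)
    (*-congˡ (trans
      (reflexive (≡.cong (𝟙 (w̃ j)) (≡.trans shifted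
        (≡.sym (w̃-chainIndex (inject₁ i) (Fin.toℕ-inject₁ i) (≡.trans (ℕ.+-suc k l) 1+k+l≡a′))))))
      (𝟙-lookup W̃.idx-unique (chainIndex (inject₁ i)) j))))
    where
    k = toℕ i
    l = a′ ℕ.∸ suc k
    1+k+l≡a′ : suc k ℕ.+ l ≡ a′
    1+k+l≡a′ = toℕ+rest (suc i)
    shifted : map ℤ.pred ((consecutive (ℤ.suc lõ) k ++ consecutive (+ suc k) l) ∷ʳ t̃) ≡ chain k (suc l)
    shifted = ≡.trans (≡.cong (map ℤ.pred) (≡.trans
        (List.++-assoc (consecutive (ℤ.suc lõ) k) (consecutive (+ suc k) l) (t̃ ∷ []))
        (≡.cong (consecutive (ℤ.suc lõ) k ++_) (≡.trans
          (≡.cong (λ s → consecutive (+ suc k) l ∷ʳ + s) (≡.sym 1+k+l≡a′))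
          (≡.sym (consecutive-∷ʳ (+ suc k) l))))))
      (≡.trans (List.map-++ ℤ.pred (consecutive (ℤ.suc lõ) k) (consecutive (+ suc k) (suc l)))
        (≡.cong₂ _++_ (map-pred-consecutive lõ k) (map-pred-consecutive (+ k) (suc l))))

  -- The subset contains -b-1, which lies in no subset of [-b, a-1].
  rowChain-U : ∀ i j → (rowChain (suc i) ⊗ U) zero j ≈ 0#
  rowChain-U i j = trans (sum-identityˡ (chainIndex (suc i)) (λ p → U p j))
    (unionEntry-≢ t̃ {w̃ (chainIndex (suc i))} {w j} {lõ}
      (≡.subst (lõ ∈_) (≡.sym (w̃-chainIndex (suc i) ≡.refl (toℕ+rest (suc i)))) (here ≡.refl))
      (λ lõ∈ → ℤ.<-irrefl ≡.refl (ℤ.<-≤-trans lõ<lo (proj₁ (W.w⁻ j lõ∈)))))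

  -- A chain of subsets joining I₀ to the lowest one

  interval : ℕ → List ℤ
  interval k = consecutive (ℤ.- (+ k)) a

  columnChain : Fin (suc b) → Matrix n 1
  columnChain i q _ = 𝟙 (interval (toℕ i)) (w q)

  private
    suc-neg : ∀ k → ℤ.suc (ℤ.- (+ suc k)) ≡ ℤ.- (+ k)
    suc-neg k = lemma (+ k)
      where
      lemma : ∀ k → ℤ.1ℤ ℤ.+ (ℤ.- (ℤ.1ℤ ℤ.+ k)) ≡ ℤ.- k
      lemma = solve-∀

    interval< : ∀ k {y} → y ∈ interval (suc k) → ℤ.suc y ℤ.< t
    interval< k {y} y∈ = ℤ.<-≤-trans
      (≡.subst (ℤ.suc y ℤ.<_)
        (≡.trans (≡.sym (ℤ.+-assoc ℤ.1ℤ (ℤ.- (+ suc k)) t)) (≡.cong (ℤ._+ t) (suc-neg k)))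
        (ℤ.+-monoʳ-< ℤ.1ℤ (proj₂ (∈-consecutive⁻ (ℤ.- (+ suc k)) a y∈))))
      (≡.subst (ℤ.- (+ k) ℤ.+ t ℤ.≤_) (ℤ.+-identityˡ t)
        (ℤ.+-monoˡ-≤ t (ℤ.neg-mono-≤ {+ 0} {+ k} (ℤ.+≤+ ℕ.z≤n))))

    interval-low : ∀ (i : Fin b) → lo ℤ.≤ ℤ.- (+ suc (toℕ i))
    interval-low i = ℤ.neg-mono-≤ (ℤ.+≤+ (Fin.toℕ<n i))

  -- An interval starting below 0 still lies below a after moving up by one, so the appended a is
  -- the letter removed.
  columnChain-T : ∀ i q → (T ⊗ columnChain (suc i)) q zero ≈ ((- 1#) ^ a * β t) * columnChain (inject₁ i) q zero
  columnChain-T i q = trans (O.T-column (interval-low i) (interval< (toℕ i)) q)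
    (*-congˡ (reflexive (≡.cong (λ L → 𝟙 L (w q)) (≡.trans
      (map-suc-consecutive (ℤ.- (+ suc (toℕ i))) a)
      (≡.trans (≡.cong (λ x → consecutive x a) (suc-neg (toℕ i)))
        (≡.cong interval (≡.sym (Fin.toℕ-inject₁ i))))))))

  -- U reaches only sets containing a-1, and an interval of length a starting below 0 ends before
  -- a-1.
  columnChain-U : ∀ i p → (U ⊗ columnChain (suc i)) p zero ≈ 0#
  columnChain-U i p = trans
    (W.union-apply {𝟙 (interval (suc (toℕ i)))} (W.𝟙-supported (interval-low i)) (ℤ.i≤pred[j]⇒i<j ℤ.≤-refl)
      (W̃.w∷ʳt-increasing p) (≡.cong suc (W̃.w-length p)))
    (𝟙-≢ {interval (suc (toℕ i))} {w̃ p ∷ʳ t̃} λ eq → ℤ.<-irrefl ≡.refl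
      (interval< (toℕ i) (≡.subst (t̃ ∈_) eq (∈.∈-++⁺ʳ (w̃ p) (here ≡.refl)))))

  -- The two chains meet at the subset [-b, a-b-2]

  bottom∈indices : interval b ∈ indices
  bottom∈indices = W.idx⁺ (increasing-consecutive lo a) (length-consecutive lo a) λ {x} x∈ →
    let (lo≤x , x<) = ∈-consecutive⁻ lo a x∈ in
    lo≤x , ℤ.<-≤-trans x< (≡.subst (lo ℤ.+ t ℤ.≤_) (ℤ.+-identityˡ t) (ℤ.+-monoˡ-≤ t lo≤0))

  meet∈indices̃ : consecutive lo a′ ∈ indices̃
  meet∈indices̃ = W̃.idx⁺ (increasing-consecutive lo a′) (length-consecutive lo a′) λ {x} x∈ →
    let (lo≤x , x<) = ∈-consecutive⁻ lo a′ x∈ in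
    ℤ.≤-trans (ℤ.<⇒≤ lõ<lo) lo≤x ,
    ℤ.<-≤-trans x< (≡.subst (lo ℤ.+ t̃ ℤ.≤_) (ℤ.+-identityˡ t̃) (ℤ.+-monoˡ-≤ t̃ lo≤0))

  bottom : Fin n
  bottom = index bottom∈indices

  meet : Fin m
  meet = index meet∈indices̃

  w-bottom : w bottom ≡ interval b
  w-bottom = ≡.sym (lookup-index bottom∈indices)

  w̃-meet : w̃ meet ≡ consecutive lo a′
  w̃-meet = ≡.sym (lookup-index meet∈indices̃)

  -- One further backward step from the end of the chain. It is no longer forced, so a full row of
  -- the inverse takes the place of a multiple of a unit vector; `σ` is the same for columns.
  ρ : Matrix 1 m
  ρ _ p = Ĩ.T⁻¹ (chainIndex (fromℕ a′)) p

  σ : Matrix n 1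
  σ q _ = I.T⁻¹ q bottom

  ρ-T̃ : ∀ j → (ρ ⊗ T̃) zero j ≈ rowChain (fromℕ a′) zero j
  ρ-T̃ j = Ĩ.T⁻¹-T (chainIndex (fromℕ a′)) j

  σ-T : ∀ j → (T ⊗ σ) j zero ≈ columnChain (fromℕ b) j zero
  σ-T j = trans (I.T-T⁻¹ j bottom)
    (sym (𝟙-w (≡.trans w-bottom (≡.cong interval (≡.sym (Fin.toℕ-fromℕ b)))) j))

  -- The inverse transfer inserts -b and shifts a-1 up to a, which the bottom interval does not
  -- contain, so a is removed. What is left is -b together with the shifted subset, and this equals
  -- the bottom interval only at `meet`.
  U-σ : ∀ p → (U ⊗ σ) p zero ≈ (κ * ((- 1#) ^ a * β t)) * identity p meet
  U-σ p = begin
    sum (λ q → U p q * I.inverseForm bottom (w q))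
      ≈⟨ W.union-apply {I.inverseForm bottom} (I.T⁻¹-supported bottom) (ℤ.i≤pred[j]⇒i<j ℤ.≤-refl)
           (W̃.w∷ʳt-increasing p) (≡.cong suc (W̃.w-length p)) ⟩
    κ * δ β (𝟙 (w bottom)) (lo ∷ map ℤ.suc (w̃ p ∷ʳ t̃))
      ≡⟨ ≡.cong (λ L → κ * δ β (𝟙 (w bottom)) (lo ∷ L)) (List.map-++ ℤ.suc (w̃ p) (t̃ ∷ [])) ⟩
    κ * δ β (𝟙 (w bottom)) ((lo ∷ map ℤ.suc (w̃ p)) ∷ʳ t)
      ≈⟨ *-congˡ (δ-last β {𝟙 (w bottom)} (lo ∷ map ℤ.suc (w̃ p)) t λ ys → 𝟙-≢ {w bottom} {ys ∷ʳ t} λ eq →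
           ℤ.<-irrefl ≡.refl (proj₂ (W.w⁻ bottom (≡.subst (t ∈_) eq (∈.∈-++⁺ʳ ys (here ≡.refl)))))) ⟩
    κ * ((- 1#) ^ suc (length (map ℤ.suc (w̃ p))) * (β t * 𝟙 (w bottom) (lo ∷ map ℤ.suc (w̃ p))))
      ≈⟨ *-congˡ (*-cong
           (reflexive (≡.cong (λ k → (- 1#) ^ suc k) (≡.trans (List.length-map ℤ.suc (w̃ p)) (W̃.w-length p))))
           (*-congˡ entry)) ⟩
    κ * ((- 1#) ^ a * (β t * identity p meet))
      ≈⟨ solve 4 (λ κ s t e → κ :* (s :* (t :* e)) := (κ :* (s :* t)) :* e) refl κ ((- 1#) ^ a) (β t) _ ⟩
    (κ * ((- 1#) ^ a * β t)) * identity p meet ∎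
    where
    open SetoidReasoning setoid
    inj : ∀ {L J} → lo ∷ map ℤ.suc L ≡ lo ∷ map ℤ.suc J → L ≡ J
    inj eq = ≡.trans (≡.sym (map-pred-suc _)) (≡.trans (≡.cong (map ℤ.pred) (List.∷-injectiveʳ eq)) (map-pred-suc _))
    entry : 𝟙 (w bottom) (lo ∷ map ℤ.suc (w̃ p)) ≈ identity p meet
    entry = trans
      (reflexive (≡.cong (λ J → 𝟙 J (lo ∷ map ℤ.suc (w̃ p))) (≡.trans w-bottom
        (≡.cong (lo ∷_) (≡.sym (map-suc-consecutive lo a′))))))
      (trans (𝟙-injective {λ L → lo ∷ map ℤ.suc L} inj (consecutive lo a′) (w̃ p)) (𝟙-w̃ w̃-meet p))

  -- Shifting the lowest subset up by one already gives `meet`, so the inserted -b-1 is the letter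
  -- removed, at position zero and with sign 1.
  ρ-meet : ρ zero meet ≈ κ̃ * β̃ lõ
  ρ-meet = *-congˡ (begin
    δ β̃ (𝟙 (w̃ meet)) (lõ ∷ map ℤ.suc (w̃ (chainIndex (fromℕ a′))))
      ≡⟨ ≡.cong₂ (λ J L → δ β̃ (𝟙 J) (lõ ∷ L)) w̃-meet shifted ⟩
    δ β̃ (𝟙 (consecutive lo a′)) (lõ ∷ consecutive lo a′)
      ≈⟨ δ-𝟙-removal β̃ [] lõ (consecutive lo a′)
           (All.tabulate (λ x∈ → ℤ.<-≤-trans lõ<lo (proj₁ (∈-consecutive⁻ lo a′ x∈))) ∷
             increasing-consecutive lo a′) ⟩
    1# * β̃ lõ  ≈⟨ *-identityˡ _ ⟩
    β̃ lõ       ∎)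
    where
    open SetoidReasoning setoid
    shifted : map ℤ.suc (w̃ (chainIndex (fromℕ a′))) ≡ consecutive lo a′
    shifted = ≡.trans (≡.cong (map ℤ.suc) (≡.trans
        (w̃-chainIndex (fromℕ a′) (Fin.toℕ-fromℕ a′) (ℕ.+-identityʳ a′)) (List.++-identityʳ (consecutive lõ a′))))
      (≡.trans (map-suc-consecutive lõ a′) (≡.cong (λ x → consecutive x a′) suc-lõ))

  -- `U-σ` is supported at `meet` alone, so the sum is a product of two explicit scalars; κ and κ̃
  -- are units as inverses of units.
  ρUσ-unit : Unit (((ρ ⊗ U) ⊗ σ) zero zero)
  ρUσ-unit = unit-cong (sym (begin
      ((ρ ⊗ U) ⊗ σ) zero zero                          ≈⟨ ⊗-assoc ρ U σ zero zero ⟩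
      sum (λ p → ρ zero p * (U ⊗ σ) p zero)
        ≈⟨ sum-cong-≋ (λ p → trans (*-congˡ {ρ zero p} (U-σ p))
             (solve 3 (λ r k e → r :* (k :* e) := k :* (r :* e)) refl (ρ zero p) k₁ (identity p meet))) ⟩
      sum (λ p → k₁ * (ρ zero p * identity p meet))
        ≈⟨ *-distribˡ-sum k₁ (λ p → ρ zero p * identity p meet) ⟨
      k₁ * sum (λ p → ρ zero p * identity p meet)
        ≈⟨ *-congˡ (trans (sum-identityʳ meet (ρ zero)) ρ-meet) ⟩
      k₁ * (κ̃ * β̃ lõ)                                  ∎))
    (unit-* (unit-* (unit-inverse (proj₂ κ-unit)) (unit-* (sign-unit a) βt-unit))
      (unit-* (unit-inverse (proj₂ κ̃-unit)) β̃lõ-unit))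
    where
    open SetoidReasoning setoid
    k₁ = κ * ((- 1#) ^ a * β t)

  module Top = Pen.TopCoefficient {p₀} {q₀} {a′} {b} {β̃ lõ} {(- 1#) ^ a * β t} rowChain columnChain ρ σ
    (λ p → reflexive (≡.cong (λ i → identity i p) chainIndex-zero))
    (λ q → 𝟙-w (≡.trans w-q₀ I₀≡) q)
    rowChain-T̃ rowChain-U columnChain-T columnChain-U ρ-T̃ σ-T

  degÑ : ℕ
  degÑ = ((a ℕ.+ b ℕ.+ 1) C a) ℕ.∸ (a ℕ.+ b ℕ.+ 1)

  private
    m+n≡ : m ℕ.+ n ≡ (a ℕ.+ b ℕ.+ 1) C a
    m+n≡ = ≡.trans (≡.cong₂ ℕ._+_ length-indices̃ length-indices)
      (≡.trans (nCk+nC[k+1]≡[n+1]C[k+1] (a ℕ.+ b) a′) (≡.cong (_C a) (ℕ.+-comm 1 (a ℕ.+ b))))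

    a+b+1≡ : suc a′ ℕ.+ suc b ≡ a ℕ.+ b ℕ.+ 1
    a+b+1≡ = ≡.trans (ℕ.+-suc a b) (ℕ.+-comm 1 (a ℕ.+ b))

    N≡degÑ : (m ℕ.+ n) ℕ.∸ (suc a′ ℕ.+ suc b) ≡ degÑ
    N≡degÑ = ≡.cong₂ ℕ._∸_ m+n≡ a+b+1≡

    a′<a+b : a′ ℕ.< a ℕ.+ b
    a′<a+b = ℕ.m≤m+n a b

    size : suc a′ ℕ.+ suc b ℕ.≤ m ℕ.+ n
    size = ≡.subst₂ ℕ._≤_ (≡.sym (ℕ.+-suc a b))
      (≡.sym (≡.trans m+n≡ (≡.cong (_C a) (ℕ.+-comm (a ℕ.+ b) 1)))) (n<[n+1]C[k+1] a′<a+b)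

    a≤m : suc a′ ℕ.≤ m
    a≤m = ≡.subst (a ℕ.≤_) (≡.sym length-indices̃) (bound a′ ≡.refl)
      where
      bound : ∀ k → k ≡ a′ → suc k ℕ.≤ (a ℕ.+ b) C k
      -- For a = 1 the binomial coefficient is 1 and equality holds; the strict bound of the other
      -- case starts at a = 2.
      bound zero    _      = ℕ.≤-refl
      bound (suc k) ≡.refl = ℕ.≤-trans (ℕ.s≤s (ℕ.m≤m+n (suc k) b))
        (n<[n+1]C[k+1] {suc k ℕ.+ b} {k} (ℕ.m≤m+n (suc k) b))

  Ñ-degree : KuP.DegreeAtMost Ñ degÑ
  Ñ-degree = ≡.subst (KuP.DegreeAtMost Ñ) N≡degÑ
    (Top.Ñ-bound β̃lõ-unit (unit-* (sign-unit a) βt-unit) a≤m size)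

  Ñ-leading : ∃ λ x → x # 0# ×
    RawRing._≈_ K[u] (KuP.coeff Ñ degÑ) (x u^ (((a ℕ.+ b) C a′) ℕ.∸ a))
  Ñ-leading =
    let (x , x*s≈ , lead) = Top.Ñ-lead β̃lõ-unit (unit-* (sign-unit a) βt-unit) a≤m size
        -- The product of x with the chain scalars equals a product of units, and an inverse of that
        -- product yields one of x.
        (y , xs*y≈1)      = unit-cong (sym x*s≈) (unit-* (unit-* d̃-unit d-unit) ρUσ-unit)
    in x , unit⇒#0 (_ , trans (sym (*-assoc x _ y)) xs*y≈1) ,
       ≡.subst₂ (λ N e → RawRing._≈_ K[u] (KuP.coeff Ñ N) (x u^ e)) N≡degÑ
         (≡.cong (ℕ._∸ a) length-indices̃) lead

open import Data.Nat.Base using (_+_; _≤_)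

mainTheorem9 : ∀ {c ℓ₁ ℓ₂} (K : HeytingField c ℓ₁ ℓ₂) → CharacteristicZero K →
    (S : List ℤ) (weight : ℤ → HeytingField.Carrier K) (a b : ℕ) →
    1 ≤ a → 1 ≤ b → (+ a) IsMaximumOf S → (ℤ.- (+ b)) IsMinimumOf S →
    let open HeytingField K using (_#_)
        open HeytingField K using (0#)
        open Setup K S weight a b
        degÑ = ((a + b + 1) C a) ∸ (a + b + 1)
    in
    ω (+ a) # 0# → ω (ℤ.- (+ b)) # 0# →
    IsFraction K[u]⟦z⟧ generatingFunction (toSeries Ñ) (toSeries denominator)
    × HasDegree D ((a + b) C a)
    × HasDegree D̃ ((a + b) C (a ∸ 1))
    × KuP.DegreeAtMost Ñ degÑ
    × (∃ λ c → c # 0# × RawRing._≈_ K[u] (KuP.coeff Ñ degÑ) (c u^ (((a + b) C (a ∸ 1)) ∸ a)))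
mainTheorem9 K _ S weight (suc a′) (suc b′) _ _ max min ωa#0 ωb#0 =
  fraction , D-degree , D̃-degree , Ñ-degree , Ñ-leading
  where open Conclusion K S weight a′ b′ max min ωa#0 ωb#0
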